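{- The Balanced Connected Subgraph problem (BCS) on bicolored graphs with $n$ vertices can be solved in $O^*(2^{n/2})$ time, i.e. in time $2^{n/2}\cdot n^{O(1)}$.
   Context: All graphs are finite, simple and undirected. A graph is bicolored if every vertex is colored blue or red (adjacent vertices may have the same color); $B$ and $R$ denote the sets of blue and red vertices. The Balanced Connected Subgraph problem (BCS): the input is a bicolored graph $G=(B\cup R,E)$; the output is a connected induced subgraph $H$ of $G$ with $|V(H)\cap B|=|V(H)\cap R|$ having the maximum number of vertices. The empty subgraph (of size $0$) counts as feasible, so an optimum always exists. The notation $O^*(\cdot)$ suppresses factors polynomial in $n$. -}

module Defs where

open import Data.Bool.Base using (Bool; true; false; if_then_else_)
open import Data.Fin.Base using (Fin; toℕ)
open import Data.Fin.Subset using (Subset; Side; inside; outside; _∈_; _∩_; ∣_∣)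
open import Data.List.Base using (List; []; _∷_; _++_; map; allFin; cartesianProductWith)
open import Data.Nat.Base using (ℕ; zero; suc; _+_; _*_; _∸_; _^_; _/_; _≤_)
open import Data.Nat.Logarithm using (⌊log₂_⌋)
open import Data.Nat.Properties using (_≟_)
open import Data.Product.Base using (_×_; ∃-syntax)
open import Data.Vec.Base using (tabulate)
open import Relation.Binary.Construct.Closure.ReflexiveTransitive using (Star)
open import Relation.Binary.PropositionalEquality.Core using (_≡_)
open import Relation.Nullary.Decidable.Core using (does)

data Color : Set where
  blue red : Color

isBlue isRed : Color → Side
isBlue blue = inside
isBlue red  = outside
isRed  blue = outside
isRed  red  = inside

record BicoloredGraph (n : ℕ) : Set where
  field
    adj      : Fin n → Fin n → Bool
    symm     : ∀ u v → adj u v ≡ adj v u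
    loopless : ∀ v → adj v v ≡ false
    color    : Fin n → Color

-- An induced subgraph is given by its set of vertices.

module _ {n : ℕ} (G : BicoloredGraph n) where
  open BicoloredGraph G

  B R : Subset n
  B = tabulate λ v → isBlue (color v)
  R = tabulate λ v → isRed (color v)

  InducedEdge : Subset n → Fin n → Fin n → Set
  InducedEdge H u v = u ∈ H × v ∈ H × adj u v ≡ true

  -- The empty vertex set is connected, so that it is feasible below.
  Connected : Subset n → Set
  Connected H = ∀ {u v} → u ∈ H → v ∈ H → Star (InducedEdge H) u v

  Balanced : Subset n → Set
  Balanced H = ∣ H ∩ B ∣ ≡ ∣ H ∩ R ∣

  Feasible : Subset n → Set
  Feasible H = Connected H × Balanced H

  Optimal : Subset n → Set
  Optimal H = Feasible H × (∀ H′ → Feasible H′ → ∣ H′ ∣ ≤ ∣ H ∣)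

-- Time is measured by the logarithmic cost criterion of Aho, Hopcroft and
-- Ullman: every operand and every address is charged its bit length.  Since
-- cells hold unbounded numbers, charging one unit per instruction would
-- make the machine unreasonably powerful.

Memory : Set
Memory = ℕ → ℕ

_[_↦_] : Memory → ℕ → ℕ → Memory
(σ [ a ↦ x ]) i = if does (i ≟ a) then x else σ i

data Op : Set where
  add sub mul div : Op

-- Subtraction is truncated, division rounds down and x div 0 is 0.
⟦_⟧ₒ : Op → ℕ → ℕ → ℕ
⟦ add ⟧ₒ x y       = x + y
⟦ sub ⟧ₒ x y       = x ∸ y
⟦ mul ⟧ₒ x y       = x * y
⟦ div ⟧ₒ x zero    = 0
⟦ div ⟧ₒ x (suc y) = x / suc y

-- mem e is the content of the cell whose address is the value of e.
data Exp : Set where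
  lit : ℕ → Exp
  mem : Exp → Exp
  bin : Op → Exp → Exp → Exp

⟦_⟧ : Exp → Memory → ℕ
⟦ lit x ⟧     σ = x
⟦ mem e ⟧     σ = σ (⟦ e ⟧ σ)
⟦ bin o d e ⟧ σ = ⟦ o ⟧ₒ (⟦ d ⟧ σ) (⟦ e ⟧ σ)

-- The number of bits of x, where 0 has one bit.
bits : ℕ → ℕ
bits x = suc ⌊log₂ x ⌋

cost : Exp → Memory → ℕ
cost (lit x)     σ = bits x
cost (mem e)     σ = cost e σ + (bits (⟦ e ⟧ σ) + bits (σ (⟦ e ⟧ σ)))
cost (bin o d e) σ = cost d σ + cost e σ + (bits (⟦ d ⟧ σ) + bits (⟦ e ⟧ σ))

infixr 4 _⨾_
infix  5 _≔_

data Program : Set where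
  skip : Program
  _≔_  : Exp → Exp → Program   -- the left side is the address written to
  _⨾_  : Program → Program → Program
  cond : Exp → Program → Program → Program
  loop : Exp → Program → Program

-- ⟨ p , σ ⟩⇓⟨ t , σ′ ⟩: started in σ, the program p halts in σ′ after time t.
-- A guard holds when its value is nonzero; p , σ determine t , σ′.
infix 2 ⟨_,_⟩⇓⟨_,_⟩

guardCost : Exp → Memory → ℕ
guardCost e σ = cost e σ + bits (⟦ e ⟧ σ)

data ⟨_,_⟩⇓⟨_,_⟩ : Program → Memory → ℕ → Memory → Set where
  skip : ∀ {σ} → ⟨ skip , σ ⟩⇓⟨ 1 , σ ⟩
  assign : ∀ {σ d e} →
    ⟨ d ≔ e , σ ⟩⇓⟨ cost d σ + cost e σ + (bits (⟦ d ⟧ σ) + bits (⟦ e ⟧ σ))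
                  , σ [ ⟦ d ⟧ σ ↦ ⟦ e ⟧ σ ] ⟩
  seq : ∀ {p q σ₀ σ₁ σ₂ s t} →
    ⟨ p , σ₀ ⟩⇓⟨ s , σ₁ ⟩ → ⟨ q , σ₁ ⟩⇓⟨ t , σ₂ ⟩ →
    ⟨ p ⨾ q , σ₀ ⟩⇓⟨ s + t , σ₂ ⟩
  cond-true : ∀ {e p q σ σ′ x t} → ⟦ e ⟧ σ ≡ suc x →
    ⟨ p , σ ⟩⇓⟨ t , σ′ ⟩ →
    ⟨ cond e p q , σ ⟩⇓⟨ guardCost e σ + t , σ′ ⟩
  cond-false : ∀ {e p q σ σ′ t} → ⟦ e ⟧ σ ≡ 0 →
    ⟨ q , σ ⟩⇓⟨ t , σ′ ⟩ →
    ⟨ cond e p q , σ ⟩⇓⟨ guardCost e σ + t , σ′ ⟩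
  loop-true : ∀ {e p σ₀ σ₁ σ₂ x s t} → ⟦ e ⟧ σ₀ ≡ suc x →
    ⟨ p , σ₀ ⟩⇓⟨ s , σ₁ ⟩ → ⟨ loop e p , σ₁ ⟩⇓⟨ t , σ₂ ⟩ →
    ⟨ loop e p , σ₀ ⟩⇓⟨ guardCost e σ₀ + (s + t) , σ₂ ⟩
  loop-false : ∀ {e p σ} → ⟦ e ⟧ σ ≡ 0 →
    ⟨ loop e p , σ ⟩⇓⟨ guardCost e σ , σ ⟩

-- The list is stored from address 0 on; all other cells contain 0.
load : List ℕ → Memory
load []       _       = 0
load (x ∷ xs) zero    = x
load (x ∷ xs) (suc i) = load xs i

colorCode : Color → ℕ
colorCode blue = 0
colorCode red  = 1

-- The number of vertices, the colors, and the adjacency matrix by rows.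
encode : ∀ {n} → BicoloredGraph n → Memory
encode {n} G = load
  (n ∷ map (λ v → colorCode (color v)) (allFin n)
     ++ cartesianProductWith (λ u v → if adj u v then 1 else 0) (allFin n) (allFin n))
  where open BicoloredGraph G

isNonzero : ℕ → Side
isNonzero zero    = outside
isNonzero (suc _) = inside

-- Vertex v belongs to the output iff cell v is nonzero on halting.
output : ∀ n → Memory → Subset n
output n σ = tabulate λ v → isNonzero (σ (toℕ v))

SolvesBCSInTime : Program → (ℕ → ℕ) → Set
SolvesBCSInTime p T = ∀ {n} (G : BicoloredGraph n) →
  ∃[ t ] ∃[ σ ] ⟨ p , encode G ⟩⇓⟨ t , σ ⟩ × t ≤ T n × Optimal G (output n σ)

-- T n ≤ 2^(n/2) · c (n + 1)^k for all n, squared to avoid the irrational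
-- value of 2^(n/2) at odd n; the base n + 1 keeps the bound nonzero at n = 0.
O*[2^n/2] : (ℕ → ℕ) → Set
O*[2^n/2] T = ∃[ c ] ∃[ k ] ∀ n → T n ^ 2 ≤ 2 ^ n * (c * suc n ^ k) ^ 2

{-# OPTIONS --safe #-}
module Submission where

-- Let bl be the rarer colour, b ≤ n/2 its number of vertices, and S ⊆ bl.  If a
-- connected set contains exactly S of bl and at most |S| other vertices, it can be
-- enlarged by single vertices of the other colour to a balanced one as long as at
-- least |S| of these are reachable from S.  Such a set exists iff some plane tree
-- with at most 2|S| nodes maps homomorphically into the graph with image meeting bl
-- in S.  For each X ⊆ bl, the trees with image avoiding bl ∖ X are counted by
-- splitting off the last child of the root, and a Möbius transform over the 2 ^ b
-- sets X, removing one vertex at a time, leaves the trees covering X.  A solution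
-- is found by discarding vertices as long as the optimum does not drop.
--
-- All these quantities are entries of a single table, computed one after the other
-- from the previous ones by one expression with polynomially many operations on
-- numbers of polynomially many bits.

open import Defs
open import Data.Bool.Base using (Bool; true; false; T; if_then_else_; _∧_; _∨_; not)
open import Data.Empty using (⊥; ⊥-elim)
open import Data.Fin.Base using (Fin; zero; suc; toℕ; fromℕ<)
open import Data.Fin.Properties using (toℕ<n; toℕ-fromℕ<; toℕ-injective)
open import Data.Fin.Subset using (Subset; _∈_; _∩_; ∣_∣)
open import Data.List.Base as List using (List; []; _∷_; _++_; length; map; allFin; cartesianProductWith)
open import Data.List.Properties using (length-map; length-tabulate; length-++)
open import Data.List.Relation.Unary.All as All using (All; []; _∷_)
import Data.List.Relation.Unary.All.Properties as All
open import Data.Nat.Base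
open import Data.Nat.Divisibility using (_∣_; divides; n∣m*n; ∣n⇒∣m*n)
open import Data.Nat.DivMod using (_%_; m/n≤m; m≡m%n+[m/n]*n; m%n<n; m%n≡m∸m/n*n; n%1≡0; m<n⇒m%n≡m; [m+kn]%n≡m%n; m*n/n≡m; m<n⇒m/n≡0; m/n/o≡m/[n*o]; +-distrib-/; +-distrib-/-∣ʳ)
open import Data.Nat.Logarithm using (⌊log₂⌋-mono-≤; ⌊log₂[2^n]⌋≡n)
open import Data.Nat.Properties
open import Data.Nat.Tactic.RingSolver using (solve-∀)
open import Data.Product.Base using (_×_; _,_; ∃-syntax; proj₁; proj₂)
open import Data.Sum.Base using (_⊎_; inj₁; inj₂)
open import Data.Vec.Base using ([]; _∷_; lookup; tabulate)
open import Data.Vec.Properties using (lookup∘tabulate; lookup-zipWith; []=⇒lookup; lookup⇒[]=)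
open import Function.Base using (case_of_)
open import Relation.Binary.Construct.Closure.ReflexiveTransitive using (Star; ε; _◅_; _◅◅_; gmap; reverse)
open import Relation.Binary.Definitions using (tri<; tri≈; tri>)
open import Relation.Binary.PropositionalEquality
open import Relation.Nullary.Decidable.Core using (Dec; yes; no)

-- Connected sets themselves resist such a count, since the parts joined at a vertex would have to
-- be disjoint. Trees mapped homomorphically may reuse vertices, so the last child is chosen
-- independently of the rest of the tree, and counts for a fixed mask obey a polynomial recurrence.
-- The price is that the number of nodes only bounds the size of the image from above. This is why a
-- tree is asked to have at most `2|S|` nodes and not to be balanced, and why missing vertices are
-- supplied afterwards. Supplying them cannot disturb the minority side: the search from `S` runs
-- through `S` and the other colour only, so the first vertex at which it leaves a set containing
-- `S` has the other colour.
--
-- Only the minority colour is indexed by subsets, which is where the exponent `n/2` comes from; the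
-- self-reduction repeats the computation `n + 1` times. Under logarithmic cost the counts must also
-- be short: they are at most exponential in a polynomial. One loop over one table makes the time
-- the number of entries times the cost of a fixed expression.

update-same : ∀ (f : ℕ → ℕ) a x → (f [ a ↦ x ]) a ≡ x
update-same f a x with a ≡ᵇ a in eq
... | true  = refl
... | false = ⊥-elim (subst T eq (≡⇒≡ᵇ a a refl))

update-other : ∀ (f : ℕ → ℕ) {a b} x → b ≢ a → (f [ a ↦ x ]) b ≡ f b
update-other f {a} {b} x b≢a with b ≡ᵇ a in eq
... | true  = ⊥-elim (b≢a (≡ᵇ⇒≡ b a (subst T (sym eq) _)))
... | false = refl

update-elim : ∀ (P : ℕ → Set) (f : ℕ → ℕ) a x b → P x → P (f b) → P ((f [ a ↦ x ]) b)
update-elim P f a x b px pf with b ≡ᵇ a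
... | true  = px
... | false = pf

-- Bit lengths of values and costs of expressions

n<2^n : ∀ n → n < 2 ^ n
n<2^n zero = s≤s z≤n
n<2^n (suc n) = begin-strict
  suc n           <⟨ s<s (n<2^n n) ⟩
  1 + 2 ^ n       ≤⟨ +-monoˡ-≤ (2 ^ n) (m^n>0 2 n) ⟩
  2 ^ n + 2 ^ n   ≡⟨ cong (2 ^ n +_) (+-identityʳ (2 ^ n)) ⟨
  2 ^ suc n       ∎
  where open ≤-Reasoning

infix 4 _<₂_

-- A record, so that the bound can be inferred from the type.
record _<₂_ (x b : ℕ) : Set where
  constructor below
  field <2^ : x < 2 ^ b
open _<₂_

<₂-weaken : ∀ {x a b} → x <₂ a → a ≤ b → x <₂ b
<₂-weaken (below x<a) a≤b = below (<-≤-trans x<a (^-monoʳ-≤ 2 a≤b))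

≤-<₂ : ∀ {x y b} → x ≤ y → y <₂ b → x <₂ b
≤-<₂ x≤y (below y<b) = below (≤-<-trans x≤y y<b)

0<₂ : ∀ b → 0 <₂ b
0<₂ b = below (m^n>0 2 b)

n<₂n : ∀ n → n <₂ n
n<₂n n = below (n<2^n n)

bits-≤ : ∀ {x b} → x <₂ b → bits x ≤ suc b
bits-≤ {x} {b} (below x<b) = s≤s (≤-trans (⌊log₂⌋-mono-≤ (<⇒≤ x<b)) (≤-reflexive (⌊log₂[2^n]⌋≡n b)))

-- One bound serves all operations: a product needs the sum of the lengths, a sum one carry bit
-- beyond the larger, and truncated subtraction and division never exceed the first operand.
op-<₂ : ∀ o {x y a b} → x <₂ a → y <₂ b → ⟦ o ⟧ₒ x y <₂ (a + b + 1)
op-<₂ add {x} {y} {a} {b} (below x<a) (below y<b) = below (begin-strict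
  x + y                     <⟨ +-mono-< x<a y<b ⟩
  2 ^ a + 2 ^ b             ≤⟨ +-mono-≤ (^-monoʳ-≤ 2 (m≤m+n a b)) (^-monoʳ-≤ 2 (m≤n+m b a)) ⟩
  2 ^ (a + b) + 2 ^ (a + b) ≡⟨ cong (2 ^ (a + b) +_) (+-identityʳ _) ⟨
  2 ^ suc (a + b)           ≡⟨ cong (2 ^_) (+-comm 1 (a + b)) ⟩
  2 ^ (a + b + 1)           ∎)
  where open ≤-Reasoning
op-<₂ sub {x} {y} {a} {b} x<a y<b =
  <₂-weaken (≤-<₂ (m∸n≤m x y) x<a) (≤-trans (m≤m+n a b) (m≤m+n (a + b) 1))
op-<₂ mul {x} {y} {a} {b} (below x<a) (below y<b) = below (begin-strict
  x * y           ≤⟨ *-monoʳ-≤ x (<⇒≤ y<b) ⟩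
  x * 2 ^ b       <⟨ *-monoˡ-< (2 ^ b) ⦃ m^n≢0 2 b ⦄ x<a ⟩
  2 ^ a * 2 ^ b   ≡⟨ ^-distribˡ-+-* 2 a b ⟨
  2 ^ (a + b)     ≤⟨ ^-monoʳ-≤ 2 (m≤m+n (a + b) 1) ⟩
  2 ^ (a + b + 1) ∎)
  where open ≤-Reasoning
op-<₂ div {x} {zero} {a} {b} x<a y<b = 0<₂ _
op-<₂ div {x} {suc y} {a} {b} x<a y<b =
  <₂-weaken (≤-<₂ (m/n≤m x (suc y)) x<a) (≤-trans (m≤m+n a b) (m≤m+n (a + b) 1))

-- Bounds on the value and the cost of an expression in a memory all of whose
-- cells hold less than 2 ^ D.

valBits : Exp → ℕ → ℕ
valBits (lit x)     D = x
valBits (mem e)     D = D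
valBits (bin o d e) D = valBits d D + valBits e D + 1

costBound : Exp → ℕ → ℕ
costBound (lit x)     D = suc x
costBound (mem e)     D = costBound e D + (suc (valBits e D) + suc D)
costBound (bin o d e) D = costBound d D + costBound e D + (suc (valBits d D) + suc (valBits e D))

Bounded : ℕ → Memory → Set
Bounded D σ = ∀ i → σ i <₂ D

⟦⟧-<₂ : ∀ e {D σ} → Bounded D σ → ⟦ e ⟧ σ <₂ valBits e D
⟦⟧-<₂ (lit x) B = n<₂n x
⟦⟧-<₂ (mem e) B = B _
⟦⟧-<₂ (bin o d e) {D} B = op-<₂ o {a = valBits d D} {b = valBits e D} (⟦⟧-<₂ d B) (⟦⟧-<₂ e B)

cost-≤ : ∀ e {D σ} → Bounded D σ → cost e σ ≤ costBound e D
cost-≤ (lit x) B = bits-≤ (n<₂n x)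
cost-≤ (mem e) B = +-mono-≤ (cost-≤ e B) (+-mono-≤ (bits-≤ (⟦⟧-<₂ e B)) (bits-≤ (B _)))
cost-≤ (bin o d e) B =
  +-mono-≤ (+-mono-≤ (cost-≤ d B) (cost-≤ e B)) (+-mono-≤ (bits-≤ (⟦⟧-<₂ d B)) (bits-≤ (⟦⟧-<₂ e B)))

assignBound : Exp → Exp → ℕ → ℕ
assignBound d e D = costBound d D + costBound e D + (suc (valBits d D) + suc (valBits e D))

guardBound : Exp → ℕ → ℕ
guardBound e D = costBound e D + suc (valBits e D)

guard-≤ : ∀ e {D σ} → Bounded D σ → guardCost e σ ≤ guardBound e D
guard-≤ e B = +-mono-≤ (cost-≤ e B) (bits-≤ (⟦⟧-<₂ e B))

-- Expressions with bounded folds and their compilation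

nz : ℕ → Bool
nz zero    = false
nz (suc _) = true

-- Expressions over named variables, a table and the input; folds bind a variable
-- and always take range n rounds, which bounds their time in advance.
data Ex : Set where
  num  : ℕ → Ex
  var  : ℕ → Ex
  inp  : Ex → Ex
  get  : Ex → Ex
  op   : Op → Ex → Ex → Ex
  ite  : Ex → Ex → Ex → Ex
  fold : Op → ℕ → ℕ → Ex → Ex
  lett : ℕ → Ex → Ex → Ex

foldTo : Op → ℕ → ℕ → (ℕ → ℕ) → ℕ
foldTo o k zero    f = k
foldTo o k (suc m) f = ⟦ o ⟧ₒ (foldTo o k m f) (f m)

-- The input occupies `1 + n + n * n` cells, all below this square; from here on the memory is
-- initially zero.
base : ℕ → ℕ
base n = (n + 1) * (n + 1)

-- A single size for vertices, edge counts, levels and search steps. It exceeds `n`, because level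
-- `n` must be a valid row, and is positive even for `n = 0`.
range : ℕ → ℕ
range n = n + (n + 2)

module Eval (n : ℕ) (I : ℕ → ℕ) (z : ℕ → ℕ) where

  eval : Ex → (ℕ → ℕ) → ℕ
  eval (num k)        ρ = k
  eval (var x)        ρ = ρ x
  -- Cells from `base n` on hold variables, temporaries and the table, so reads of the input are
  -- confined to the cells below.
  eval (inp e)        ρ = if nz (base n ∸ eval e ρ) then I (eval e ρ) else 0
  eval (get e)        ρ = z (eval e ρ)
  eval (op o a b)     ρ = ⟦ o ⟧ₒ (eval a ρ) (eval b ρ)
  eval (ite c a b)    ρ = if nz (eval c ρ) then eval a ρ else eval b ρ
  eval (fold o k x b) ρ = foldTo o k (range n) (λ i → eval b (ρ [ x ↦ i ]))
  eval (lett x e b)   ρ = eval b (ρ [ x ↦ eval e ρ ])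

-- Bits of all values arising in the evaluation, when variables, table and
-- input hold less than 2 ^ M and folds have F rounds.
exBits : Ex → ℕ → ℕ → ℕ
exBits (num k)        F M = k
exBits (var x)        F M = M
exBits (inp e)        F M = M + exBits e F M
exBits (get e)        F M = M + exBits e F M
exBits (op o a b)     F M = exBits a F M + exBits b F M + 1
exBits (ite c a b)    F M = exBits c F M + (exBits a F M + exBits b F M)
exBits (fold o k x b) F M = (k + F * (exBits b F (M + F) + 1)) + (exBits b F (M + F) + (M + F))
exBits (lett x e b)   F M = (M + exBits e F M) + exBits b F (M + exBits e F M)

foldTo-<₂ : ∀ o k {f b F} → (∀ i → i < F → f i <₂ b) → ∀ m → m ≤ F → foldTo o k m f <₂ (k + m * (b + 1))
foldTo-<₂ o k f<b zero _ = <₂-weaken (n<₂n k) (m≤m+n k 0)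
foldTo-<₂ o k {f} {b} f<b (suc m) m<F =
  <₂-weaken (op-<₂ o (foldTo-<₂ o k f<b m (<⇒≤ m<F)) (f<b m m<F)) (≤-reflexive eq)
  where
  open ≡-Reasoning
  eq : k + m * (b + 1) + b + 1 ≡ k + (b + 1 + m * (b + 1))
  eq = begin
    k + m * (b + 1) + b + 1     ≡⟨ +-assoc (k + m * (b + 1)) b 1 ⟩
    k + m * (b + 1) + (b + 1)   ≡⟨ +-assoc k (m * (b + 1)) (b + 1) ⟩
    k + (m * (b + 1) + (b + 1)) ≡⟨ cong (k +_) (+-comm (m * (b + 1)) (b + 1)) ⟩
    k + (b + 1 + m * (b + 1))   ∎

module _ {n : ℕ} {I z : ℕ → ℕ} where
  open Eval n I z

  eval-<₂ : ∀ e {M ρ} → (∀ i → I i <₂ M) → (∀ i → z i <₂ M) → (∀ x → ρ x <₂ M) →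
            eval e ρ <₂ exBits e (range n) M
  eval-<₂ (num k) i z r = n<₂n k
  eval-<₂ (var x) i z r = r x
  eval-<₂ (inp e) {M} {ρ} i z r with nz (base n ∸ eval e ρ)
  ... | true  = <₂-weaken (i _) (m≤m+n M _)
  ... | false = 0<₂ _
  eval-<₂ (get e) {M} i z r = <₂-weaken (z _) (m≤m+n M _)
  eval-<₂ (op o a b) {M} i z r =
    op-<₂ o {a = exBits a (range n) M} {b = exBits b (range n) M} (eval-<₂ a i z r) (eval-<₂ b i z r)
  eval-<₂ (ite c a b) {M} {ρ} i z r with nz (eval c ρ)
  ... | true  = <₂-weaken (eval-<₂ a i z r)
                  (≤-trans (m≤m+n _ (exBits b (range n) M)) (m≤n+m _ (exBits c (range n) M)))
  ... | false = <₂-weaken (eval-<₂ b i z r)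
                  (≤-trans (m≤n+m _ (exBits a (range n) M)) (m≤n+m _ (exBits c (range n) M)))
  eval-<₂ (fold o k x b) {M} {ρ} i z r =
    <₂-weaken (foldTo-<₂ o k body (range n) ≤-refl) (m≤m+n _ _)
    where
    body : ∀ j → j < range n → eval b (ρ [ x ↦ j ]) <₂ exBits b (range n) (M + range n)
    body j j<F = eval-<₂ b (λ y → <₂-weaken (i y) (m≤m+n M _)) (λ y → <₂-weaken (z y) (m≤m+n M _))
      (λ y → update-elim (_<₂ (M + range n)) ρ x j y
        (<₂-weaken (≤-<₂ (<⇒≤ j<F) (n<₂n (range n))) (m≤n+m (range n) M)) (<₂-weaken (r y) (m≤m+n M _)))
  eval-<₂ (lett x e b) {M} {ρ} i z r =
    <₂-weaken (eval-<₂ b (λ y → <₂-weaken (i y) (m≤m+n M _)) (λ y → <₂-weaken (z y) (m≤m+n M _))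
      (λ y → update-elim (_<₂ (M + exBits e (range n) M)) ρ x _ y
        (<₂-weaken (eval-<₂ e i z r) (m≤n+m _ M)) (<₂-weaken (r y) (m≤m+n M _)))) (m≤n+m _ _)

-- Variable x, temporary r and table entry i live at base + 3x, base + 3r + 1
-- and base + 3i + 2, beyond the input.

baseE rangeE : Exp
baseE  = bin mul (bin add (mem (lit 0)) (lit 1)) (bin add (mem (lit 0)) (lit 1))
rangeE = bin add (mem (lit 0)) (bin add (mem (lit 0)) (lit 2))

varE tmpE : ℕ → Exp
varE x = bin add baseE (lit (x * 3))
tmpE r = bin add baseE (lit (1 + r * 3))

cellE : Exp → Exp
cellE e = bin add baseE (bin add (lit 2) (bin mul e (lit 3)))

foldGuard : ℕ → Exp
foldGuard x = bin sub rangeE (mem (varE x))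

accumulate : Op → ℕ → ℕ → Program
accumulate o x r =
  tmpE (suc r) ≔ bin o (mem (tmpE (suc r))) (mem (tmpE (2 + r))) ⨾
  varE x ≔ bin add (mem (varE x)) (lit 1)

-- The value is left in temporary `r`; temporaries below `r` survive and those above are scratch.
-- Binders save the outer value of their variable in a temporary and restore it: `fold` keeps it in
-- `r` and accumulates in `suc r`, `lett` keeps it in `suc r`, and both run the body from `2 + r`.
compile : Ex → ℕ → Program
compile (num k)        r = tmpE r ≔ lit k
compile (var x)        r = tmpE r ≔ mem (varE x)
compile (inp e)        r = compile e r ⨾
  cond (bin sub baseE (mem (tmpE r))) (tmpE r ≔ mem (mem (tmpE r))) (tmpE r ≔ lit 0)
compile (get e)        r = compile e r ⨾ tmpE r ≔ mem (cellE (mem (tmpE r)))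
compile (op o a b)     r = compile a r ⨾ compile b (suc r) ⨾
  tmpE r ≔ bin o (mem (tmpE r)) (mem (tmpE (suc r)))
compile (ite c a b)    r = compile c r ⨾ cond (mem (tmpE r)) (compile a r) (compile b r)
compile (fold o k x b) r =
  tmpE r ≔ mem (varE x) ⨾ tmpE (suc r) ≔ lit k ⨾ varE x ≔ lit 0 ⨾
  loop (foldGuard x) (compile b (2 + r) ⨾ accumulate o x r) ⨾
  varE x ≔ mem (tmpE r) ⨾ tmpE r ≔ mem (tmpE (suc r))
compile (lett x e b)   r =
  compile e r ⨾ tmpE (suc r) ≔ mem (varE x) ⨾ varE x ≔ mem (tmpE r) ⨾ compile b (2 + r) ⨾
  varE x ≔ mem (tmpE (suc r)) ⨾ tmpE r ≔ mem (tmpE (2 + r))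

accumulateTime : Op → ℕ → ℕ → ℕ → ℕ
accumulateTime o x r D =
  assignBound (tmpE (suc r)) (bin o (mem (tmpE (suc r))) (mem (tmpE (2 + r)))) D +
  assignBound (varE x) (bin add (mem (varE x)) (lit 1)) D

-- Both branches of a conditional and all `F` rounds of a fold are charged, so the bound does not
-- depend on the memory.
exTime : Ex → ℕ → ℕ → ℕ → ℕ
exTime (num k)        F D r = assignBound (tmpE r) (lit k) D
exTime (var x)        F D r = assignBound (tmpE r) (mem (varE x)) D
exTime (inp e)        F D r = exTime e F D r + (guardBound (bin sub baseE (mem (tmpE r))) D +
  (assignBound (tmpE r) (mem (mem (tmpE r))) D + assignBound (tmpE r) (lit 0) D))
exTime (get e)        F D r = exTime e F D r + assignBound (tmpE r) (mem (cellE (mem (tmpE r)))) D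
exTime (op o a b)     F D r = exTime a F D r + (exTime b F D (suc r) +
  assignBound (tmpE r) (bin o (mem (tmpE r)) (mem (tmpE (suc r)))) D)
exTime (ite c a b)    F D r = exTime c F D r + (guardBound (mem (tmpE r)) D + (exTime a F D r + exTime b F D r))
exTime (fold o k x b) F D r =
  assignBound (tmpE r) (mem (varE x)) D + (assignBound (tmpE (suc r)) (lit k) D + (assignBound (varE x) (lit 0) D +
  ((F * (guardBound (foldGuard x) D + (exTime b F D (2 + r) + accumulateTime o x r D)) + guardBound (foldGuard x) D) +
  (assignBound (varE x) (mem (tmpE r)) D + assignBound (tmpE r) (mem (tmpE (suc r))) D))))
exTime (lett x e b)   F D r =
  exTime e F D r + (assignBound (tmpE (suc r)) (mem (varE x)) D + (assignBound (varE x) (mem (tmpE r)) D + (exTime b F D (2 + r) +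
  (assignBound (varE x) (mem (tmpE (suc r))) D + assignBound (tmpE r) (mem (tmpE (2 + r))) D))))

-- Correctness and running time of compiled expressions

-- Keeps variables, temporaries and table apart: beyond the input they occupy the residues 0, 1 and
-- 2 modulo 3.
residue : ∀ {a b} x y → a < 3 → b < 3 → a + x * 3 ≡ b + y * 3 → a ≡ b × x ≡ y
residue {a} {b} x y a<3 b<3 eq = a≡b , *-cancelʳ-≡ x y 3 (+-cancelˡ-≡ a _ _ (trans eq (cong (_+ y * 3) (sym a≡b))))
  where
  open ≡-Reasoning
  a≡b : a ≡ b
  a≡b = begin
    a               ≡⟨ m<n⇒m%n≡m a<3 ⟨
    a % 3           ≡⟨ [m+kn]%n≡m%n a x 3 ⟨
    (a + x * 3) % 3 ≡⟨ cong (_% 3) eq ⟩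
    (b + y * 3) % 3 ≡⟨ [m+kn]%n≡m%n b y 3 ⟩
    b % 3           ≡⟨ m<n⇒m%n≡m b<3 ⟩
    b               ∎

module Semantics (n D : ℕ) where

  address : ℕ → ℕ → ℕ
  address c x = base n + (c + x * 3)

  -- Views the memory as four separate functions, so that an assignment becomes the update of one of
  -- them. `order` is stated for cell 0 because every address is computed from it; `bounded` is what
  -- limits the cost of instructions.
  record Rep (I ρ θ z : ℕ → ℕ) (σ : Memory) : Set where
    field
      input   : ∀ i → i < base n → σ i ≡ I i
      order   : σ 0 ≡ n
      vars    : ∀ x → σ (address 0 x) ≡ ρ x
      temps   : ∀ r → σ (address 1 r) ≡ θ r
      cells   : ∀ i → σ (address 2 i) ≡ z i
      bounded : Bounded D σ
  open Rep public

  private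
    variable
      I ρ θ z ρ₁ θ₁ z₁ ρ₂ θ₂ z₂ : ℕ → ℕ
      σ : Memory

  base-pos : 0 < base n
  base-pos = subst (0 <_) (cong₂ _*_ (+-comm 1 n) (+-comm 1 n)) z<s

  write-same : ∀ σ {c} (f : ℕ → ℕ) → c < 3 → (∀ w → σ (address c w) ≡ f w) → ∀ x y w →
               (σ [ address c x ↦ y ]) (address c w) ≡ (f [ x ↦ y ]) w
  write-same σ {c} f c<3 eq x y w with w ≟ x
  ... | yes refl = trans (update-same σ (address c x) y) (sym (update-same f x y))
  ... | no w≢x = trans (update-other σ y λ e → w≢x (proj₂ (residue w x c<3 c<3 (+-cancelˡ-≡ (base n) _ _ e))))
                   (trans (eq w) (sym (update-other f y w≢x)))

  write-other : ∀ σ {c d} (f : ℕ → ℕ) → c < 3 → d < 3 → d ≢ c → (∀ w → σ (address d w) ≡ f w) → ∀ x y w →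
                (σ [ address c x ↦ y ]) (address d w) ≡ f w
  write-other σ {c} {d} f c<3 d<3 d≢c eq x y w =
    trans (update-other σ y λ e → d≢c (proj₁ (residue w x d<3 c<3 (+-cancelˡ-≡ (base n) _ _ e)))) (eq w)

  write-input : ∀ σ c x y {i} → i < base n → (σ [ address c x ↦ y ]) i ≡ σ i
  write-input σ c x y i<b =
    update-other σ y λ { refl → <-irrefl refl (<-≤-trans i<b (m≤m+n (base n) _)) }

  write-bounded : ∀ σ a {y} → y <₂ D → Bounded D σ → Bounded D (σ [ a ↦ y ])
  write-bounded σ a y<D B i = update-elim (_<₂ D) σ a _ i y<D (B i)

  write-var : ∀ x {y} → y <₂ D → Rep I ρ θ z σ → Rep I (ρ [ x ↦ y ]) θ z (σ [ address 0 x ↦ y ])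
  write-var {ρ = ρ} {θ = θ} {z = z} {σ = σ} x {y} y<D S = record
    { input = λ i i<b → trans (write-input σ 0 x y i<b) (input S i i<b)
    ; order = trans (write-input σ 0 x y base-pos) (order S)
    ; vars = write-same σ ρ z<s (vars S) x y
    ; temps = write-other σ θ z<s (s<s z<s) (λ ()) (temps S) x y
    ; cells = write-other σ z z<s (s<s (s<s z<s)) (λ ()) (cells S) x y
    ; bounded = write-bounded σ _ y<D (bounded S) }

  write-tmp : ∀ r {y} → y <₂ D → Rep I ρ θ z σ → Rep I ρ (θ [ r ↦ y ]) z (σ [ address 1 r ↦ y ])
  write-tmp {ρ = ρ} {θ = θ} {z = z} {σ = σ} x {y} y<D S = record
    { input = λ i i<b → trans (write-input σ 1 x y i<b) (input S i i<b)
    ; order = trans (write-input σ 1 x y base-pos) (order S)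
    ; vars = write-other σ ρ (s<s z<s) z<s (λ ()) (vars S) x y
    ; temps = write-same σ θ (s<s z<s) (temps S) x y
    ; cells = write-other σ z (s<s z<s) (s<s (s<s z<s)) (λ ()) (cells S) x y
    ; bounded = write-bounded σ _ y<D (bounded S) }

  write-cell : ∀ r {y} → y <₂ D → Rep I ρ θ z σ → Rep I ρ θ (z [ r ↦ y ]) (σ [ address 2 r ↦ y ])
  write-cell {ρ = ρ} {θ = θ} {z = z} {σ = σ} x {y} y<D S = record
    { input = λ i i<b → trans (write-input σ 2 x y i<b) (input S i i<b)
    ; order = trans (write-input σ 2 x y base-pos) (order S)
    ; vars = write-other σ ρ (s<s (s<s z<s)) z<s (λ ()) (vars S) x y
    ; temps = write-other σ θ (s<s (s<s z<s)) (s<s z<s) (λ ()) (temps S) x y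
    ; cells = write-same σ z (s<s (s<s z<s)) (cells S) x y
    ; bounded = write-bounded σ _ y<D (bounded S) }

  -- Without function extensionality, overwritten or restored updates agree with the intended
  -- function only pointwise.
  recast : (∀ x → ρ x ≡ ρ₁ x) → Rep I ρ θ z σ → Rep I ρ₁ θ z σ
  recast eq S = record
    { input = input S ; order = order S ; vars = λ x → trans (vars S x) (eq x)
    ; temps = temps S ; cells = cells S ; bounded = bounded S }

  base-val : Rep I ρ θ z σ → ⟦ baseE ⟧ σ ≡ base n
  base-val S = cong base (order S)

  range-val : Rep I ρ θ z σ → ⟦ rangeE ⟧ σ ≡ range n
  range-val S = cong range (order S)

  varE-val : ∀ x → Rep I ρ θ z σ → ⟦ varE x ⟧ σ ≡ address 0 x
  varE-val x S = cong (_+ x * 3) (base-val S)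

  tmpE-val : ∀ r → Rep I ρ θ z σ → ⟦ tmpE r ⟧ σ ≡ address 1 r
  tmpE-val r S = cong (_+ (1 + r * 3)) (base-val S)

  cellE-val : ∀ e {i} → Rep I ρ θ z σ → ⟦ e ⟧ σ ≡ i → ⟦ cellE e ⟧ σ ≡ address 2 i
  cellE-val e S eq = cong₂ (λ a i → a + (2 + i * 3)) (base-val S) eq

  var-val : ∀ x → Rep I ρ θ z σ → ⟦ mem (varE x) ⟧ σ ≡ ρ x
  var-val {σ = σ} x S = trans (cong σ (varE-val x S)) (vars S x)

  tmp-val : ∀ r → Rep I ρ θ z σ → ⟦ mem (tmpE r) ⟧ σ ≡ θ r
  tmp-val {σ = σ} r S = trans (cong σ (tmpE-val r S)) (temps S r)

  cell-val : ∀ e {i} → Rep I ρ θ z σ → ⟦ e ⟧ σ ≡ i → ⟦ mem (cellE e) ⟧ σ ≡ z i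
  cell-val {σ = σ} e {i} S eq = trans (cong σ (cellE-val e S eq)) (cells S i)

  -- A Hoare triple for total correctness with a time bound, over the abstract view of the memory.
  record Does (I : ℕ → ℕ) (p : Program) (t : ℕ) (ρ θ z ρ₁ θ₁ z₁ : ℕ → ℕ) : Set where
    constructor runs
    field
      execute : ∀ σ → Rep I ρ θ z σ →
        ∃[ t₁ ] ∃[ σ₁ ] ⟨ p , σ ⟩⇓⟨ t₁ , σ₁ ⟩ × t₁ ≤ t × Rep I ρ₁ θ₁ z₁ σ₁
  open Does public

  infixr 4 _⨟_
  _⨟_ : ∀ {p q s t} → Does I p s ρ θ z ρ₁ θ₁ z₁ → Does I q t ρ₁ θ₁ z₁ ρ₂ θ₂ z₂ →
        Does I (p ⨾ q) (s + t) ρ θ z ρ₂ θ₂ z₂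
  (P ⨟ Q) .execute σ S with execute P σ S
  ... | s , σ₁ , run , s≤ , S₁ with execute Q σ₁ S₁
  ... | t , σ₂ , run′ , t≤ , S₂ = s + t , σ₂ , seq run run′ , +-mono-≤ s≤ t≤ , S₂

  assign-≤ : ∀ d e → Bounded D σ →
             cost d σ + cost e σ + (bits (⟦ d ⟧ σ) + bits (⟦ e ⟧ σ)) ≤ assignBound d e D
  assign-≤ d e B = +-mono-≤ (+-mono-≤ (cost-≤ d B) (cost-≤ e B)) (+-mono-≤ (bits-≤ (⟦⟧-<₂ d B)) (bits-≤ (⟦⟧-<₂ e B)))

  set-tmp : ∀ r e {y} → y <₂ D → (∀ {σ} → Rep I ρ θ z σ → ⟦ e ⟧ σ ≡ y) →
            Does I (tmpE r ≔ e) (assignBound (tmpE r) e D) ρ θ z ρ (θ [ r ↦ y ]) z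
  set-tmp r e {y} y<D val .execute σ S = _ , _ , assign , assign-≤ (tmpE r) e (bounded S) ,
    subst (Rep _ _ _ _) (sym (cong₂ (λ a x → σ [ a ↦ x ]) (tmpE-val r S) (val S))) (write-tmp r y<D S)

  set-var : ∀ x e {y} → y <₂ D → (∀ {σ} → Rep I ρ θ z σ → ⟦ e ⟧ σ ≡ y) →
            Does I (varE x ≔ e) (assignBound (varE x) e D) ρ θ z (ρ [ x ↦ y ]) θ z
  set-var r e {y} y<D val .execute σ S = _ , _ , assign , assign-≤ (varE r) e (bounded S) ,
    subst (Rep _ _ _ _) (sym (cong₂ (λ a x → σ [ a ↦ x ]) (varE-val r S) (val S))) (write-var r y<D S)

  set-cell : ∀ d e {i y} → y <₂ D → (∀ {σ} → Rep I ρ θ z σ → ⟦ d ⟧ σ ≡ i) → (∀ {σ} → Rep I ρ θ z σ → ⟦ e ⟧ σ ≡ y) →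
            Does I (cellE d ≔ e) (assignBound (cellE d) e D) ρ θ z ρ θ (z [ i ↦ y ])
  set-cell d e {i} {y} y<D addr val .execute σ S = _ , _ , assign , assign-≤ (cellE d) e (bounded S) ,
    subst (Rep _ _ _ _) (sym (cong₂ (λ a x → σ [ a ↦ x ]) (cellE-val d S (addr S)) (val S))) (write-cell i y<D S)

  branch-true : ∀ e p q {s t y} → (∀ {σ} → Rep I ρ θ z σ → ⟦ e ⟧ σ ≡ y) → nz y ≡ true →
                Does I p s ρ θ z ρ₁ θ₁ z₁ → Does I (cond e p q) (guardBound e D + (s + t)) ρ θ z ρ₁ θ₁ z₁
  branch-true e p q {s} {t} {suc y} val eq P .execute σ S with execute P σ S
  ... | s₁ , σ₁ , run , s≤ , S₁ =
    _ , σ₁ , cond-true (val S) run , +-mono-≤ (guard-≤ e (bounded S)) (≤-trans s≤ (m≤m+n s t)) , S₁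

  branch-false : ∀ e p q {s t y} → (∀ {σ} → Rep I ρ θ z σ → ⟦ e ⟧ σ ≡ y) → nz y ≡ false →
                Does I q t ρ θ z ρ₁ θ₁ z₁ → Does I (cond e p q) (guardBound e D + (s + t)) ρ θ z ρ₁ θ₁ z₁
  branch-false e p q {s} {t} {zero} val eq P .execute σ S with execute P σ S
  ... | s₁ , σ₁ , run , s≤ , S₁ =
    _ , σ₁ , cond-false (val S) run , +-mono-≤ (guard-≤ e (bounded S)) (≤-trans s≤ (m≤n+m t s)) , S₁

  loop-stop : ∀ e p → (∀ {σ} → Rep I ρ θ z σ → ⟦ e ⟧ σ ≡ 0) → Does I (loop e p) (guardBound e D) ρ θ z ρ θ z
  loop-stop e p val .execute σ S = _ , σ , loop-false (val S) , guard-≤ e (bounded S) , S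

  loop-step : ∀ e p {s t y} → (∀ {σ} → Rep I ρ θ z σ → ⟦ e ⟧ σ ≡ suc y) →
              Does I p s ρ θ z ρ₁ θ₁ z₁ → Does I (loop e p) t ρ₁ θ₁ z₁ ρ₂ θ₂ z₂ →
              Does I (loop e p) (guardBound e D + s + t) ρ θ z ρ₂ θ₂ z₂
  loop-step e p {s} {t} val P L .execute σ S with execute P σ S
  ... | s₁ , σ₁ , run , s≤ , S₁ with execute L σ₁ S₁
  ... | t₂ , σ₂ , run₂ , t≤ , S₂ = _ , σ₂ , loop-true (val S) run run₂ ,
    ≤-trans (+-mono-≤ (guard-≤ e (bounded S)) (+-mono-≤ s≤ t≤)) (≤-reflexive (sym (+-assoc (guardBound e D) s t))) , S₂

  recast-post : ∀ {p t} → (∀ x → ρ₁ x ≡ ρ₂ x) → Does I p t ρ θ z ρ₁ θ₁ z₁ → Does I p t ρ θ z ρ₂ θ₁ z₁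
  recast-post eq P .execute σ S with execute P σ S
  ... | t , σ₁ , run , t≤ , S₁ = t , σ₁ , run , t≤ , recast eq S₁

  retime : ∀ {p s t} → s ≡ t → Does I p s ρ θ z ρ₁ θ₁ z₁ → Does I p t ρ θ z ρ₁ θ₁ z₁
  retime refl P = P

  update-twice : ∀ (ρ : ℕ → ℕ) x a b y → ((ρ [ x ↦ a ]) [ x ↦ b ]) y ≡ (ρ [ x ↦ b ]) y
  update-twice ρ x a b y with y ≡ᵇ x
  ... | true = refl
  ... | false = refl

  update-restore : ∀ (ρ : ℕ → ℕ) x a y → ((ρ [ x ↦ a ]) [ x ↦ ρ x ]) y ≡ ρ y
  update-restore ρ x a y with y ≡ᵇ x in eq
  ... | true = cong ρ (sym (≡ᵇ⇒≡ y x (subst T (sym eq) _)))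
  ... | false = refl

  Computes : (I : ℕ → ℕ) → Program → ℕ → (ρ θ z : ℕ → ℕ) → ℕ → ℕ → Set
  Computes I p t ρ θ z r v = ∃[ θ₁ ] Does I p t ρ θ z ρ θ₁ z × θ₁ r ≡ v × (∀ q → q < r → θ₁ q ≡ θ q)

  frame-tmp : ∀ (θ : ℕ → ℕ) r {y q} → q < r → (θ [ r ↦ y ]) q ≡ θ q
  frame-tmp θ r q<r = update-other θ _ (<⇒≢ q<r)

  module _ (I z : ℕ → ℕ) where
    open Eval n I z

    -- Induction on the expression. `exBits` of an expression dominates that of its parts, with `M`
    -- enlarged under binders, so one hypothesis on `D` also makes all intermediate values fit.
    compile-ok : ∀ e r {ρ θ M} → (∀ i → I i <₂ M) → (∀ i → z i <₂ M) → (∀ x → ρ x <₂ M) →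
                 exBits e (range n) M ≤ D →
                 Computes I (compile e r) (exTime e (range n) D r) ρ θ z r (eval e ρ)
    compile-ok (num k) r {ρ} {θ} i z r< b = θ [ r ↦ k ] ,
      set-tmp r (lit k) (<₂-weaken (n<₂n k) b) (λ S → refl) , update-same θ r k , λ q → frame-tmp θ r
    compile-ok (var x) r {ρ} {θ} i z r< b = θ [ r ↦ ρ x ] ,
      set-tmp r (mem (varE x)) (<₂-weaken (r< x) b) (var-val x) , update-same θ r _ , λ q → frame-tmp θ r
    compile-ok (inp e) r {ρ} {θ} {M} i z r< b
      with compile-ok e r {ρ} {θ} i z r< (≤-trans (m≤n+m _ M) b)
    ... | θ₁ , P , val , fr with nz (base n ∸ eval e ρ) in eq
    ... | true = θ₁ [ r ↦ I (eval e ρ) ] ,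
      (P ⨟ branch-true (bin sub baseE (mem (tmpE r))) _ _ {t = assignBound (tmpE r) (lit 0) D}
        (λ S → cong₂ _∸_ (base-val S) (trans (tmp-val r S) val)) eq
        (set-tmp r (mem (mem (tmpE r))) (<₂-weaken (i _) (≤-trans (m≤m+n M _) b))
          (λ {σ} S → trans (cong σ (trans (tmp-val r S) val)) (input S _ (nz-∸ (base n) (eval e ρ) eq))))) ,
      update-same θ₁ r _ , λ q q<r → trans (frame-tmp θ₁ r q<r) (fr q q<r)
      where
      nz-∸ : ∀ m k → nz (m ∸ k) ≡ true → k < m
      nz-∸ (suc m) zero _ = z<s
      nz-∸ (suc m) (suc k) eq = s<s (nz-∸ m k eq)
      nz-∸ zero zero ()
      nz-∸ zero (suc k) ()
    ... | false = θ₁ [ r ↦ 0 ] ,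
      (P ⨟ branch-false (bin sub baseE (mem (tmpE r))) _ _ {s = assignBound (tmpE r) (mem (mem (tmpE r))) D}
        (λ S → cong₂ _∸_ (base-val S) (trans (tmp-val r S) val)) eq
        (set-tmp r (lit 0) (0<₂ D) (λ S → refl))) ,
      update-same θ₁ r _ , λ q q<r → trans (frame-tmp θ₁ r q<r) (fr q q<r)
    compile-ok (get e) r {ρ} {θ} {M} i z< r< b
      with compile-ok e r {ρ} {θ} i z< r< (≤-trans (m≤n+m _ M) b)
    ... | θ₁ , P , val , fr = θ₁ [ r ↦ z (eval e ρ) ] ,
      (P ⨟ set-tmp r (mem (cellE (mem (tmpE r)))) (<₂-weaken (z< _) (≤-trans (m≤m+n M _) b))
        (λ S → cell-val (mem (tmpE r)) S (trans (tmp-val r S) val))) ,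
      update-same θ₁ r _ , λ q q<r → trans (frame-tmp θ₁ r q<r) (fr q q<r)
    compile-ok (op o a c) r {ρ} {θ} {M} i z r< b
      with compile-ok a r {ρ} {θ} i z r< (≤-trans (≤-trans (m≤m+n _ _) (m≤m+n _ 1)) b)
    ... | θ₁ , P , val , fr
      with compile-ok c (suc r) {ρ} {θ₁} i z r< (≤-trans (≤-trans (m≤n+m _ (exBits a (range n) M)) (m≤m+n _ 1)) b)
    ... | θ₂ , P₂ , val₂ , fr₂ = θ₂ [ r ↦ eval (op o a c) ρ ] ,
      (P ⨟ P₂ ⨟ set-tmp r (bin o (mem (tmpE r)) (mem (tmpE (suc r)))) (<₂-weaken (eval-<₂ (op o a c) i z r<) b)
        (λ S → cong₂ ⟦ o ⟧ₒ (trans (tmp-val r S) (trans (fr₂ r ≤-refl) val)) (trans (tmp-val (suc r) S) val₂))) ,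
      update-same θ₂ r _ , λ q q<r → trans (frame-tmp θ₂ r q<r) (trans (fr₂ q (m<n⇒m<1+n q<r)) (fr q q<r))
    compile-ok (ite c a d) r {ρ} {θ} {M} i z r< b
      with compile-ok c r {ρ} {θ} i z r< (≤-trans (m≤m+n _ _) b)
    ... | θ₁ , P , val , fr with nz (eval c ρ) in eq
    ... | true with compile-ok a r {ρ} {θ₁} i z r<
                      (≤-trans (≤-trans (m≤m+n _ (exBits d (range n) M)) (m≤n+m _ (exBits c (range n) M))) b)
    ...   | θ₂ , P₂ , val₂ , fr₂ = θ₂ ,
      (P ⨟ branch-true (mem (tmpE r)) _ _ (λ S → trans (tmp-val r S) val) eq P₂) ,
      val₂ , λ q q<r → trans (fr₂ q q<r) (fr q q<r)
    compile-ok (ite c a d) r {ρ} {θ} {M} i z r< b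
        | θ₁ , P , val , fr | false with compile-ok d r {ρ} {θ₁} i z r<
                      (≤-trans (≤-trans (m≤n+m _ (exBits a (range n) M)) (m≤n+m _ (exBits c (range n) M))) b)
    ...   | θ₂ , P₂ , val₂ , fr₂ = θ₂ ,
      (P ⨟ branch-false (mem (tmpE r)) _ _ (λ S → trans (tmp-val r S) val) eq P₂) ,
      val₂ , λ q q<r → trans (fr₂ q q<r) (fr q q<r)
    compile-ok (fold o k x e) r {ρ} {θ} {M} i z< r< b =
      θ₄ [ r ↦ θ₄ (suc r) ] ,
      (set-tmp r (mem (varE x)) ρx<D (var-val x) ⨟
       set-tmp (suc r) (lit k) (<₂-weaken (n<₂n k) (≤-trans (m≤m+n k _) acc≤D)) (λ S → refl) ⨟
       set-var x (lit 0) (0<₂ D) (λ S → refl) ⨟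
       proj₁ (proj₂ L) ⨟
       recast-post (update-restore ρ x (range n))
         (set-var x (mem (tmpE r)) ρx<D (λ S → trans (tmp-val r S) saved)) ⨟
       set-tmp r (mem (tmpE (suc r))) (subst (_<₂ D) (sym result) (acc<D (range n) ≤-refl)) (tmp-val (suc r))) ,
      trans (update-same θ₄ r _) result ,
      λ q q<r → trans (frame-tmp θ₄ r q<r) (trans (frame₄ q (m<n⇒m<1+n q<r)) (trans (frame-tmp (θ [ r ↦ ρ x ]) (suc r) (m<n⇒m<1+n q<r)) (frame-tmp θ r q<r)))
      where
      F = range n
      G = guardBound (foldGuard x) D
      f : ℕ → ℕ
      f j = eval e (ρ [ x ↦ j ])
      β = exBits e F (M + F)
      acc≤D : k + F * (β + 1) ≤ D
      acc≤D = ≤-trans (m≤m+n _ _) b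
      rest≤D : β + (M + F) ≤ D
      rest≤D = ≤-trans (m≤n+m _ (k + F * (β + 1))) b
      MF≤D : M + F ≤ D
      MF≤D = ≤-trans (m≤n+m (M + F) β) rest≤D
      ρx<D : ρ x <₂ D
      ρx<D = <₂-weaken (r< x) (≤-trans (m≤m+n M F) MF≤D)
      i′ = λ y → <₂-weaken (i y) (m≤m+n M F)
      z′ = λ y → <₂-weaken (z< y) (m≤m+n M F)
      r′ : ∀ j → j ≤ F → ∀ y → (ρ [ x ↦ j ]) y <₂ (M + F)
      r′ j j≤F y = update-elim (_<₂ (M + F)) ρ x j y
        (<₂-weaken (≤-<₂ j≤F (n<₂n F)) (m≤n+m F M)) (<₂-weaken (r< y) (m≤m+n M F))
      acc<D : ∀ j → j ≤ F → foldTo o k j f <₂ D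
      acc<D j j≤F = <₂-weaken (foldTo-<₂ o k (λ j j<F → eval-<₂ e i′ z′ (r′ j (<⇒≤ j<F))) j j≤F)
        (≤-trans (+-monoʳ-≤ k (*-monoˡ-≤ (β + 1) j≤F)) acc≤D)

      -- The loop invariant: after `j` rounds the accumulator holds the fold over the first `j`
      -- values. Induction is on the number `m` of rounds to come.
      rounds : ∀ m j θ → j + m ≡ F → θ (suc r) ≡ foldTo o k j f → ∃[ θ₁ ]
        Does I (loop (foldGuard x) (compile e (2 + r) ⨾ accumulate o x r))
          (m * (G + (exTime e F D (2 + r) + accumulateTime o x r D)) + G) (ρ [ x ↦ j ]) θ z (ρ [ x ↦ F ]) θ₁ z
        × θ₁ (suc r) ≡ foldTo o k F f × (∀ q → q < suc r → θ₁ q ≡ θ q)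
      rounds zero j θ eq val rewrite trans (sym (+-identityʳ j)) eq = θ ,
        loop-stop (foldGuard x) _
          (λ S → trans (cong₂ _∸_ (range-val S) (trans (var-val x S) (update-same ρ x F))) (n∸n≡0 F)) ,
        val , λ q _ → refl
      rounds (suc m) j θ eq val
        with compile-ok e (2 + r) {ρ [ x ↦ j ]} {θ} i′ z′ (r′ j (subst (j ≤_) eq (m≤m+n j (suc m)))) (≤-trans (m≤m+n β _) rest≤D)
      ... | θ₁ , P , val₁ , fr₁
        with rounds m (suc j) (θ₁ [ suc r ↦ foldTo o k (suc j) f ]) (trans (sym (+-suc j m)) eq) (update-same θ₁ (suc r) _)
      ... | θ₂ , Q , val₂ , fr₂ = θ₂ ,
        retime (sym (+-assoc (G + (exTime e F D (2 + r) + accumulateTime o x r D)) (m * (G + (exTime e F D (2 + r) + accumulateTime o x r D))) G))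
          (loop-step (foldGuard x) _
            (λ S → trans (cong₂ _∸_ (range-val S) (trans (var-val x S) (update-same ρ x j))) remaining)
            (P ⨟ set-tmp (suc r) (bin o (mem (tmpE (suc r))) (mem (tmpE (2 + r)))) (acc<D (suc j) sj≤F)
                   (λ S → cong₂ ⟦ o ⟧ₒ (trans (tmp-val (suc r) S) (trans (fr₁ (suc r) ≤-refl) val)) (trans (tmp-val (2 + r) S) val₁)) ⨟
                 recast-post (update-twice ρ x j (suc j))
                   (set-var x (bin add (mem (varE x)) (lit 1)) (≤-<₂ sj≤F (<₂-weaken (n<₂n F) (≤-trans (m≤n+m F M) MF≤D)))
                   (λ S → trans (cong (_+ 1) (trans (var-val x S) (update-same ρ x j))) (+-comm j 1))))
            Q) ,
        val₂ , λ q q<r → trans (fr₂ q q<r) (trans (frame-tmp θ₁ (suc r) q<r) (fr₁ q (m<n⇒m<1+n q<r)))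
        where
        sj≤F : suc j ≤ F
        sj≤F = subst (suc j ≤_) (trans (sym (+-suc j m)) eq) (m≤m+n (suc j) m)
        remaining : F ∸ j ≡ suc m
        remaining = trans (cong (_∸ j) (sym eq)) (m+n∸m≡n j (suc m))

      L = rounds F 0 ((θ [ r ↦ ρ x ]) [ suc r ↦ k ]) refl (update-same (θ [ r ↦ ρ x ]) (suc r) k)
      θ₄ = proj₁ L
      result = proj₁ (proj₂ (proj₂ L))
      frame₄ = proj₂ (proj₂ (proj₂ L))
      saved : θ₄ r ≡ ρ x
      saved = trans (frame₄ r ≤-refl) (trans (frame-tmp (θ [ r ↦ ρ x ]) (suc r) ≤-refl) (update-same θ r (ρ x)))
    compile-ok (lett x e e′) r {ρ} {θ} {M} i z< r< b
      with compile-ok e r {ρ} {θ} i z< r< (≤-trans (m≤n+m _ M) (≤-trans (m≤m+n (M + _) _) b))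
    ... | θ₁ , P , val , fr
      with compile-ok e′ (2 + r) {ρ [ x ↦ eval e ρ ]} {θ₁ [ suc r ↦ ρ x ]}
             (λ y → <₂-weaken (i y) (m≤m+n M _)) (λ y → <₂-weaken (z< y) (m≤m+n M _))
             (λ y → update-elim (_<₂ (M + exBits e (range n) M)) ρ x _ y
               (<₂-weaken (eval-<₂ e i z< r<) (m≤n+m _ M)) (<₂-weaken (r< y) (m≤m+n M _)))
             (≤-trans (m≤n+m _ (M + exBits e (range n) M)) b)
    ... | θ₂ , P₂ , val₂ , fr₂ = θ₂ [ r ↦ eval e′ (ρ [ x ↦ eval e ρ ]) ] ,
      (P ⨟ set-tmp (suc r) (mem (varE x)) ρx<D (var-val x) ⨟
       set-var x (mem (tmpE r)) (<₂-weaken (eval-<₂ e i z< r<) (≤-trans (m≤n+m _ M) (≤-trans (m≤m+n (M + _) _) b)))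
         (λ S → trans (tmp-val r S) (trans (frame-tmp θ₁ (suc r) ≤-refl) val)) ⨟
       P₂ ⨟
       recast-post (update-restore ρ x _)
         (set-var x (mem (tmpE (suc r))) ρx<D (λ S → trans (tmp-val (suc r) S) (trans (fr₂ (suc r) ≤-refl) (update-same θ₁ (suc r) (ρ x))))) ⨟
       set-tmp r (mem (tmpE (2 + r))) (<₂-weaken (eval-<₂ (lett x e e′) i z< r<) b) (λ S → trans (tmp-val (2 + r) S) val₂)) ,
      update-same θ₂ r _ ,
      λ q q<r → trans (frame-tmp θ₂ r q<r) (trans (fr₂ q (m<n⇒m<1+n (m<n⇒m<1+n q<r)))
                  (trans (frame-tmp θ₁ (suc r) (m<n⇒m<1+n q<r)) (fr q q<r)))
      where
      ρx<D : ρ x <₂ D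
      ρx<D = <₂-weaken (r< x) (≤-trans (m≤m+n M _) (≤-trans (m≤m+n (M + _) _) b))

-- The program that fills the table and copies out the answer

fillGuard copyGuard firstE outE : Exp
fillGuard = bin sub (mem (tmpE 0)) (mem (varE 0))
copyGuard = bin sub (mem (lit 0)) (mem (varE 1))
firstE    = bin sub (mem (tmpE 0)) (mem (lit 0))
outE      = cellE (bin add firstE (mem (varE 1)))

increment : ℕ → Program
increment x = varE x ≔ bin add (mem (varE x)) (lit 1)

-- The last entries of the table are copied to the cells below n.  Cell 0 comes
-- last, since all addresses are computed from it.
copyOut : Program
copyOut = varE 1 ≔ lit 1 ⨾ loop copyGuard (mem (varE 1) ≔ mem outE ⨾ increment 1) ⨾ lit 0 ≔ mem (cellE firstE)

-- Temporary 0 keeps the size of the table throughout, hence `entry` is compiled from temporary 1;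
-- variable 0 is the index of the entry being filled.
tableProgram : Ex → Ex → Program
tableProgram size entry =
  compile size 0 ⨾
  loop fillGuard (compile entry 1 ⨾ cellE (mem (varE 0)) ≔ mem (tmpE 1) ⨾ increment 0) ⨾
  copyOut

incrementTime : ℕ → ℕ → ℕ
incrementTime x D = assignBound (varE x) (bin add (mem (varE x)) (lit 1)) D

fillTime : Ex → ℕ → ℕ → ℕ
fillTime entry F D = guardBound fillGuard D +
  (exTime entry F D 1 + (assignBound (cellE (mem (varE 0))) (mem (tmpE 1)) D + incrementTime 0 D))

copyTime : ℕ → ℕ
copyTime D = guardBound copyGuard D + (assignBound (mem (varE 1)) (mem outE) D + incrementTime 1 D)

tableTime : Ex → Ex → (n D N : ℕ) → ℕ
tableTime size entry n D N = exTime size (range n) D 0 +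
  ((N * fillTime entry (range n) D + guardBound fillGuard D) +
   (assignBound (varE 1) (lit 1) D + ((n * copyTime D + guardBound copyGuard D) + assignBound (lit 0) (mem (cellE firstE)) D)))

module Table (n D M : ℕ) where
  open Semantics n D

  zeros : ℕ → ℕ
  zeros _ = 0

  -- `eval-entry` makes the table a course-of-values recursion: entry `τ` must come out right from
  -- the earlier entries alone, whatever the rest of `z` contains.
  module Fill (I : ℕ → ℕ) (size entry : Ex) (g : ℕ → ℕ) (N : ℕ)
    (I<M : ∀ i → I i <₂ M) (N<M : N <₂ M)
    (eval-size : Eval.eval n I zeros size zeros ≡ N)
    (eval-entry : ∀ τ (z : ℕ → ℕ) → τ < N → (∀ j → j < τ → z j ≡ g j) → Eval.eval n I z entry (zeros [ 0 ↦ τ ]) ≡ g τ)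
    (g<M : ∀ τ → τ < N → g τ <₂ M)
    (M≤D : M ≤ D) (size≤D : exBits size (range n) M ≤ D) (entry≤D : exBits entry (range n) M ≤ D)
    where

    body : ℕ
    body = exTime entry (range n) D 1 + (assignBound (cellE (mem (varE 0))) (mem (tmpE 1)) D + incrementTime 0 D)

    fill : ∀ m τ θ z → τ + m ≡ N → θ 0 ≡ N → (∀ j → j < τ → z j ≡ g j) → (∀ i → z i <₂ M) → ∃[ θ₁ ] ∃[ z₁ ]
      Does I (loop fillGuard (compile entry 1 ⨾ cellE (mem (varE 0)) ≔ mem (tmpE 1) ⨾ increment 0))
        (m * fillTime entry (range n) D + guardBound fillGuard D) (zeros [ 0 ↦ τ ]) θ z (zeros [ 0 ↦ N ]) θ₁ z₁
      × θ₁ 0 ≡ N × (∀ j → j < N → z₁ j ≡ g j) × (∀ i → z₁ i <₂ M)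
    fill zero τ θ z eq θ0 z≡g z<M rewrite trans (sym (+-identityʳ τ)) eq = θ , z ,
      loop-stop fillGuard _ (λ S → trans (cong₂ _∸_ (trans (tmp-val 0 S) θ0) (var-val 0 S)) (n∸n≡0 N)) ,
      θ0 , z≡g , z<M
    fill (suc m) τ θ z eq θ0 z≡g z<M
      with compile-ok I z entry 1 {zeros [ 0 ↦ τ ]} {θ} I<M z<M
             (λ x → update-elim (_<₂ M) zeros 0 τ x (≤-<₂ (subst (τ ≤_) eq (m≤m+n τ (suc m))) N<M) (0<₂ M)) entry≤D
    ... | θ₁ , P , val , fr
      with fill m (suc τ) θ₁ (z [ τ ↦ g τ ]) (trans (sym (+-suc τ m)) eq) (trans (fr 0 z<s) θ0) known
             (λ i → update-elim (_<₂ M) z τ (g τ) i (g<M τ τ<N) (z<M i))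
      where
      τ<N : τ < N
      τ<N = subst (suc τ ≤_) (trans (sym (+-suc τ m)) eq) (m≤m+n (suc τ) m)
      known : ∀ j → j < suc τ → (z [ τ ↦ g τ ]) j ≡ g j
      known j j≤τ with j ≟ τ
      ... | yes refl = update-same z j (g j)
      ... | no j≢τ = trans (update-other z (g τ) j≢τ) (z≡g j (≤∧≢⇒< (s≤s⁻¹ j≤τ) j≢τ))
    ... | θ₂ , z₂ , Q , θ₂0 , z₂≡g , z₂<M = θ₂ , z₂ ,
      retime (sym (+-assoc (guardBound fillGuard D + body) (m * (guardBound fillGuard D + body)) (guardBound fillGuard D)))
        (loop-step fillGuard _
          (λ S → trans (cong₂ _∸_ (trans (tmp-val 0 S) θ0) (var-val 0 S)) (trans (cong (_∸ τ) (sym eq)) (m+n∸m≡n τ (suc m))))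
          (P ⨟ set-cell (mem (varE 0)) (mem (tmpE 1)) (<₂-weaken (g<M τ τ<N) M≤D)
                 (var-val 0) (λ S → trans (tmp-val 1 S) (trans val (eval-entry τ z τ<N z≡g))) ⨟
               recast-post (update-twice zeros 0 τ (suc τ))
                 (set-var 0 (bin add (mem (varE 0)) (lit 1)) (<₂-weaken (≤-<₂ τ<N N<M) M≤D)
                   (λ S → trans (cong (_+ 1) (var-val 0 S)) (+-comm τ 1))))
          Q) ,
      θ₂0 , z₂≡g , z₂<M
      where
      τ<N : τ < N
      τ<N = subst (suc τ ≤_) (trans (sym (+-suc τ m)) eq) (m≤m+n (suc τ) m)

  n<base : n < base n
  n<base = begin-strict
    n                 <⟨ ≤-reflexive (+-comm 1 n) ⟩
    n + 1             ≡⟨ *-identityʳ (n + 1) ⟨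
    (n + 1) * 1       ≤⟨ *-monoʳ-≤ (n + 1) (m≤n+m 1 n) ⟩
    (n + 1) * (n + 1) ∎
    where open ≤-Reasoning

  -- The answer overwrites the input, so the abstract input is updated along with it. Cell 0 is
  -- excluded, since the addresses would move.
  write-output : ∀ {I ρ θ z σ y} v → v ≢ 0 → v < n → y <₂ D → Rep I ρ θ z σ → Rep (I [ v ↦ y ]) ρ θ z (σ [ v ↦ y ])
  write-output {I} {σ = σ} {y} v v≢0 v<n y<D S = record
    { input = λ i i<b → input-case i i<b
    ; order = trans (update-other σ y (λ e → v≢0 (sym e))) (order S)
    ; vars = λ x → trans (update-other σ y (far 0 x)) (vars S x)
    ; temps = λ x → trans (update-other σ y (far 1 x)) (temps S x)
    ; cells = λ x → trans (update-other σ y (far 2 x)) (cells S x)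
    ; bounded = write-bounded σ v y<D (bounded S) }
    where
    input-case : ∀ i → i < base n → (σ [ v ↦ y ]) i ≡ (I [ v ↦ y ]) i
    input-case i i<b with i ≡ᵇ v
    ... | true = refl
    ... | false = input S i i<b
    far : ∀ c x → address c x ≢ v
    far c x refl = <-asym v<n (<-≤-trans n<base (m≤m+n (base n) (c + x * 3)))

  module _ (θ z : ℕ → ℕ) (N : ℕ) (θ0 : θ 0 ≡ N) (n<D : suc n <₂ D) where

    firstE-val : ∀ {I ρ σ} → Rep I ρ θ z σ → ⟦ firstE ⟧ σ ≡ N ∸ n
    firstE-val S = cong₂ _∸_ (trans (tmp-val 0 S) θ0) (order S)

    outE-val : ∀ {I ρ i σ} → Rep I (ρ [ 1 ↦ i ]) θ z σ → ⟦ mem outE ⟧ σ ≡ z (N ∸ n + i)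
    outE-val {ρ = ρ} {i} S = cell-val (bin add firstE (mem (varE 1))) S
      (cong₂ _+_ (firstE-val S) (trans (var-val 1 S) (update-same ρ 1 i)))

    Copied : ℕ → (ℕ → ℕ) → Set
    Copied i I = ∀ v → 1 ≤ v → v < i → I v ≡ z (N ∸ n + v)

    cell<D : ∀ {I ρ σ} i → Rep I ρ θ z σ → z i <₂ D
    cell<D i S = subst (_<₂ D) (cells S i) (bounded S _)

    assign-to : ∀ d e {σ a y} → Bounded D σ → ⟦ d ⟧ σ ≡ a → ⟦ e ⟧ σ ≡ y →
                ∃[ t ] ⟨ d ≔ e , σ ⟩⇓⟨ t , σ [ a ↦ y ] ⟩ × t ≤ assignBound d e D
    assign-to d e B refl refl = _ , assign , assign-≤ d e B

    copy : ∀ m i {I ρ σ} → n ∸ i ≡ m → 1 ≤ i → Rep I (ρ [ 1 ↦ i ]) θ z σ → Copied i I →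
      ∃[ t ] ∃[ σ₁ ] ∃[ I₁ ] ∃[ ρ₁ ] ⟨ loop copyGuard (mem (varE 1) ≔ mem outE ⨾ increment 1) , σ ⟩⇓⟨ t , σ₁ ⟩
        × t ≤ m * copyTime D + guardBound copyGuard D × Rep I₁ ρ₁ θ z σ₁ × Copied n I₁
    copy zero i {I} {ρ} {σ} eq 1≤i S done = _ , σ , I , _ ,
      loop-false (trans (cong₂ _∸_ (order S) (trans (var-val 1 S) (update-same ρ 1 i))) eq) ,
      guard-≤ copyGuard (bounded S) , S , λ v 1≤v v<n → done v 1≤v (<-≤-trans v<n (m∸n≡0⇒m≤n eq))
    copy (suc m) i {I} {ρ} {σ} eq 1≤i S done =
      let t₁ , run₁ , t₁≤ = assign-to (mem (varE 1)) (mem outE) (bounded S) (trans (var-val 1 S) (update-same ρ 1 i)) (outE-val {ρ = ρ} S)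
          t₂ , σ₂ , run₂ , t₂≤ , S₂ = execute bump _ S′
          t₃ , σ₃ , I₃ , ρ₃ , run₃ , t₃≤ , S₃ , done₃ = copy m (suc i) rest (m≤n⇒m≤1+n 1≤i) (recast (update-twice ρ 1 i (suc i)) S₂) done′
      in _ , σ₃ , I₃ , ρ₃ ,
         loop-true (trans (cong₂ _∸_ (order S) (trans (var-val 1 S) (update-same ρ 1 i))) eq) (seq run₁ run₂) run₃ ,
         ≤-trans (+-mono-≤ (guard-≤ copyGuard (bounded S)) (+-mono-≤ (+-mono-≤ t₁≤ t₂≤) t₃≤))
           (≤-reflexive (trans (sym (+-assoc G s (m * copyTime D + G))) (sym (+-assoc (G + s) (m * copyTime D) G)))) ,
         S₃ , done₃
      where
      G = guardBound copyGuard D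
      s = assignBound (mem (varE 1)) (mem outE) D + incrementTime 1 D
      i<n : i < n
      i<n = m∸n≢0⇒n<m (λ e → 0≢1+n (trans (sym e) eq))
      y = z (N ∸ n + i)
      S′ : Rep (I [ i ↦ y ]) (ρ [ 1 ↦ i ]) θ z (σ [ i ↦ y ])
      S′ = write-output i (λ { refl → case 1≤i of λ () }) i<n (cell<D _ S) S
      bump : Does (I [ i ↦ y ]) (increment 1) (incrementTime 1 D) (ρ [ 1 ↦ i ]) θ z ((ρ [ 1 ↦ i ]) [ 1 ↦ suc i ]) θ z
      bump = set-var 1 (bin add (mem (varE 1)) (lit 1)) (≤-<₂ (s≤s (<⇒≤ i<n)) n<D)
               (λ S → trans (cong (_+ 1) (trans (var-val 1 S) (update-same ρ 1 i))) (+-comm i 1))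
      rest : n ∸ suc i ≡ m
      rest = trans (sym (pred[m∸n]≡m∸[1+n] n i)) (cong pred eq)
      done′ : Copied (suc i) (I [ i ↦ y ])
      done′ v 1≤v v≤i with v ≟ i
      ... | yes refl = update-same I v y
      ... | no v≢i = trans (update-other I y v≢i) (done v 1≤v (≤∧≢⇒< (s≤s⁻¹ v≤i) v≢i))

    copyOut-ok : ∀ {I ρ σ} → Rep I ρ θ z σ →
      ∃[ t ] ∃[ σ₁ ] ⟨ copyOut , σ ⟩⇓⟨ t , σ₁ ⟩
        × t ≤ assignBound (varE 1) (lit 1) D + ((n * copyTime D + guardBound copyGuard D) + assignBound (lit 0) (mem (cellE firstE)) D)
        × (∀ v → v < n → σ₁ v ≡ z (N ∸ n + v))
    copyOut-ok {I} {ρ} S =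
      let t₁ , σ₁ , run₁ , t₁≤ , S₁ = execute start _ S
          t₂ , σ₂ , I₂ , ρ₂ , run₂ , t₂≤ , S₂ , done = copy (n ∸ 1) 1 refl ≤-refl S₁ (λ v 1≤v v<1 → ⊥-elim (<-irrefl refl (<-≤-trans v<1 1≤v)))
          t₃ , run₃ , t₃≤ = assign-to (lit 0) (mem (cellE firstE)) (bounded S₂) refl (cell-val firstE S₂ (firstE-val S₂))
      in _ , _ , seq run₁ (seq run₂ run₃) ,
         +-mono-≤ t₁≤ (+-mono-≤ (≤-trans t₂≤ (+-monoˡ-≤ (guardBound copyGuard D) (*-monoˡ-≤ (copyTime D) (m∸n≤m n 1)))) t₃≤) ,
         λ { zero v<n → cong z (sym (+-identityʳ (N ∸ n)))
           ; (suc v) v<n → trans (input S₂ (suc v) (<-trans v<n n<base)) (done (suc v) (s≤s z≤n) v<n) }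
      where
      start : Does I (varE 1 ≔ lit 1) (assignBound (varE 1) (lit 1) D) ρ θ z (ρ [ 1 ↦ 1 ]) θ z
      start = set-var 1 (lit 1) (≤-<₂ (s≤s z≤n) n<D) (λ S → refl)

  module _ (I : ℕ → ℕ) (size entry : Ex) (g : ℕ → ℕ) (N : ℕ)
    (I0 : I 0 ≡ n) (I-beyond : ∀ i → base n ≤ i → I i ≡ 0)
    (I<M : ∀ i → I i <₂ M) (N<M : N <₂ M) (n<M : suc n <₂ M) (n≤N : n ≤ N)
    (eval-size : Eval.eval n I zeros size zeros ≡ N)
    (eval-entry : ∀ τ (z : ℕ → ℕ) → τ < N → (∀ j → j < τ → z j ≡ g j) → Eval.eval n I z entry (zeros [ 0 ↦ τ ]) ≡ g τ)
    (g<M : ∀ τ → τ < N → g τ <₂ M)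
    (M≤D : M ≤ D) (size≤D : exBits size (range n) M ≤ D) (entry≤D : exBits entry (range n) M ≤ D)
    where
    open Fill I size entry g N I<M N<M eval-size eval-entry g<M M≤D size≤D entry≤D

    initial : Rep I zeros zeros zeros I
    initial = record
      { input = λ _ _ → refl ; order = I0
      ; vars = λ x → I-beyond _ (m≤m+n (base n) _)
      ; temps = λ x → I-beyond _ (m≤m+n (base n) _)
      ; cells = λ x → I-beyond _ (m≤m+n (base n) _)
      ; bounded = λ i → <₂-weaken (I<M i) M≤D }

    tableProgram-ok : ∃[ t ] ∃[ σ ] ⟨ tableProgram size entry , I ⟩⇓⟨ t , σ ⟩
      × t ≤ tableTime size entry n D N × (∀ v → v < n → σ v ≡ g (N ∸ n + v))
    tableProgram-ok =
      let θ₁ , P , val , _ = compile-ok I zeros size 0 {zeros} {zeros} {M} I<M (λ _ → 0<₂ M) (λ _ → 0<₂ M) size≤D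
          t₁ , σ₁ , run₁ , t₁≤ , S₁ = execute P I initial
          θ₂ , z₂ , Q , θ₂0 , z₂≡g , z₂<M = fill N 0 θ₁ zeros refl (trans val eval-size) (λ _ ()) (λ _ → 0<₂ M)
          -- Memory beyond the input is zero, so the loop counter starts at 0 without an assignment.
          t₂ , σ₂ , run₂ , t₂≤ , S₂ = execute Q σ₁ (recast (λ x → sym (update-elim (_≡ 0) zeros 0 0 x refl refl)) S₁)
          t₃ , σ₃ , run₃ , t₃≤ , out = copyOut-ok θ₂ z₂ N θ₂0 (<₂-weaken n<M M≤D) S₂
      in _ , σ₃ , seq run₁ (seq run₂ run₃) , +-mono-≤ t₁≤ (+-mono-≤ t₂≤ t₃≤) ,
         λ v v<n → trans (out v v<n) (z₂≡g _ (subst (N ∸ n + v <_) (m∸n+n≡m n≤N) (+-monoʳ-< (N ∸ n) v<n)))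

-- Polynomial time bounds

-- A record, so that the function can be inferred from the type.
record Polynomial (f : ℕ → ℕ) : Set where
  constructor polynomial
  field
    coefficient degree : ℕ
    bound : ∀ n → f n ≤ coefficient * suc n ^ degree

poly-const : ∀ k → Polynomial (λ _ → k)
poly-const k = polynomial k 0 (λ n → ≤-reflexive (sym (*-identityʳ k)))

poly-id : Polynomial (λ n → n)
poly-id = polynomial 1 1 (λ n → ≤-trans (n≤1+n n) (≤-reflexive (sym (trans (*-identityˡ _) (*-identityʳ (suc n))))))

infixl 6 _⊕_
infixl 7 _⊗_

_⊕_ : ∀ {f g} → Polynomial f → Polynomial g → Polynomial (λ n → f n + g n)
_⊕_ {f} {g} (polynomial c k f≤) (polynomial d l g≤) = polynomial (c + d) (k + l) λ n → begin
  f n + g n                                     ≤⟨ +-mono-≤ (f≤ n) (g≤ n) ⟩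
  c * suc n ^ k + d * suc n ^ l                 ≤⟨ +-mono-≤ (*-monoʳ-≤ c (^-monoʳ-≤ (suc n) (m≤m+n k l)))
                                                            (*-monoʳ-≤ d (^-monoʳ-≤ (suc n) (m≤n+m l k))) ⟩
  c * suc n ^ (k + l) + d * suc n ^ (k + l)     ≡⟨ *-distribʳ-+ (suc n ^ (k + l)) c d ⟨
  (c + d) * suc n ^ (k + l)                     ∎
  where open ≤-Reasoning

_⊗_ : ∀ {f g} → Polynomial f → Polynomial g → Polynomial (λ n → f n * g n)
_⊗_ {f} {g} (polynomial c k f≤) (polynomial d l g≤) = polynomial (c * d) (k + l) λ n → begin
  f n * g n                            ≤⟨ *-mono-≤ (f≤ n) (g≤ n) ⟩
  c * suc n ^ k * (d * suc n ^ l)      ≡⟨ interchange c (suc n ^ k) d (suc n ^ l) ⟩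
  c * d * (suc n ^ k * suc n ^ l)      ≡⟨ cong (c * d *_) (^-distribˡ-+-* (suc n) k l) ⟨
  c * d * suc n ^ (k + l)              ∎
  where
  open ≤-Reasoning
  interchange : ∀ a b c d → a * b * (c * d) ≡ a * c * (b * d)
  interchange = solve-∀

poly-suc : ∀ {f} → Polynomial f → Polynomial (λ n → suc (f n))
poly-suc p = poly-const 1 ⊕ p

poly-range : Polynomial range
poly-range = poly-id ⊕ (poly-id ⊕ poly-const 2)

module _ {D : ℕ → ℕ} (pD : Polynomial D) where

  poly-valBits : ∀ e → Polynomial (λ n → valBits e (D n))
  poly-valBits (lit x)     = poly-const x
  poly-valBits (mem e)     = pD
  poly-valBits (bin o d e) = poly-valBits d ⊕ poly-valBits e ⊕ poly-const 1

  poly-costBound : ∀ e → Polynomial (λ n → costBound e (D n))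
  poly-costBound (lit x)     = poly-const (suc x)
  poly-costBound (mem e)     = poly-costBound e ⊕ (poly-suc (poly-valBits e) ⊕ poly-suc pD)
  poly-costBound (bin o d e) =
    poly-costBound d ⊕ poly-costBound e ⊕ (poly-suc (poly-valBits d) ⊕ poly-suc (poly-valBits e))

  poly-assign : ∀ d e → Polynomial (λ n → assignBound d e (D n))
  poly-assign d e = poly-costBound d ⊕ poly-costBound e ⊕ (poly-suc (poly-valBits d) ⊕ poly-suc (poly-valBits e))

  poly-guard : ∀ e → Polynomial (λ n → guardBound e (D n))
  poly-guard e = poly-costBound e ⊕ poly-suc (poly-valBits e)

  -- Nested folds multiply factors `range n`, but their depth is fixed by the expression.
  poly-exTime : ∀ e r → Polynomial (λ n → exTime e (range n) (D n) r)
  poly-exTime (num k) r = poly-assign (tmpE r) (lit k)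
  poly-exTime (var x) r = poly-assign (tmpE r) (mem (varE x))
  poly-exTime (inp e) r = poly-exTime e r ⊕ (poly-guard (bin sub baseE (mem (tmpE r))) ⊕
    (poly-assign (tmpE r) (mem (mem (tmpE r))) ⊕ poly-assign (tmpE r) (lit 0)))
  poly-exTime (get e) r = poly-exTime e r ⊕ poly-assign (tmpE r) (mem (cellE (mem (tmpE r))))
  poly-exTime (op o a b) r = poly-exTime a r ⊕ (poly-exTime b (suc r) ⊕
    poly-assign (tmpE r) (bin o (mem (tmpE r)) (mem (tmpE (suc r)))))
  poly-exTime (ite c a b) r = poly-exTime c r ⊕ (poly-guard (mem (tmpE r)) ⊕ (poly-exTime a r ⊕ poly-exTime b r))
  poly-exTime (fold o k x b) r =
    poly-assign (tmpE r) (mem (varE x)) ⊕ (poly-assign (tmpE (suc r)) (lit k) ⊕ (poly-assign (varE x) (lit 0) ⊕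
    ((poly-range ⊗ (poly-guard (foldGuard x) ⊕ (poly-exTime b (2 + r) ⊕
       (poly-assign (tmpE (suc r)) (bin o (mem (tmpE (suc r))) (mem (tmpE (2 + r)))) ⊕
        poly-assign (varE x) (bin add (mem (varE x)) (lit 1))))) ⊕ poly-guard (foldGuard x)) ⊕
    (poly-assign (varE x) (mem (tmpE r)) ⊕ poly-assign (tmpE r) (mem (tmpE (suc r)))))))
  poly-exTime (lett x e b) r =
    poly-exTime e r ⊕ (poly-assign (tmpE (suc r)) (mem (varE x)) ⊕ (poly-assign (varE x) (mem (tmpE r)) ⊕ (poly-exTime b (2 + r) ⊕
    (poly-assign (varE x) (mem (tmpE (suc r))) ⊕ poly-assign (tmpE r) (mem (tmpE (2 + r)))))))

-- Stated for every polynomial `M`, because `M` grows under each binder.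
poly-exBits : ∀ e {M} → Polynomial M → Polynomial (λ n → exBits e (range n) (M n))
poly-exBits (num k) pM = poly-const k
poly-exBits (var x) pM = pM
poly-exBits (inp e) pM = pM ⊕ poly-exBits e pM
poly-exBits (get e) pM = pM ⊕ poly-exBits e pM
poly-exBits (op o a b) pM = poly-exBits a pM ⊕ poly-exBits b pM ⊕ poly-const 1
poly-exBits (ite c a b) pM = poly-exBits c pM ⊕ (poly-exBits a pM ⊕ poly-exBits b pM)
poly-exBits (fold o k x b) pM =
  (poly-const k ⊕ poly-range ⊗ (poly-exBits b (pM ⊕ poly-range) ⊕ poly-const 1)) ⊕
  (poly-exBits b (pM ⊕ poly-range) ⊕ (pM ⊕ poly-range))
poly-exBits (lett x e b) pM =
  (pM ⊕ poly-exBits e pM) ⊕ poly-exBits b (pM ⊕ poly-exBits e pM)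

module _ (size entry : Ex) {M R : ℕ → ℕ} (pM : Polynomial M) (pR : Polynomial R) where

  -- A cell may hold a table entry, an input value or any intermediate value of the two expressions.
  memoryBits : ℕ → ℕ
  memoryBits n = M n + (exBits size (range n) (M n) + exBits entry (range n) (M n))

  roundTime restTime : ℕ → ℕ
  roundTime n = fillTime entry (range n) (memoryBits n)
  restTime n = exTime size (range n) (memoryBits n) 0 + (guardBound fillGuard (memoryBits n) +
    (assignBound (varE 1) (lit 1) (memoryBits n) +
     ((n * copyTime (memoryBits n) + guardBound copyGuard (memoryBits n)) + assignBound (lit 0) (mem (cellE firstE)) (memoryBits n))))

  timeFactor : ℕ → ℕ
  timeFactor n = R n * roundTime n + restTime n

  poly-memoryBits : Polynomial memoryBits
  poly-memoryBits = pM ⊕ (poly-exBits size pM ⊕ poly-exBits entry pM)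

  poly-timeFactor : Polynomial timeFactor
  poly-timeFactor = pR ⊗ (poly-guard pD fillGuard ⊕ (poly-exTime pD entry 1 ⊕
      (poly-assign pD (cellE (mem (varE 0))) (mem (tmpE 1)) ⊕ poly-assign pD (varE 0) (bin add (mem (varE 0)) (lit 1))))) ⊕
    (poly-exTime pD size 0 ⊕ (poly-guard pD fillGuard ⊕ (poly-assign pD (varE 1) (lit 1) ⊕
     ((poly-id ⊗ (poly-guard pD copyGuard ⊕ (poly-assign pD (mem (varE 1)) (mem outE) ⊕ poly-assign pD (varE 1) (bin add (mem (varE 1)) (lit 1))))
       ⊕ poly-guard pD copyGuard) ⊕ poly-assign pD (lit 0) (mem (cellE firstE))))))
    where pD = poly-memoryBits

  tableTime-≤ : ∀ n {N} → N ≤ 2 ^ ⌊ n /2⌋ * R n → tableTime size entry n (memoryBits n) N ≤ 2 ^ ⌊ n /2⌋ * timeFactor n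
  tableTime-≤ n {N} N≤ = begin
    tableTime size entry n (memoryBits n) N              ≡⟨ rearrange (exTime size (range n) D 0) (N * roundTime n) (guardBound fillGuard D) _ ⟩
    N * roundTime n + restTime n                         ≤⟨ +-mono-≤ (*-monoˡ-≤ (roundTime n) N≤) (m≤n*m (restTime n) E ⦃ m^n≢0 2 ⌊ n /2⌋ ⦄) ⟩
    E * R n * roundTime n + E * restTime n               ≡⟨ cong (_+ E * restTime n) (*-assoc E (R n) (roundTime n)) ⟩
    E * (R n * roundTime n) + E * restTime n             ≡⟨ *-distribˡ-+ E (R n * roundTime n) (restTime n) ⟨
    E * timeFactor n                                    ∎
    where
    open ≤-Reasoning
    D = memoryBits n
    E = 2 ^ ⌊ n /2⌋
    rearrange : ∀ a b c d → a + ((b + c) + d) ≡ b + (a + (c + d))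
    rearrange = solve-∀

2⌊n/2⌋≤n : ∀ n → ⌊ n /2⌋ + ⌊ n /2⌋ ≤ n
2⌊n/2⌋≤n n = ≤-trans (+-monoʳ-≤ ⌊ n /2⌋ (⌊n/2⌋≤⌈n/2⌉ n)) (≤-reflexive (⌊n/2⌋+⌈n/2⌉≡n n))

O*-poly : ∀ {Q} → Polynomial Q → O*[2^n/2] (λ n → 2 ^ ⌊ n /2⌋ * Q n)
O*-poly {Q} (polynomial c k Q≤) = c , k , λ n → let E = 2 ^ ⌊ n /2⌋ ; q = c * suc n ^ k in begin
  (E * Q n) ^ 2      ≤⟨ ^-monoˡ-≤ 2 (*-monoʳ-≤ E (Q≤ n)) ⟩
  (E * q) ^ 2        ≡⟨ square E q ⟩
  (E * E) * q ^ 2    ≡⟨ cong (_* q ^ 2) (^-distribˡ-+-* 2 ⌊ n /2⌋ ⌊ n /2⌋) ⟨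
  2 ^ (⌊ n /2⌋ + ⌊ n /2⌋) * q ^ 2  ≤⟨ *-monoˡ-≤ (q ^ 2) (^-monoʳ-≤ 2 (2⌊n/2⌋≤n n)) ⟩
  2 ^ n * q ^ 2      ∎
  where
  open ≤-Reasoning
  square : ∀ a b → a * b * (a * b * 1) ≡ a * a * (b * (b * 1))
  square = solve-∀

-- Sums and counting

true≢false : ∀ {b} → b ≡ true → b ≡ false → ⊥
true≢false refl ()

∧⁻ : ∀ {a b} → a ∧ b ≡ true → a ≡ true × b ≡ true
∧⁻ {true} eq = refl , eq

∧⁺ : ∀ {a b} → a ≡ true → b ≡ true → a ∧ b ≡ true
∧⁺ refl refl = refl

∨⁻ : ∀ {a b} → a ∨ b ≡ true → a ≡ true ⊎ b ≡ true
∨⁻ {true} eq = inj₁ refl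
∨⁻ {false} eq = inj₂ eq

∨⁺ˡ : ∀ {a b} → a ≡ true → a ∨ b ≡ true
∨⁺ˡ refl = refl

∨⁺ʳ : ∀ {a b} → b ≡ true → a ∨ b ≡ true
∨⁺ʳ {true} eq = refl
∨⁺ʳ {false} eq = eq

≡ᵇ-refl : ∀ x → (x ≡ᵇ x) ≡ true
≡ᵇ-refl zero = refl
≡ᵇ-refl (suc x) = ≡ᵇ-refl x

≡ᵇ-true : ∀ {x y} → (x ≡ᵇ y) ≡ true → x ≡ y
≡ᵇ-true {x} {y} eq = ≡ᵇ⇒≡ x y (subst T (sym eq) _)

≡ᵇ-false : ∀ {x y} → x ≢ y → (x ≡ᵇ y) ≡ false
≡ᵇ-false {x} {y} x≢y with x ≡ᵇ y in eq
... | true = ⊥-elim (x≢y (≡ᵇ-true eq))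
... | false = refl

<ᵇ-true : ∀ {x y} → x < y → (x <ᵇ y) ≡ true
<ᵇ-true {x} {y} x<y with x <ᵇ y | <⇒<ᵇ x<y
... | true | _ = refl

<ᵇ-true⁻ : ∀ x y → (x <ᵇ y) ≡ true → x < y
<ᵇ-true⁻ x y eq = <ᵇ⇒< x y (subst T (sym eq) _)

<ᵇ-false : ∀ {x y} → y ≤ x → (x <ᵇ y) ≡ false
<ᵇ-false {x} {y} y≤x with x <ᵇ y in eq
... | true = ⊥-elim (<⇒≱ (<ᵇ-true⁻ x y eq) y≤x)
... | false = refl

Sum : ℕ → (ℕ → ℕ) → ℕ
Sum = foldTo add 0

𝟙 : Bool → ℕ
𝟙 b = if b then 1 else 0

𝟙≤1 : ∀ b → 𝟙 b ≤ 1
𝟙≤1 true = ≤-refl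
𝟙≤1 false = z≤n

nz-pos : ∀ {x} → nz x ≡ true → 0 < x
nz-pos {suc x} _ = z<s

pos-nz : ∀ {x} → 0 < x → nz x ≡ true
pos-nz z<s = refl

nz-𝟙 : ∀ b → nz (𝟙 b) ≡ b
nz-𝟙 true = refl
nz-𝟙 false = refl

Sum-cong : ∀ m {f g} → (∀ i → i < m → f i ≡ g i) → Sum m f ≡ Sum m g
Sum-cong zero eq = refl
Sum-cong (suc m) eq = cong₂ _+_ (Sum-cong m (λ i i<m → eq i (m<n⇒m<1+n i<m))) (eq m ≤-refl)

Sum-mono : ∀ m {f g} → (∀ i → i < m → f i ≤ g i) → Sum m f ≤ Sum m g
Sum-mono zero le = z≤n
Sum-mono (suc m) le = +-mono-≤ (Sum-mono m (λ i i<m → le i (m<n⇒m<1+n i<m))) (le m ≤-refl)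

Sum-const : ∀ m c → Sum m (λ _ → c) ≡ m * c
Sum-const zero c = refl
Sum-const (suc m) c = trans (cong (_+ c) (Sum-const m c)) (+-comm (m * c) c)

Sum-bound : ∀ m {f c} → (∀ i → i < m → f i ≤ c) → Sum m f ≤ m * c
Sum-bound m {c = c} le = ≤-trans (Sum-mono m le) (≤-reflexive (Sum-const m c))

Sum-zero : ∀ m → Sum m (λ _ → 0) ≡ 0
Sum-zero m = trans (Sum-const m 0) (*-zeroʳ m)

+-interchange : ∀ a b c d → (a + b) + (c + d) ≡ (a + c) + (b + d)
+-interchange = solve-∀

Sum-+ : ∀ m f g → Sum m (λ i → f i + g i) ≡ Sum m f + Sum m g
Sum-+ zero f g = refl
Sum-+ (suc m) f g = trans (cong (_+ (f m + g m)) (Sum-+ m f g)) (+-interchange (Sum m f) (Sum m g) (f m) (g m))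

Sum-*ˡ : ∀ m c f → Sum m (λ i → c * f i) ≡ c * Sum m f
Sum-*ˡ zero c f = sym (*-zeroʳ c)
Sum-*ˡ (suc m) c f = trans (cong (_+ c * f m) (Sum-*ˡ m c f)) (sym (*-distribˡ-+ c (Sum m f) (f m)))

Sum-term : ∀ m f {i} → i < m → f i ≤ Sum m f
Sum-term (suc m) f {i} i<sm with i ≟ m
... | yes refl = m≤n+m (f m) (Sum m f)
... | no i≢m = ≤-trans (Sum-term m f (≤∧≢⇒< (s≤s⁻¹ i<sm) i≢m)) (m≤m+n (Sum m f) (f m))

Sum-pos : ∀ m f → 0 < Sum m f → ∃[ i ] i < m × 0 < f i
Sum-pos (suc m) f pos with Sum m f in eq
... | zero = m , ≤-refl , pos
... | suc _ with Sum-pos m f (subst (0 <_) (sym eq) z<s)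
...   | i , i<m , fi>0 = i , m<n⇒m<1+n i<m , fi>0

Sum-< : ∀ m f g → Sum m f < Sum m g → ∃[ i ] i < m × f i < g i
Sum-< (suc m) f g lt with f m <? g m
... | yes fm<gm = m , ≤-refl , fm<gm
... | no fm≮gm with Sum m f <? Sum m g
...   | yes lt′ = let i , i<m , fi<gi = Sum-< m f g lt′ in i , m<n⇒m<1+n i<m , fi<gi
...   | no ≮ = ⊥-elim (<⇒≱ lt (+-mono-≤ (≮⇒≥ ≮) (≮⇒≥ fm≮gm)))

Sum-extend : ∀ {m k} f → m ≤ k → (∀ i → m ≤ i → f i ≡ 0) → Sum k f ≡ Sum m f
Sum-extend {k = zero} f z≤n zr = refl
Sum-extend {m} {suc k} f m≤sk zr with m ≟ suc k
... | yes refl = refl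
... | no m≢ = let m≤k = s≤s⁻¹ (≤∧≢⇒< m≤sk m≢) in
  trans (cong₂ _+_ (Sum-extend f m≤k zr) (zr k m≤k)) (+-identityʳ (Sum m f))

Sum-cut : ∀ m f → (∀ b → b ≤ m → Sum m (λ i → if i <ᵇ b then f i else 0) ≡ Sum b f)
Sum-cut m f b b≤m = trans (Sum-extend _ b≤m (λ i b≤i → cong (if_then f i else 0) (<ᵇ-false b≤i)))
  (Sum-cong b (λ i i<b → cong (if_then f i else 0) (<ᵇ-true i<b)))

_⊆_ : (ℕ → Bool) → (ℕ → Bool) → Set
p ⊆ q = ∀ x → p x ≡ true → q x ≡ true

search : ∀ m (p : ℕ → Bool) → (∃[ x ] x < m × p x ≡ true) ⊎ (∀ x → x < m → p x ≡ false)
search zero p = inj₂ (λ _ ())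
search (suc m) p with p m in eq | search m p
... | true  | _ = inj₁ (m , ≤-refl , eq)
... | false | inj₁ (x , x<m , px) = inj₁ (x , m<n⇒m<1+n x<m , px)
... | false | inj₂ none = inj₂ last
  where
  last : ∀ x → x < suc m → p x ≡ false
  last x x<sm with x ≟ m
  ... | yes refl = eq
  ... | no x≢m = none x (≤∧≢⇒< (s≤s⁻¹ x<sm) x≢m)

count : ℕ → (ℕ → Bool) → ℕ
count m p = Sum m (λ x → 𝟙 (p x))

𝟙-mono : ∀ {a b} → (a ≡ true → b ≡ true) → 𝟙 a ≤ 𝟙 b
𝟙-mono {false} a⇒b = z≤n
𝟙-mono {true} a⇒b rewrite a⇒b refl = ≤-refl

𝟙-< : ∀ {a b} → 𝟙 a < 𝟙 b → a ≡ false × b ≡ true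
𝟙-< {false} {true} _ = refl , refl
𝟙-< {true} {true} (s≤s ())

count-mono : ∀ m {p q} → p ⊆ q → count m p ≤ count m q
count-mono m p⊆q = Sum-mono m (λ i _ → 𝟙-mono (p⊆q i))

count-≤ : ∀ m p → count m p ≤ m
count-≤ m p = ≤-trans (Sum-bound m (λ i _ → 𝟙≤1 (p i))) (≤-reflexive (*-identityʳ m))

count-cong : ∀ m {p q} → (∀ x → x < m → p x ≡ q x) → count m p ≡ count m q
count-cong m eq = Sum-cong m (λ i i<m → cong 𝟙 (eq i i<m))

count-singleton : ∀ m v → count m (_≡ᵇ v) ≤ 1
count-singleton zero v = z≤n
count-singleton (suc m) v with m ≟ v
... | no m≢v rewrite ≡ᵇ-false m≢v | +-identityʳ (count m (_≡ᵇ v)) = count-singleton m v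
... | yes refl rewrite ≡ᵇ-refl m = ≤-reflexive (cong (_+ 1)
  (trans (Sum-cong m (λ i i<m → cong 𝟙 (≡ᵇ-false (<⇒≢ i<m)))) (Sum-zero m)))

𝟙-∨ : ∀ a b → 𝟙 (a ∨ b) ≤ 𝟙 a + 𝟙 b
𝟙-∨ true b = s≤s z≤n
𝟙-∨ false b = ≤-refl

count-∨ : ∀ m (p q : ℕ → Bool) → count m (λ x → p x ∨ q x) ≤ count m p + count m q
count-∨ m p q = ≤-trans (Sum-mono m (λ i _ → 𝟙-∨ (p i) (q i))) (≤-reflexive (Sum-+ m _ _))

𝟙-split : ∀ a b → 𝟙 a ≡ 𝟙 (a ∧ b) + 𝟙 (a ∧ not b)
𝟙-split false b = refl
𝟙-split true true = refl
𝟙-split true false = refl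

count-split : ∀ m (p q : ℕ → Bool) → count m p ≡ count m (λ x → p x ∧ q x) + count m (λ x → p x ∧ not (q x))
count-split m p q = trans (Sum-cong m {λ x → 𝟙 (p x)} (λ i _ → 𝟙-split (p i) (q i))) (Sum-+ m (λ x → 𝟙 (p x ∧ q x)) (λ x → 𝟙 (p x ∧ not (q x))))

insert : (ℕ → Bool) → ℕ → ℕ → Bool
insert p y x = p x ∨ (x ≡ᵇ y)

∨-falseʳ : ∀ a {b} → b ≡ false → a ∨ b ≡ a
∨-falseʳ true _ = refl
∨-falseʳ false eq = eq

count-insert : ∀ m p {y} → p y ≡ false → y < m → count m (insert p y) ≡ suc (count m p)
count-insert (suc m) p {y} py y<sm with m ≟ y
... | yes refl rewrite py | ≡ᵇ-refl m = trans (+-comm _ 1) (cong suc (trans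
  (count-cong m (λ x x<m → ∨-falseʳ (p x) (≡ᵇ-false (<⇒≢ x<m)))) (sym (+-identityʳ _))))
... | no m≢y rewrite ∨-falseʳ (p m) (≡ᵇ-false m≢y) =
  cong (_+ 𝟙 (p m)) (count-insert m p py (≤∧≢⇒< (s≤s⁻¹ y<sm) (λ y≡m → m≢y (sym y≡m))))

-- Branching walks

-- Nodes carry the vertices they are mapped to. Splitting off one child at a time keeps the
-- recursion binary, so that counting becomes a convolution over the number of edges.
data Tree : Set where
  leaf  : ℕ → Tree
  graft : Tree → Tree → Tree

mem? : ℕ → Tree → Bool
mem? x (leaf v)    = x ≡ᵇ v
mem? x (graft t u) = mem? x t ∨ mem? x u

allIn : (ℕ → Bool) → Tree → Bool
allIn p (leaf v)    = p v
allIn p (graft t u) = allIn p t ∧ allIn p u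

allIn⁻ : ∀ {p} t → allIn p t ≡ true → (λ x → mem? x t) ⊆ p
allIn⁻ {p} (leaf v) pv x x∈ = subst (λ y → p y ≡ true) (sym (≡ᵇ-true x∈)) pv
allIn⁻ (graft t u) all x x∈ with ∧⁻ {allIn _ t} all | ∨⁻ {mem? x t} x∈
... | pt , pu | inj₁ x∈t = allIn⁻ t pt x x∈t
... | pt , pu | inj₂ x∈u = allIn⁻ u pu x x∈u

allIn⁺ : ∀ {p} t → (λ x → mem? x t) ⊆ p → allIn p t ≡ true
allIn⁺ (leaf v) t⊆p = t⊆p v (≡ᵇ-refl v)
allIn⁺ (graft t u) t⊆p =
  ∧⁺ (allIn⁺ t (λ x x∈ → t⊆p x (∨⁺ˡ x∈))) (allIn⁺ u (λ x x∈ → t⊆p x (∨⁺ʳ {mem? x t} x∈)))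

𝟙-∧ : ∀ a b → 𝟙 (a ∧ b) ≡ 𝟙 a * 𝟙 b
𝟙-∧ true b = sym (+-identityʳ (𝟙 b))
𝟙-∧ false b = refl

module Graph (F : ℕ) (E : ℕ → ℕ → Bool) where

  Edge : (ℕ → Bool) → ℕ → ℕ → Set
  Edge H u v = H u ≡ true × H v ≡ true × E u v ≡ true

  Conn : (ℕ → Bool) → Set
  Conn H = ∀ {u v} → H u ≡ true → H v ≡ true → Star (Edge H) u v

  -- Valid s v t: t is a rooted plane tree with s edges, mapped homomorphically
  -- to the graph with the root going to v; t grafts the last child of the root.
  data Valid : ℕ → ℕ → Tree → Set where
    leaf  : ∀ {v} → Valid 0 v (leaf v)
    graft : ∀ {i j v w t u} → Valid i v t → E v w ≡ true → Valid j w u → Valid (suc (i + j)) v (graft t u)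

  -- The sum of φ over all t with Valid s v t, if the fuel is at least s < F.
  sumT : ℕ → ℕ → ℕ → (Tree → ℕ) → ℕ
  sumT f       zero    v φ = φ (leaf v)
  sumT zero    (suc s) v φ = 0
  sumT (suc f) (suc s) v φ = Sum F λ w → if E v w then
    Sum F (λ i → if i <ᵇ suc s then sumT f i v (λ t → sumT f (s ∸ i) w (λ u → φ (graft t u))) else 0) else 0

  if-cong : ∀ b {x y : ℕ} → (b ≡ true → x ≡ y) → (if b then x else 0) ≡ (if b then y else 0)
  if-cong true eq = eq refl
  if-cong false eq = refl

  if-+ : ∀ b x y → (if b then x + y else 0) ≡ (if b then x else 0) + (if b then y else 0)
  if-+ true x y = refl
  if-+ false x y = refl

  if-* : ∀ b c x → (if b then c * x else 0) ≡ c * (if b then x else 0)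
  if-* true c x = refl
  if-* false c x = sym (*-zeroʳ c)

  if-≤ : ∀ b {x y} → x ≤ y → (if b then x else 0) ≤ y
  if-≤ true le = le
  if-≤ false le = z≤n

  if-pos : ∀ b {x} → 0 < (if b then x else 0) → b ≡ true × 0 < x
  if-pos true pos = refl , pos

  sumT-cong : ∀ f s v {φ ψ} → (∀ t → φ t ≡ ψ t) → sumT f s v φ ≡ sumT f s v ψ
  sumT-cong f zero v eq = eq (leaf v)
  sumT-cong zero (suc s) v eq = refl
  sumT-cong (suc f) (suc s) v eq = Sum-cong F λ w _ → if-cong (E v w) λ _ → Sum-cong F λ i _ → if-cong (i <ᵇ suc s) λ _ →
    sumT-cong f i v λ t → sumT-cong f (s ∸ i) w λ u → eq (graft t u)

  sumT-+ : ∀ f s v φ ψ → sumT f s v (λ t → φ t + ψ t) ≡ sumT f s v φ + sumT f s v ψ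
  sumT-+ f zero v φ ψ = refl
  sumT-+ zero (suc s) v φ ψ = refl
  sumT-+ (suc f) (suc s) v φ ψ = trans
    (Sum-cong F λ w _ → trans
      (if-cong (E v w) λ _ → trans
        (Sum-cong F λ i _ → trans
          (if-cong (i <ᵇ suc s) λ _ → trans
            (sumT-cong f i v λ t → sumT-+ f (s ∸ i) w (λ u → φ (graft t u)) (λ u → ψ (graft t u)))
            (sumT-+ f i v _ _))
          (if-+ (i <ᵇ suc s) _ _))
        (Sum-+ F _ _))
      (if-+ (E v w) _ _))
    (Sum-+ F _ _)

  sumT-* : ∀ f s v c φ → sumT f s v (λ t → c * φ t) ≡ c * sumT f s v φ
  sumT-* f zero v c φ = refl
  sumT-* zero (suc s) v c φ = sym (*-zeroʳ c)
  sumT-* (suc f) (suc s) v c φ = trans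
    (Sum-cong F λ w _ → trans
      (if-cong (E v w) λ _ → trans
        (Sum-cong F λ i _ → trans
          (if-cong (i <ᵇ suc s) λ _ → trans
            (sumT-cong f i v λ t → sumT-* f (s ∸ i) w c (λ u → φ (graft t u)))
            (sumT-* f i v c _))
          (if-* (i <ᵇ suc s) c _))
        (Sum-*ˡ F c _))
      (if-* (E v w) c _))
    (Sum-*ˡ F c _)

  -- Recursion is on the fuel because `s ∸ i` is not structurally smaller than `suc s`; the sum must
  -- then be shown independent of it.
  sumT-fuel : ∀ f g s v φ → s ≤ f → s ≤ g → sumT f s v φ ≡ sumT g s v φ
  sumT-fuel f g zero v φ _ _ = refl
  sumT-fuel (suc f) (suc g) (suc s) v φ (s≤s s≤f) (s≤s s≤g) =
    Sum-cong F λ w _ → if-cong (E v w) λ _ → Sum-cong F λ i _ → if-cong (i <ᵇ suc s) λ i≤s →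
      let i≤s = s≤s⁻¹ (<ᵇ-true⁻ i (suc s) i≤s) in trans
        (sumT-cong f i v λ t → sumT-fuel f g (s ∸ i) w _ (≤-trans (m∸n≤m s i) s≤f) (≤-trans (m∸n≤m s i) s≤g))
        (sumT-fuel f g i v _ (≤-trans i≤s s≤f) (≤-trans i≤s s≤g))

  -- The two halves of a graft are chosen independently, so a multiplicative weight turns the nested
  -- sum into products of table entries. Being inside an allowed set is such a weight, while
  -- covering a set is not; hence the Möbius transform.
  sumT-multiplicative : ∀ s v φ → (∀ t u → φ (graft t u) ≡ φ t * φ u) → suc s < F →
    sumT F (suc s) v φ ≡ Sum F λ w → if E v w then
      Sum F (λ i → if i <ᵇ suc s then sumT F i v φ * sumT F (s ∸ i) w φ else 0) else 0
  -- One more unit of fuel, so that both halves are summed with fuel `F` again.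
  sumT-multiplicative s v φ mult ss<F = trans (sumT-fuel F (suc F) (suc s) v φ (<⇒≤ ss<F) (≤-trans (<⇒≤ ss<F) (n≤1+n F)))
    (Sum-cong F λ w _ → if-cong (E v w) λ _ → Sum-cong F λ i _ → if-cong (i <ᵇ suc s) λ _ → let c = sumT F (s ∸ i) w φ in begin
      sumT F i v (λ t → sumT F (s ∸ i) w (λ u → φ (graft t u)))  ≡⟨ sumT-cong F i v (λ t → sumT-cong F (s ∸ i) w (mult t)) ⟩
      sumT F i v (λ t → sumT F (s ∸ i) w (λ u → φ t * φ u))      ≡⟨ sumT-cong F i v (λ t → trans (sumT-* F (s ∸ i) w (φ t) φ) (*-comm (φ t) c)) ⟩
      sumT F i v (λ t → c * φ t)                                 ≡⟨ sumT-* F i v c φ ⟩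
      c * sumT F i v φ                                           ≡⟨ *-comm c _ ⟩
      sumT F i v φ * c                                           ∎)
    where open ≡-Reasoning

  sumT-pos : ∀ f s v φ → 0 < sumT f s v φ → ∃[ t ] Valid s v t × 0 < φ t
  sumT-pos f zero v φ pos = leaf v , leaf , pos
  sumT-pos (suc f) (suc s) v φ pos =
    let w , _ , pos₁ = Sum-pos F _ pos
        e , pos₂ = if-pos (E v w) pos₁
        i , _ , pos₃ = Sum-pos F _ pos₂
        i≤s , pos₄ = if-pos (i <ᵇ suc s) pos₃
        t , valid-t , pos₅ = sumT-pos f i v _ pos₄
        u , valid-u , pos₆ = sumT-pos f (s ∸ i) w _ pos₅
    in graft t u , subst (λ k → Valid (suc k) v (graft t u)) (m+[n∸m]≡n (s≤s⁻¹ (<ᵇ-true⁻ i (suc s) i≤s))) (graft valid-t e valid-u) , pos₆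

  module _ (E<F : ∀ u v → E u v ≡ true → v < F) where

    -- Counterpart of `sumT-pos`: together they make positivity of a sum equivalent to the existence
    -- of a tree of positive weight.
    sumT-term : ∀ f {s v t} φ → Valid s v t → s ≤ f → s < F → φ t ≤ sumT f s v φ
    sumT-term f φ leaf _ _ = ≤-refl
    sumT-term (suc f) {v = v} φ (graft {i} {j} {w = w} {t} {u} vt e vu) (s≤s s≤f) s<F = begin
      φ (graft t u)                                         ≤⟨ sumT-term f (λ u → φ (graft t u)) vu (≤-trans (m≤n+m j i) s≤f) (≤-trans (s≤s (m≤n+m j i)) (<⇒≤ s<F)) ⟩
      sumT f j w (λ u → φ (graft t u))                      ≡⟨ cong (λ k → sumT f k w (λ u → φ (graft t u))) (m+n∸m≡n i j) ⟨
      sumT f (i + j ∸ i) w (λ u → φ (graft t u))            ≤⟨ sumT-term f (λ t → sumT f (i + j ∸ i) w (λ u → φ (graft t u))) vt (≤-trans (m≤m+n i j) s≤f) (≤-trans (s≤s (m≤m+n i j)) (<⇒≤ s<F)) ⟩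
      pairs i                                               ≡⟨ cong (if_then pairs i else 0) (<ᵇ-true (s≤s (m≤m+n i j))) ⟨
      (if i <ᵇ suc (i + j) then pairs i else 0)             ≤⟨ Sum-term F (λ k → if k <ᵇ suc (i + j) then pairs k else 0) (≤-trans (s≤s (m≤m+n i j)) (<⇒≤ s<F)) ⟩
      children w                                            ≡⟨ cong (if_then children w else 0) e ⟨
      (if E v w then children w else 0)                     ≤⟨ Sum-term F (λ w → if E v w then children w else 0) (E<F v w e) ⟩
      sumT (suc f) (suc (i + j)) v φ                        ∎
      where
      open ≤-Reasoning
      children : ℕ → ℕ
      children w = Sum F (λ k → if k <ᵇ suc (i + j) then sumT f k v (λ t → sumT f (i + j ∸ k) w (λ u → φ (graft t u))) else 0)
      pairs : ℕ → ℕ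
      pairs k = sumT f k v (λ t → sumT f (i + j ∸ k) w (λ u → φ (graft t u)))

  square-split : ∀ {i s} → i ≤ s → i * i + (s ∸ i) * (s ∸ i) ≤ s * s
  square-split {i} {s} i≤s = subst (λ k → i * i + j * j ≤ k * k) (m+[n∸m]≡n i≤s)
    (≤-trans (m≤m+n (i * i + j * j) (i * j + i * j)) (≤-reflexive (expand i j)))
    where
    j = s ∸ i
    expand : ∀ i j → i * i + j * j + (i * j + i * j) ≡ (i + j) * (i + j)
    expand = solve-∀

  -- A split picks the child `w` and the share `i` of the edges in at most `F * F` ways, and
  -- `square-split` lets the exponents of the two halves fit into that of the whole. The aim is a
  -- polynomial number of bits.
  sumT-≤ : ∀ f s v φ c → 0 < F → (∀ t → φ t ≤ c) → sumT f s v φ ≤ (F * F) ^ (s * s) * c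
  sumT-≤ f zero v φ c 0<F φ≤c = ≤-trans (φ≤c (leaf v)) (≤-reflexive (sym (+-identityʳ c)))
  sumT-≤ zero (suc s) v φ c 0<F φ≤c = z≤n
  sumT-≤ (suc f) (suc s) v φ c 0<F φ≤c = begin
    sumT (suc f) (suc s) v φ                   ≤⟨ Sum-bound F (λ w _ → if-≤ (E v w) (Sum-bound F (λ i _ → inner w i))) ⟩
    F * (F * (W ^ (s * s) * c))                ≡⟨ trans (sym (*-assoc F F _)) (sym (*-assoc (F * F) _ c)) ⟩
    W ^ suc (s * s) * c                        ≤⟨ *-monoˡ-≤ c (^-monoʳ-≤ W ⦃ >-nonZero W>0 ⦄ (s≤s (≤-trans (m≤n+m (s * s) s) (+-monoʳ-≤ s (*-monoʳ-≤ s (n≤1+n s)))))) ⟩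
    W ^ (suc s * suc s) * c                    ∎
    where
    open ≤-Reasoning
    W = F * F
    W>0 : 0 < W
    W>0 = *-mono-< 0<F 0<F
    inner : ∀ w i → (if i <ᵇ suc s then sumT f i v (λ t → sumT f (s ∸ i) w (λ u → φ (graft t u))) else 0) ≤ W ^ (s * s) * c
    inner w i with i <ᵇ suc s in eq
    ... | false = z≤n
    ... | true = begin
      sumT f i v (λ t → sumT f (s ∸ i) w (λ u → φ (graft t u)))
        ≤⟨ sumT-≤ f i v _ _ 0<F (λ t → sumT-≤ f (s ∸ i) w _ c 0<F (λ u → φ≤c (graft t u))) ⟩
      W ^ (i * i) * (W ^ ((s ∸ i) * (s ∸ i)) * c)   ≡⟨ *-assoc (W ^ (i * i)) _ c ⟨
      W ^ (i * i) * W ^ ((s ∸ i) * (s ∸ i)) * c     ≡⟨ cong (_* c) (^-distribˡ-+-* W (i * i) _) ⟨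
      W ^ (i * i + (s ∸ i) * (s ∸ i)) * c           ≤⟨ *-monoˡ-≤ c (^-monoʳ-≤ W ⦃ >-nonZero W>0 ⦄ (square-split (s≤s⁻¹ (<ᵇ-true⁻ i (suc s) eq)))) ⟩
      W ^ (s * s) * c                               ∎

  root-mem : ∀ {s v t} → Valid s v t → mem? v t ≡ true
  root-mem {v = v} leaf = ≡ᵇ-refl v
  root-mem (graft vt _ _) = ∨⁺ˡ (root-mem vt)

  -- Only an inequality, as several nodes may be mapped to the same vertex.
  count-mem : ∀ {s v t} → Valid s v t → count F (λ x → mem? x t) ≤ suc s
  count-mem {v = v} leaf = count-singleton F v
  count-mem (graft {i} {j} {t = t} {u} vt _ vu) = ≤-trans (count-∨ F _ _)
    (≤-trans (+-mono-≤ (count-mem vt) (count-mem vu)) (≤-reflexive (cong suc (+-suc i j))))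

  -- The leaf becomes the last child of some node mapped to `x`, found by descending into the half
  -- that contains one.
  add-leaf : ∀ {s v t x} y → Valid s v t → mem? x t ≡ true → E x y ≡ true →
             ∃[ t₁ ] Valid (suc s) v t₁ × (∀ z → mem? z t₁ ≡ insert (λ z → mem? z t) y z)
  add-leaf {v = v} y leaf x∈ e = graft (leaf v) (leaf y) ,
    graft leaf (subst (λ x → E x y ≡ true) (≡ᵇ-true x∈) e) leaf , λ z → refl
  add-leaf {v = v} {x = x} y (graft {i} {j} {t = t} {u} vt e′ vu) x∈ e with ∨⁻ {mem? x t} x∈
  ... | inj₁ x∈t = let t₁ , vt₁ , eq = add-leaf y vt x∈t e in
    graft t₁ u , graft vt₁ e′ vu , λ z → trans (cong (_∨ mem? z u) (eq z)) (swap (mem? z t) (z ≡ᵇ y) (mem? z u))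
    where
    swap : ∀ a b c → (a ∨ b) ∨ c ≡ (a ∨ c) ∨ b
    swap true b c = refl
    swap false true true = refl
    swap false true false = refl
    swap false false true = refl
    swap false false false = refl
  ... | inj₂ x∈u = let u₁ , vu₁ , eq = add-leaf y vu x∈u e in
    graft t u₁ , subst (λ k → Valid (suc k) v (graft t u₁)) (+-suc i j) (graft vt e′ vu₁) ,
    λ z → trans (cong (mem? z t ∨_) (eq z)) (assoc (mem? z t) (mem? z u) (z ≡ᵇ y))
    where
    assoc : ∀ a b c → a ∨ (b ∨ c) ≡ (a ∨ b) ∨ c
    assoc true b c = refl
    assoc false b c = refl

  tree-path : ∀ {H s v t x} → Valid s v t → (λ z → mem? z t) ⊆ H → mem? x t ≡ true → Star (Edge H) v x
  tree-path {H} {v = v} leaf t⊆H x∈ = subst (Star (Edge H) v) (sym (≡ᵇ-true x∈)) ε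
  tree-path {x = x} (graft {t = t} {u} vt e vu) t⊆H x∈ with ∨⁻ {mem? x t} x∈
  ... | inj₁ x∈t = tree-path vt (λ z z∈ → t⊆H z (∨⁺ˡ z∈)) x∈t
  ... | inj₂ x∈u = (t⊆H _ (∨⁺ˡ (root-mem vt)) , t⊆H _ (∨⁺ʳ {mem? _ t} (root-mem vu)) , e) ◅
                   tree-path vu (λ z z∈ → t⊆H z (∨⁺ʳ {mem? z t} z∈)) x∈u

  crossing : ∀ {H a b} (p : ℕ → Bool) → Star (Edge H) a b → p a ≡ true → p b ≡ false →
             ∃[ x ] ∃[ y ] Edge H x y × p x ≡ true × p y ≡ false
  crossing p ε pa pb = ⊥-elim (true≢false pa pb)
  crossing p (_◅_ {j = c} e path) pa pb with p c in eq
  ... | true  = crossing p path eq pb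
  ... | false = _ , c , e , pa , eq

  module _ (E-sym : ∀ u v → E u v ≡ E v u) where

    tree-conn : ∀ {s v t} → Valid s v t → Conn (λ z → mem? z t)
    tree-conn vt u∈ w∈ = reverse (λ (a , b , e) → b , a , trans (E-sym _ _) e) (tree-path vt (λ z z∈ → z∈) u∈)
                         ◅◅ tree-path vt (λ z z∈ → z∈) w∈

  -- Grown from the root: as long as a vertex of `H` is missing, a path to it leaves the tree along
  -- an edge whose far end is new. Every step adds a new vertex, so here nodes and image have the
  -- same number.
  spanning-tree : ∀ {H v} → (∀ x → H x ≡ true → x < F) → Conn H → H v ≡ true →
    ∃[ s ] ∃[ t ] Valid s v t × (∀ x → mem? x t ≡ H x) × suc s ≡ count F H
  -- The first argument of `grow` bounds the number of vertices still missing and makes the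
  -- recursion structural.
  spanning-tree {H} {v} H<F conn v∈ = grow (count F H) 0 (leaf v) leaf
      (λ x x∈ → subst (λ y → H y ≡ true) (sym (≡ᵇ-true x∈)) v∈)
      (≤-antisym (count-singleton F v) (≤-trans (≤-reflexive (cong 𝟙 (sym (≡ᵇ-refl v)))) (Sum-term F (λ x → 𝟙 (x ≡ᵇ v)) (H<F v v∈))))
      (m≤m+n (count F H) 1)
    where
    grow : ∀ m s t → Valid s v t → (λ x → mem? x t) ⊆ H → count F (λ x → mem? x t) ≡ suc s →
      count F H ≤ m + suc s →
      ∃[ s ] ∃[ t ] Valid s v t × (∀ x → mem? x t ≡ H x) × suc s ≡ count F H
    grow m s t vt t⊆H size bound with search F (λ x → H x ∧ not (mem? x t))
    ... | inj₂ none = s , t , vt , same , trans (sym size) (count-cong F (λ x _ → same x))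
      where
      same : ∀ x → mem? x t ≡ H x
      same x with mem? x t in eq | H x in eq′
      ... | true  | true  = refl
      ... | false | false = refl
      ... | true  | false = ⊥-elim (true≢false (t⊆H x eq) eq′)
      ... | false | true  = ⊥-elim (true≢false (∧⁺ eq′ (cong not eq)) (none x (H<F x eq′)))
    ... | inj₁ (y , y<F , found)
      with crossing (λ x → mem? x t) (conn v∈ (proj₁ (∧⁻ {H y} found))) (root-mem vt) (not-true (proj₂ (∧⁻ {H y} found)))
      where
      not-true : ∀ {b} → not b ≡ true → b ≡ false
      not-true {false} _ = refl
    ... | a , b , (a∈H , b∈H , e) , a∈t , b∉t with add-leaf b vt a∈t e
    ... | t₁ , vt₁ , eq = continue m bound
      where
      size₁ : count F (λ x → mem? x t₁) ≡ suc (suc s)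
      size₁ = trans (count-cong F (λ x _ → eq x)) (trans (count-insert F _ b∉t (H<F b b∈H)) (cong suc size))
      t₁⊆H : (λ x → mem? x t₁) ⊆ H
      t₁⊆H x x∈ with ∨⁻ {mem? x t} (trans (sym (eq x)) x∈)
      ... | inj₁ x∈t = t⊆H x x∈t
      ... | inj₂ x≡b = subst (λ y → H y ≡ true) (sym (≡ᵇ-true x≡b)) b∈H
      continue : ∀ m → count F H ≤ m + suc s → ∃[ s ] ∃[ t ] Valid s v t × (∀ x → mem? x t ≡ H x) × suc s ≡ count F H
      -- The enlarged tree has `s + 2` vertices, all in `H`, which has at most `s + 1`.
      continue zero le = ⊥-elim (<-irrefl refl (≤-trans (≤-reflexive (sym size₁)) (≤-trans (count-mono F t₁⊆H) le)))
      continue (suc m) le = grow m (suc s) t₁ vt₁ t₁⊆H size₁ (≤-trans le (≤-reflexive (sym (+-suc m (suc s)))))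

-- Inclusion–exclusion over the minority colour

allBelow : ℕ → (ℕ → Bool) → Bool
allBelow zero    p = true
allBelow (suc j) p = allBelow j p ∧ p j

allBelow⁻ : ∀ j p {x} → allBelow j p ≡ true → x < j → p x ≡ true
allBelow⁻ (suc j) p {x} all x≤j with x ≟ j
... | yes refl = proj₂ (∧⁻ {allBelow j p} all)
... | no x≢j = allBelow⁻ j p (proj₁ (∧⁻ {allBelow j p} all)) (≤∧≢⇒< (s≤s⁻¹ x≤j) x≢j)

allBelow⁺ : ∀ j p → (∀ x → x < j → p x ≡ true) → allBelow j p ≡ true
allBelow⁺ zero p all = refl
allBelow⁺ (suc j) p all = ∧⁺ (allBelow⁺ j p (λ x x<j → all x (m<n⇒m<1+n x<j))) (all j ≤-refl)

allBelow-cong : ∀ j {p q} → (∀ x → x < j → p x ≡ q x) → allBelow j p ≡ allBelow j q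
allBelow-cong zero eq = refl
allBelow-cong (suc j) eq = cong₂ _∧_ (allBelow-cong j (λ x x<j → eq x (m<n⇒m<1+n x<j))) (eq j ≤-refl)

∧-falseʳ : ∀ a {b} → b ≡ false → a ∧ b ≡ false
∧-falseʳ true eq = eq
∧-falseʳ false eq = refl

∧-trueʳ : ∀ a {b} → b ≡ true → a ∧ b ≡ a
∧-trueʳ true eq = eq
∧-trueʳ false eq = refl

not-true : ∀ {b} → not b ≡ true → b ≡ false
not-true {false} _ = refl

∧-false⁻ : ∀ {a b} → b ≡ true → a ∧ b ≡ false → a ≡ false
∧-false⁻ {false} _ _ = refl
∧-false⁻ {true} b¬ f = ⊥-elim (true≢false b¬ f)

-- bl marks the vertices of the minority colour, all of them below J.
module Decide (F J : ℕ) (E : ℕ → ℕ → Bool)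
  (E<F : ∀ u v → E u v ≡ true → v < F) (E-sym : ∀ u v → E u v ≡ E v u)
  (bl : ℕ → Bool) (bl<J : ∀ x → bl x ≡ true → x < J) where

  open Graph F E public

  -- `C` is the set of vertices under consideration in the self-reduction; of the minority colour
  -- only members of `S` may be used.
  allowed : (C S : ℕ → Bool) → ℕ → Bool
  allowed C S v = if bl v then C v ∧ S v else C v

  -- Only members of `S` below `j` must occur. This interpolates between all allowed trees at
  -- `j = 0` and the trees covering `S` at `j = J`.
  covers : ℕ → (ℕ → Bool) → Tree → Bool
  covers j S t = allBelow j (λ w → not (S w) ∨ mem? w t)

  fits : ℕ → (C S : ℕ → Bool) → Tree → Bool
  fits j C S t = allIn (allowed C S) t ∧ covers j S t

  -- Fewer than `k + k` edges means at most `2 k` nodes. The bound `k` is separate from the size of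
  -- `S` because the Möbius transform shrinks `S` and must leave the bound fixed.
  trees : ℕ → ℕ → (C S : ℕ → Bool) → ℕ
  trees j k C S = Sum F λ s → if s <ᵇ k + k then Sum F (λ v → sumT F s v (λ t → 𝟙 (fits j C S t))) else 0

  reach : ℕ → (C S : ℕ → Bool) → ℕ → Bool
  reach zero    C S v = allowed C S v ∧ bl v
  reach (suc i) C S v = allowed C S v ∧ (reach i C S v ∨ nz (Sum F (λ u → if E u v then 𝟙 (reach i C S u) else 0)))

  -- Red means the majority colour here. A spanning tree of a solution has fewer than `F` edges, so
  -- `F ∸ 1` search steps reach all of it.
  reds : (C S : ℕ → Bool) → ℕ
  reds C S = count F (λ v → reach (F ∸ 1) C S v ∧ not (bl v))

  -- Zero also serves for failure, since the empty subgraph is always feasible.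
  value : (C S : ℕ → Bool) → ℕ
  value C S = if nz (trees J (count F S) C S) then (if reds C S <ᵇ count F S then 0 else count F S) else 0

  allowed⊆ : ∀ C S → allowed C S ⊆ C
  allowed⊆ C S x ok with bl x
  ... | true = proj₁ (∧⁻ {C x} ok)
  ... | false = ok

  allowed-blue : ∀ C S {x} → allowed C S x ≡ true → bl x ≡ true → S x ≡ true
  allowed-blue C S {x} ok b rewrite b = proj₂ (∧⁻ {C x} ok)

  trees-cong : ∀ j j′ k {C S C′ S′} → (∀ t → fits j C S t ≡ fits j′ C′ S′ t) → trees j k C S ≡ trees j′ k C′ S′
  trees-cong j j′ k eq = Sum-cong F λ s _ → if-cong (s <ᵇ k + k) λ _ → Sum-cong F λ v _ → sumT-cong F s v (λ t → cong 𝟙 (eq t))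

  trees-skip : ∀ j k C S → S j ≡ false → trees (suc j) k C S ≡ trees j k C S
  trees-skip j k C S j∉ = trees-cong (suc j) j k {C} {S} {C} {S} λ t → cong (allIn (allowed C S) t ∧_)
    (∧-trueʳ (covers j S t) (cong (λ b → not b ∨ mem? j t) j∉))

  -- Trees avoiding j are counted by dropping j from S, for j cannot be used then.
  trees-drop : ∀ j k C S S′ → bl j ≡ true → S j ≡ true → S′ j ≡ false → (∀ x → x ≢ j → S′ x ≡ S x) →
               trees (suc j) k C S + trees j k C S′ ≡ trees j k C S
  trees-drop j k C S S′ bj j∈ j∉ same = sym (trans
    (Sum-cong F λ s _ → trans
      (if-cong (s <ᵇ k + k) λ _ → trans
        (Sum-cong F λ v _ → trans (sumT-cong F s v (λ t → sym (pointwise t))) (sumT-+ F s v _ _))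
        (Sum-+ F _ _))
      (if-+ (s <ᵇ k + k) _ _))
    (Sum-+ F _ _))
    where
    allowed-same : ∀ x → x ≢ j → allowed C S′ x ≡ allowed C S x
    allowed-same x x≢j with bl x
    ... | true = cong (C x ∧_) (same x x≢j)
    ... | false = refl
    allIn-same : ∀ t → mem? j t ≡ false → allIn (allowed C S′) t ≡ allIn (allowed C S) t
    allIn-same (leaf v) j∉t = allowed-same v λ { refl → true≢false (≡ᵇ-refl j) j∉t }
    allIn-same (graft t u) j∉t with mem? j t in eq
    ... | false = cong₂ _∧_ (allIn-same t eq) (allIn-same u j∉t)
    covers-same : ∀ t → covers j S′ t ≡ covers j S t
    covers-same t = allBelow-cong j λ x x<j → cong (λ b → not b ∨ mem? x t) (same x (<⇒≢ x<j))
    j-blocked : ∀ t → mem? j t ≡ true → allIn (allowed C S′) t ≡ false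
    j-blocked t j∈t with allIn (allowed C S′) t in eq
    ... | false = refl
    ... | true = ⊥-elim (true≢false (allowed-blue C S′ (allIn⁻ t eq j j∈t) bj) j∉)
    -- A tree using `j` covers it and is not allowed for `S′`. A tree avoiding `j` fails to cover
    -- it, and is counted for `S′` exactly when it is counted for `S` at level `j`.
    pointwise : ∀ t → 𝟙 (fits (suc j) C S t) + 𝟙 (fits j C S′ t) ≡ 𝟙 (fits j C S t)
    pointwise t with mem? j t in eq
    ... | true rewrite j-blocked t eq | j∈ | ∧-trueʳ (covers j S t) {true} refl = +-identityʳ _
    ... | false rewrite allIn-same t eq | covers-same t | j∈ | ∧-falseʳ (covers j S t) {false} refl
                      | ∧-falseʳ (allIn (allowed C S) t) {false} refl = refl

  Balanced-in : (C : ℕ → Bool) → ℕ → (ℕ → Bool) → Set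
  Balanced-in C k H = H ⊆ C × Conn H × count F (λ x → H x ∧ bl x) ≡ k × count F (λ x → H x ∧ not (bl x)) ≡ k

  module _ {C S : ℕ → Bool} where

    -- Walks back along the search from `v` until it enters `p`, which contains all starting points.
    -- The reachable `v` itself need not be adjacent to `p`, so the vertex found may be a different
    -- one.
    escape : ∀ i v (p : ℕ → Bool) → (∀ x → allowed C S x ≡ true → bl x ≡ true → p x ≡ true) →
      reach i C S v ≡ true → p v ≡ false → ∃[ x ] ∃[ y ] p x ≡ true × p y ≡ false × E x y ≡ true × allowed C S y ≡ true
    escape zero v p start r pv =
      let ok , b = ∧⁻ {allowed C S v} r in ⊥-elim (true≢false (start v ok b) pv)
    escape (suc i) v p start r pv with ∧⁻ {allowed C S v} r
    ... | ok , step with ∨⁻ {reach i C S v} step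
    ... | inj₁ r′ = escape i v p start r′ pv
    ... | inj₂ some with Sum-pos F _ (nz-pos some)
    ... | u , _ , pos with if-pos (E u v) pos
    ... | e , pos′ with p u in eq
    ... | true = u , v , eq , pv , e , ok
    ... | false = escape i u p start (trans (sym (nz-𝟙 _)) (pos-nz pos′)) eq

    reach-mono : ∀ i d {v} → reach i C S v ≡ true → reach (i + d) C S v ≡ true
    reach-mono i zero r = subst (λ k → reach k C S _ ≡ true) (sym (+-identityʳ i)) r
    reach-mono i (suc d) {v} r = subst (λ k → reach k C S v ≡ true) (sym (+-suc i d))
      (∧⁺ (reach-allowed i r) (∨⁺ˡ (reach-mono i d r)))
      where
      reach-allowed : ∀ i → reach i C S v ≡ true → allowed C S v ≡ true
      reach-allowed zero r = proj₁ (∧⁻ {allowed C S v} r)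
      reach-allowed (suc i) r = proj₁ (∧⁻ {allowed C S v} r)

    reach-tree : ∀ {s v t} i → Valid s v t → (λ x → mem? x t) ⊆ allowed C S → (∀ x → mem? x t ≡ true → x < F) →
      reach i C S v ≡ true → ∀ x → mem? x t ≡ true → reach (i + s) C S x ≡ true
    reach-tree i leaf ok t<F r x x∈ rewrite +-identityʳ i = subst (λ y → reach i C S y ≡ true) (sym (≡ᵇ-true x∈)) r
    reach-tree i (graft {a} {b} {v} {w} {t} {u} vt e vu) ok t<F r x x∈ with ∨⁻ {mem? x t} x∈
    ... | inj₁ x∈t = subst (λ k → reach k C S x ≡ true) (trans (+-assoc i a (suc b)) (cong (i +_) (+-suc a b)))
                       (reach-mono (i + a) (suc b) (reach-tree i vt (λ y y∈ → ok y (∨⁺ˡ y∈)) (λ y y∈ → t<F y (∨⁺ˡ y∈)) r x x∈t))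
    ... | inj₂ x∈u = subst (λ k → reach k C S x ≡ true) arrange
                       (reach-mono (suc i + b) a (reach-tree (suc i) vu (λ y y∈ → ok y (∨⁺ʳ {mem? y t} y∈)) (λ y y∈ → t<F y (∨⁺ʳ {mem? y t} y∈)) reach-w x x∈u))
      where
      reach-w : reach (suc i) C S w ≡ true
      reach-w = ∧⁺ (ok w (∨⁺ʳ {mem? w t} (root-mem vu))) (∨⁺ʳ {reach i C S w} (pos-nz
        (≤-trans (≤-reflexive (sym (trans (cong (if_then 𝟙 (reach i C S v) else 0) e) (cong 𝟙 r))))
          (Sum-term F (λ u → if E u w then 𝟙 (reach i C S u) else 0) (t<F v (∨⁺ˡ (root-mem vt)))))))
      arrange : suc i + b + a ≡ i + suc (a + b)
      arrange = trans (cong suc (trans (+-assoc i b a) (cong (i +_) (+-comm b a)))) (sym (+-suc i (a + b)))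

    module _ (S⊆bl : S ⊆ bl) (C<F : ∀ x → C x ≡ true → x < F) where

      Extension : ℕ → ℕ → Set
      Extension v r = ∃[ s ] ∃[ t ] Valid s v t × (λ x → mem? x t) ⊆ allowed C S × S ⊆ (λ x → mem? x t) ×
        count F (λ x → mem? x t ∧ not (bl x)) ≡ r

      -- While the tree has fewer reds than are reachable, some reachable red is outside, and
      -- `escape` yields an allowed vertex adjacent to the tree. That vertex is red, because every
      -- allowed vertex of `bl` is in `S` and thus in the tree, so the number of reds grows by
      -- exactly one.
      extend : ∀ d s v t → Valid s v t → (λ x → mem? x t) ⊆ allowed C S → S ⊆ (λ x → mem? x t) →
        count F (λ x → mem? x t ∧ not (bl x)) + d ≤ reds C S → Extension v (count F (λ x → mem? x t ∧ not (bl x)) + d)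
      extend zero s v t vt ok S⊆t le = s , t , vt , ok , S⊆t , sym (+-identityʳ _)
      extend (suc d) s v t vt ok S⊆t le with Sum-< F _ _ (<-≤-trans (m<m+n _ z<s) le)
      ... | x₀ , _ , lt with 𝟙-< {mem? x₀ t ∧ not (bl x₀)} lt
      ... | out , within with ∧⁻ {reach (F ∸ 1) C S x₀} within
      ... | r , rx with escape (F ∸ 1) x₀ (λ x → mem? x t) (λ x okx bx → S⊆t x (allowed-blue C S okx bx)) r (∧-false⁻ rx out)
      ... | x , y , x∈ , y∉ , e , y-ok with add-leaf y vt x∈ e
      ... | t₁ , vt₁ , eq = grown (extend d (suc s) v t₁ vt₁ (ok₁ t₁ y eq y-ok)
              (λ z z∈ → trans (eq z) (∨⁺ˡ (S⊆t z z∈)))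
              (≤-trans (≤-reflexive (trans (cong (_+ d) size) (sym (+-suc _ d)))) le))
        where
        ok₁ : ∀ t₁ y → (∀ z → mem? z t₁ ≡ insert (λ z → mem? z t) y z) → allowed C S y ≡ true → (λ x → mem? x t₁) ⊆ allowed C S
        ok₁ t₁ y eq y-ok z z∈ with ∨⁻ {mem? z t} (trans (sym (eq z)) z∈)
        ... | inj₁ z∈t = ok z z∈t
        ... | inj₂ z≡y = subst (λ w → allowed C S w ≡ true) (sym (≡ᵇ-true z≡y)) y-ok
        distrib : ∀ z y → mem? y t ≡ false → allowed C S y ≡ true →
          insert (λ z → mem? z t) y z ∧ not (bl z) ≡ insert (λ x → mem? x t ∧ not (bl x)) y z
        distrib z y y∉ y-ok with z ≡ᵇ y in eq
        ... | false = trans (cong (_∧ not (bl z)) (∨-falseʳ (mem? z t) refl)) (sym (∨-falseʳ (mem? z t ∧ not (bl z)) refl))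
        ... | true with bl z in bz
        ...   | true = ⊥-elim (true≢false (S⊆t y (allowed-blue C S y-ok (subst (λ w → bl w ≡ true) (≡ᵇ-true eq) bz))) y∉)
        ...   | false = trans (∧-trueʳ _ refl) (trans (∨⁺ʳ {mem? z t} refl) (sym (∨⁺ʳ {mem? z t ∧ true} refl)))
        size : count F (λ x → mem? x t₁ ∧ not (bl x)) ≡ suc (count F (λ x → mem? x t ∧ not (bl x)))
        size = trans (count-cong F (λ z _ → trans (cong (_∧ not (bl z)) (eq z)) (distrib z y y∉ y-ok)))
                 (count-insert F (λ x → mem? x t ∧ not (bl x)) (cong (_∧ not (bl y)) y∉) (C<F y (allowed⊆ C S y y-ok)))
        grown : Extension v (count F (λ x → mem? x t₁ ∧ not (bl x)) + d) → Extension v (count F (λ x → mem? x t ∧ not (bl x)) + suc d)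
        grown (s₂ , t₂ , vt₂ , ok₂ , S⊆t₂ , size₂) =
          s₂ , t₂ , vt₂ , ok₂ , S⊆t₂ , trans size₂ (trans (cong (_+ d) size) (sym (+-suc _ d)))

      -- A counted tree meets `bl` exactly in `S` and has at most as many reds; enough reds are
      -- reachable for `extend` to make up the difference.
      value-sound : ∀ {k} → value C S ≡ suc k → ∃[ H ] Balanced-in C (suc k) H
      value-sound {k} val with nz (trees J (count F S) C S) in some
      ... | true with reds C S <ᵇ count F S in enough
      ... | false with Sum-pos F _ (nz-pos some)
      ... | s , _ , pos₁ with if-pos (s <ᵇ count F S + count F S) pos₁
      ... | s<2k , pos₂ with Sum-pos F _ pos₂
      ... | v , _ , pos₃ with sumT-pos F s v _ pos₃
      ... | t , vt , pos₄ with ∧⁻ {allIn (allowed C S) t} (trans (sym (nz-𝟙 _)) (pos-nz pos₄))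
      ... | all , cov = finish (extend (count F S ∸ count F (λ x → mem? x t ∧ not (bl x))) s v t vt t⊆ S⊆t
              (≤-trans (≤-reflexive (m+[n∸m]≡n few)) (≮⇒≥ (λ lt → true≢false (<ᵇ-true lt) enough))))
        where
        covered : ∀ {a b} → a ≡ true → not a ∨ b ≡ true → b ≡ true
        covered refl eq = eq
        blue-count : ∀ t → (λ x → mem? x t) ⊆ allowed C S → S ⊆ (λ x → mem? x t) → count F (λ x → mem? x t ∧ bl x) ≡ count F S
        blue-count t t⊆ S⊆t = count-cong F λ x _ → same x
          where
          same : ∀ x → mem? x t ∧ bl x ≡ S x
          same x with S x in Sx
          ... | true = ∧⁺ (S⊆t x Sx) (S⊆bl x Sx)
          ... | false with mem? x t ∧ bl x in eq
          ...   | false = refl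
          ...   | true = let x∈ , bx = ∧⁻ {mem? x t} eq in ⊥-elim (true≢false (allowed-blue C S (t⊆ x x∈) bx) Sx)
        t⊆ = allIn⁻ t all
        S⊆t : S ⊆ (λ x → mem? x t)
        S⊆t x x∈ = covered x∈ (allBelow⁻ J _ cov (bl<J x (S⊆bl x x∈)))
        few : count F (λ x → mem? x t ∧ not (bl x)) ≤ count F S
        -- `S` and the reds together form the image, which has at most `suc s` vertices, and `suc s`
        -- is at most twice the size of `S`.
        few = +-cancelˡ-≤ (count F S) _ _
          (≤-trans (≤-reflexive (trans (cong (_+ count F (λ x → mem? x t ∧ not (bl x))) (sym (blue-count t t⊆ S⊆t)))
                                  (sym (count-split F (λ x → mem? x t) bl))))
            (≤-trans (count-mem vt) (<ᵇ-true⁻ s (count F S + count F S) s<2k)))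
        finish : Extension v (count F (λ x → mem? x t ∧ not (bl x)) + (count F S ∸ count F (λ x → mem? x t ∧ not (bl x)))) →
                 ∃[ H ] Balanced-in C (suc k) H
        finish (_ , t₁ , vt₁ , ok₁ , S⊆t₁ , size₁) =
          (λ x → mem? x t₁) , (λ x x∈ → allowed⊆ C S x (ok₁ x x∈)) , tree-conn E-sym vt₁ ,
          trans (blue-count t₁ ok₁ S⊆t₁) val , trans size₁ (trans (m+[n∸m]≡n few) val)

      -- A spanning tree of `H` has exactly `2 (k + 1)` nodes, so it is among the trees counted, and
      -- all reds of `H` are reached along it.
      value-complete : ∀ {k H} → Balanced-in C (suc k) H → (∀ x → S x ≡ H x ∧ bl x) → value C S ≡ suc k
      value-complete {k} {H} (H⊆C , conn , blues , redsH) S≡ =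
        subst (λ b → (if b then (if reds C S <ᵇ count F S then 0 else count F S) else 0) ≡ suc k) (sym (pos-nz some))
          (subst (λ b → (if b then 0 else count F S) ≡ suc k) (sym (<ᵇ-false enough)) K≡)
        where
        H<F : ∀ x → H x ≡ true → x < F
        H<F x x∈ = C<F x (H⊆C x x∈)
        K≡ : count F S ≡ suc k
        K≡ = trans (count-cong F (λ x _ → S≡ x)) blues
        H⊆allowed : H ⊆ allowed C S
        H⊆allowed x x∈ with bl x in bx
        ... | true = ∧⁺ (H⊆C x x∈) (trans (S≡ x) (∧⁺ x∈ bx))
        ... | false = H⊆C x x∈
        -- The root is taken in `bl`, where the search starts.
        v₀ : ∃[ v ] v < F × 0 < 𝟙 (H v ∧ bl v)
        v₀ = Sum-pos F _ (subst (0 <_) (sym blues) z<s)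
        v = proj₁ v₀
        Hbv : H v ≡ true × bl v ≡ true
        Hbv = ∧⁻ {H v} (trans (sym (nz-𝟙 _)) (pos-nz (proj₂ (proj₂ v₀))))
        spanning = spanning-tree H<F conn (proj₁ Hbv)
        s = proj₁ spanning
        t = proj₁ (proj₂ spanning)
        vt : Valid s v t
        vt = proj₁ (proj₂ (proj₂ spanning))
        t≡H : ∀ x → mem? x t ≡ H x
        t≡H = proj₁ (proj₂ (proj₂ (proj₂ spanning)))
        size : suc s ≡ count F H
        size = proj₂ (proj₂ (proj₂ (proj₂ spanning)))
        t⊆ : (λ x → mem? x t) ⊆ allowed C S
        t⊆ x x∈ = H⊆allowed x (trans (sym (t≡H x)) x∈)
        s<F : s < F
        s<F = ≤-trans (≤-reflexive size) (count-≤ F H)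
        s<2K : s < count F S + count F S
        s<2K = ≤-reflexive (trans size (trans (count-split F H bl) (trans (cong₂ _+_ blues redsH) (sym (cong₂ _+_ K≡ K≡)))))
        fit : fits J C S t ≡ true
        fit = ∧⁺ (allIn⁺ t t⊆) (allBelow⁺ J _ λ x _ → cover x)
          where
          cover : ∀ x → not (S x) ∨ mem? x t ≡ true
          cover x with S x in Sx
          ... | true = trans (t≡H x) (proj₁ (∧⁻ {H x} (trans (sym (S≡ x)) Sx)))
          ... | false = refl
        some : 0 < trees J (count F S) C S
        some = begin
          1                                                   ≡⟨ cong 𝟙 fit ⟨
          𝟙 (fits J C S t)                                    ≤⟨ sumT-term E<F F (λ t → 𝟙 (fits J C S t)) vt (<⇒≤ s<F) s<F ⟩
          sumT F s v (λ t → 𝟙 (fits J C S t))                 ≤⟨ Sum-term F (λ v → sumT F s v (λ t → 𝟙 (fits J C S t))) (H<F v (proj₁ Hbv)) ⟩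
          inner s                                             ≡⟨ cong (if_then inner s else 0) (<ᵇ-true s<2K) ⟨
          (if s <ᵇ count F S + count F S then inner s else 0) ≤⟨ Sum-term F (λ s → if s <ᵇ count F S + count F S then inner s else 0) s<F ⟩
          trees J (count F S) C S                             ∎
          where
          open ≤-Reasoning
          inner : ℕ → ℕ
          inner s = Sum F (λ v → sumT F s v (λ t → 𝟙 (fits J C S t)))
        enough : count F S ≤ reds C S
        enough = ≤-trans (≤-reflexive (trans K≡ (sym redsH))) (count-mono F λ x Hx → let x∈ , rx = ∧⁻ {H x} Hx in
          ∧⁺ (subst (λ i → reach i C S x ≡ true) (m+[n∸m]≡n (pred-mono-≤ s<F))
               (reach-mono s (F ∸ 1 ∸ s) (reach-tree 0 vt t⊆ (λ y y∈ → H<F y (trans (sym (t≡H y)) y∈))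
                 (∧⁺ (H⊆allowed v (proj₁ Hbv)) (proj₂ Hbv)) x (trans (t≡H x) x∈)))) rx)

-- Subsets of the minority colour as numbers

infixl 7 _÷_
_÷_ : ℕ → ℕ → ℕ
_÷_ = ⟦ div ⟧ₒ

÷-multiple : ∀ x c {k} → 0 < k → (x + c * k) ÷ k ≡ x ÷ k + c
÷-multiple x c {suc k} _ = trans (+-distrib-/-∣ʳ x (n∣m*n c)) (cong (x / suc k +_) (m*n/n≡m c (suc k)))

÷-small : ∀ {x k} → x < k → x ÷ k ≡ 0
÷-small {x} {suc k} x<k = m<n⇒m/n≡0 x<k

÷-÷ : ∀ x {k l} → 0 < k → 0 < l → x ÷ k ÷ l ≡ x ÷ (k * l)
÷-÷ x {suc k} {suc l} _ _ = m/n/o≡m/[n*o] x (suc k) (suc l)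

-- The subsets of bl below m are numbered by mixed-radix numbers, with a binary
-- digit for each element of bl and a digit of base 1 elsewhere.
module Mask (bl : ℕ → Bool) where

  radix : ℕ → ℕ
  radix v = suc (𝟙 (bl v))

  weight : ℕ → ℕ
  weight zero    = 1
  weight (suc v) = weight v * radix v

  weight>0 : ∀ v → 0 < weight v
  weight>0 zero = z<s
  weight>0 (suc v) = *-mono-< (weight>0 v) z<s

  digit : ℕ → ℕ → ℕ
  digit X v = (X ÷ weight v) % radix v

  subset : ℕ → ℕ → Bool
  subset X v = nz (digit X v)

  subset⊆bl : ∀ X → subset X ⊆ bl
  subset⊆bl X v = binary (X ÷ weight v) (bl v)
    where
    binary : ∀ q b → nz (q % suc (𝟙 b)) ≡ true → b ≡ true
    binary q true _ = refl
    binary q false q∈ = ⊥-elim (true≢false q∈ (cong nz (n%1≡0 q)))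

  weight-∣ : ∀ {u v} → u ≤ v → weight u ∣ weight v
  weight-∣ {zero} {v} _ = divides (weight v) (sym (*-identityʳ (weight v)))
  weight-∣ {suc u} {suc v} u<v with suc u ≟ suc v
  ... | yes refl = divides 1 (sym (+-identityʳ _))
  ... | no u≢v with weight-∣ {suc u} {v} (s≤s⁻¹ (≤∧≢⇒< u<v u≢v))
  ... | divides c eq = divides (c * radix v)
        (trans (cong (_* radix v) eq) (swap c (weight (suc u)) (radix v)))
    where
    swap : ∀ a b c → a * b * c ≡ a * c * b
    swap = solve-∀

  digit-low : ∀ X {y} v → weight (suc v) ∣ y → digit (X + y) v ≡ digit X v
  digit-low X v (divides c refl) = begin
    (X + c * (weight v * radix v)) ÷ weight v % radix v   ≡⟨ cong (λ y → (X + y) ÷ weight v % radix v) (swap c (weight v) (radix v)) ⟩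
    (X + c * radix v * weight v) ÷ weight v % radix v     ≡⟨ cong (_% radix v) (÷-multiple X (c * radix v) (weight>0 v)) ⟩
    (X ÷ weight v + c * radix v) % radix v                ≡⟨ [m+kn]%n≡m%n (X ÷ weight v) c (radix v) ⟩
    X ÷ weight v % radix v                                ∎
    where
    open ≡-Reasoning
    swap : ∀ a b c → a * (b * c) ≡ a * c * b
    swap = solve-∀

  -- A nonzero digit at `j` is 1, so subtracting `weight j` causes no borrow: removing a vertex from
  -- a subset is one subtraction on masks.
  module _ {X j : ℕ} (bj : bl j ≡ true) (j∈ : subset X j ≡ true) where

    weight≤ : weight j ≤ X
    weight≤ with weight j ≤? X
    ... | yes le = le
    ... | no ≰ = ⊥-elim (true≢false j∈ (cong (λ q → nz (q % radix j)) (÷-small (≰⇒> ≰))))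

    private
      Y = X ∸ weight j

      X≡ : X ≡ Y + weight j
      X≡ = sym (m∸n+n≡m weight≤)

      quotient : X ÷ weight j ≡ suc (Y ÷ weight j)
      quotient = trans (cong (_÷ weight j) (trans X≡ (cong (Y +_) (sym (+-identityʳ (weight j))))))
        (trans (÷-multiple Y 1 (weight>0 j)) (+-comm (Y ÷ weight j) 1))

      even : Y ÷ weight j % 2 ≡ 0
      even = odd-pred (Y ÷ weight j) (subst (λ q → nz (q % 2) ≡ true) quotient (subst (λ b → nz (X ÷ weight j % suc (𝟙 b)) ≡ true) bj j∈))
        where
        odd-pred : ∀ q → nz (suc q % 2) ≡ true → q % 2 ≡ 0
        odd-pred zero _ = refl
        odd-pred (suc zero) ()
        odd-pred (suc (suc q)) odd = odd-pred q odd

    drop-self : subset (X ∸ weight j) j ≡ false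
    drop-self = trans (cong (λ b → nz (Y ÷ weight j % suc (𝟙 b))) bj) (cong nz even)

    drop-other : ∀ v → v ≢ j → subset (X ∸ weight j) v ≡ subset X v
    drop-other v v≢j with <-cmp v j
    ... | tri≈ _ v≡j _ = ⊥-elim (v≢j v≡j)
    ... | tri< v<j _ _ = cong nz (sym (trans (cong (λ x → digit x v) X≡) (digit-low Y v (weight-∣ v<j))))
    ... | tri> _ _ v>j with weight-∣ v>j
    -- Above `j`, dividing by `weight v` includes a division by `weight j * 2`, and halving does not
    -- distinguish an even quotient from its successor.
    ...   | divides c eq = cong (λ q → nz (q % radix v)) (trans (halve Y) (trans (cong (_÷ c) same) (sym (halve X))))
      where
      half : ∀ q → q % 2 ≡ 0 → q / 2 ≡ suc q / 2
      half q ev = sym (+-distrib-/ 1 q (subst (λ r → 1 + r < 2) (sym ev) ≤-refl))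
      same : Y ÷ weight j ÷ 2 ≡ X ÷ weight j ÷ 2
      same = trans (half (Y ÷ weight j) even) (cong (_÷ 2) (sym quotient))
      positive : ∀ {c} → weight v ≡ c * weight (suc j) → 0 < c
      positive {suc c} _ = z<s
      positive {zero} eq = ⊥-elim (<-irrefl (sym eq) (weight>0 v))
      split : weight v ≡ weight j * 2 * c
      split = trans eq (trans (*-comm c _) (cong (λ b → weight j * suc (𝟙 b) * c) bj))
      halve : ∀ x → x ÷ weight v ≡ x ÷ weight j ÷ 2 ÷ c
      halve x = sym (trans (cong (_÷ c) (÷-÷ x (weight>0 j) z<s))
        (trans (÷-÷ x (*-mono-< (weight>0 j) (z<s {1})) (positive eq)) (cong (x ÷_) (sym split))))

  encode-subset : ∀ m (p : ℕ → Bool) → ∃[ X ] X < weight m × (∀ v → v < m → subset X v ≡ bl v ∧ p v)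
  encode-subset zero p = 0 , z<s , λ v ()
  encode-subset (suc m) p with encode-subset m p
  ... | X , X<w , ok = X + b * weight m , bound , digits
    where
    b = 𝟙 (bl m ∧ p m)
    b<radix : b < radix m
    b<radix with bl m
    ... | true = s≤s (𝟙≤1 (p m))
    ... | false = z<s
    bound : X + b * weight m < weight m * radix m
    bound = <-≤-trans (+-monoˡ-< (b * weight m) X<w) (≤-trans (*-monoˡ-≤ (weight m) b<radix) (≤-reflexive (*-comm (radix m) (weight m))))
    digits : ∀ v → v < suc m → subset (X + b * weight m) v ≡ bl v ∧ p v
    digits v v<sm with v ≟ m
    ... | no v≢m = let v<m = ≤∧≢⇒< (s≤s⁻¹ v<sm) v≢m in
      trans (cong nz (digit-low X v (∣n⇒∣m*n b (weight-∣ v<m)))) (ok v v<m)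
    ... | yes refl = trans (cong nz (begin
      (X + b * weight v) ÷ weight v % radix v   ≡⟨ cong (_% radix v) (÷-multiple X b (weight>0 v)) ⟩
      (X ÷ weight v + b) % radix v              ≡⟨ cong (λ q → (q + b) % radix v) (÷-small X<w) ⟩
      b % radix v                               ≡⟨ m<n⇒m%n≡m b<radix ⟩
      b                                         ∎)) (nz-𝟙 _)
      where open ≡-Reasoning

  weight-count : ∀ m → weight m ≡ 2 ^ count m bl
  weight-count zero = refl
  weight-count (suc m) with bl m
  ... | true = trans (*-comm (weight m) 2) (trans (cong (2 *_) (weight-count m)) (cong (2 ^_) (+-comm 1 (count m bl))))
  ... | false = trans (*-identityʳ (weight m)) (trans (weight-count m) (cong (2 ^_) (sym (+-identityʳ (count m bl)))))

  weight-≤ : ∀ n m → count m bl + count m bl ≤ n → weight m ≤ 2 ^ ⌊ n /2⌋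
  weight-≤ n m le = ≤-trans (≤-reflexive (weight-count m)) (^-monoʳ-≤ 2
    (≤-trans (≤-reflexive (n≡⌊n+n/2⌋ (count m bl))) (⌊n/2⌋-mono le)))

≢true⇒false : ∀ {b} → (b ≡ true → ⊥) → b ≡ false
≢true⇒false {true} b≢ = ⊥-elim (b≢ refl)
≢true⇒false {false} _ = refl

-- The optimum over all masks and the self-reduction

module Reduction (n : ℕ) (E : ℕ → ℕ → Bool)
  (E<n : ∀ u v → E u v ≡ true → v < n) (E-sym : ∀ u v → E u v ≡ E v u)
  (bl : ℕ → Bool) (bl<n : ∀ x → bl x ≡ true → x < n) where

  n≤range : n ≤ range n
  n≤range = m≤m+n n (n + 2)

  open Decide (range n) n E (λ u v e → <-≤-trans (E<n u v e) n≤range) E-sym bl bl<n public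
  open Mask bl public

  F = range n

  vertices : ℕ → Bool
  vertices v = v <ᵇ n

  val : (ℕ → Bool) → ℕ → ℕ
  val C X = value C (subset X)

  -- The running maximum: with truncated subtraction, `a + (b ∸ a)` is the maximum of `a` and `b`.
  best : (ℕ → Bool) → ℕ → ℕ
  best C zero    = val C 0
  best C (suc X) = best C X + (val C (suc X) ∸ best C X)

  -- Half the size of an optimum inside `C`, since `value` counts one colour only.
  opt : (ℕ → Bool) → ℕ
  opt C = best C (weight n ∸ 1)

  -- Vertices are discarded one by one, as long as the optimum stays the same.
  kept : ℕ → ℕ → Bool
  kept zero    v = vertices v
  kept (suc t) v = if opt (λ v → kept t v ∧ not (v ≡ᵇ t)) ≡ᵇ opt vertices then kept t v ∧ not (v ≡ᵇ t) else kept t v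

  -- The set whose optimum is computed at stage `t`: the whole graph at stage 0, and at stage
  -- `suc t` the remaining vertices without vertex `t`.
  candidate : ℕ → ℕ → Bool
  candidate zero    v = vertices v
  candidate (suc t) v = kept t v ∧ not (v ≡ᵇ t)

  best-≥ : ∀ C Y {X} → X ≤ Y → val C X ≤ best C Y
  best-≥ C zero z≤n = ≤-refl
  best-≥ C (suc Y) {X} X≤ with X ≟ suc Y
  ... | yes refl = m≤n+m∸n (val C (suc Y)) (best C Y)
  ... | no X≢ = ≤-trans (best-≥ C Y (s≤s⁻¹ (≤∧≢⇒< X≤ X≢))) (m≤m+n (best C Y) _)

  best-attained : ∀ C Y → ∃[ X ] val C X ≡ best C Y
  best-attained C zero = 0 , refl
  best-attained C (suc Y) with best C Y ≤? val C (suc Y)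
  ... | yes le = suc Y , sym (m+[n∸m]≡n le)
  ... | no ≰ with best-attained C Y
  ...   | X , eq = X , trans eq (sym (trans (cong (best C Y +_) (m≤n⇒m∸n≡0 (≰⇒≥ ≰))) (+-identityʳ _)))

  opt-complete : ∀ {C k H} → C ⊆ vertices → Balanced-in C k H → k ≤ opt C
  opt-complete {k = zero} C⊆ bal = z≤n
  opt-complete {C} {suc k} {H} C⊆ bal with encode-subset n H
  ... | X , X<P , eq = ≤-trans (≤-reflexive (sym (value-complete (subset⊆bl X) C<F bal same)))
                         (best-≥ C (weight n ∸ 1) (pred-mono-≤ X<P))
    where
    C<F : ∀ x → C x ≡ true → x < F
    C<F x x∈ = <-≤-trans (<ᵇ-true⁻ x n (C⊆ x x∈)) n≤range
    same : ∀ x → subset X x ≡ H x ∧ bl x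
    same x with x <? n
    ... | yes x<n = trans (eq x x<n) (∧-swap (bl x) (H x))
      where
      ∧-swap : ∀ a b → a ∧ b ≡ b ∧ a
      ∧-swap true true = refl
      ∧-swap true false = refl
      ∧-swap false true = refl
      ∧-swap false false = refl
    ... | no x≮n = trans (≢true⇒false (λ x∈ → x≮n (bl<n x (subset⊆bl X x x∈))))
                     (sym (∧-falseʳ (H x) (≢true⇒false (λ bx → x≮n (bl<n x bx)))))

  opt-sound : ∀ {C} → C ⊆ vertices → ∃[ H ] Balanced-in C (opt C) H
  opt-sound {C} C⊆ with opt C in eq
  ... | zero = (λ _ → false) , (λ x ()) , (λ ()) , Sum-zero F , Sum-zero F
  ... | suc k with best-attained C (weight n ∸ 1)
  ... | X , val≡ = value-sound (subset⊆bl X) (λ x x∈ → <-≤-trans (<ᵇ-true⁻ x n (C⊆ x x∈)) n≤range) (trans val≡ eq)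

  Balanced-in-⊆ : ∀ {C C′ k H} → C ⊆ C′ → Balanced-in C k H → Balanced-in C′ k H
  Balanced-in-⊆ C⊆C′ (H⊆C , rest) = (λ x x∈ → C⊆C′ x (H⊆C x x∈)) , rest

  opt-mono : ∀ {C C′} → C ⊆ C′ → C′ ⊆ vertices → opt C ≤ opt C′
  opt-mono C⊆C′ C′⊆ with opt-sound (λ x x∈ → C′⊆ x (C⊆C′ x x∈))
  ... | H , bal = opt-complete C′⊆ (Balanced-in-⊆ C⊆C′ bal)

  kept-step : ∀ t → kept (suc t) ⊆ kept t
  kept-step t v v∈ with opt (λ v → kept t v ∧ not (v ≡ᵇ t)) ≡ᵇ opt vertices
  ... | true = proj₁ (∧⁻ {kept t v} v∈)
  ... | false = v∈

  kept-anti : ∀ {s t} → s ≤′ t → kept t ⊆ kept s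
  kept-anti ≤′-refl v v∈ = v∈
  kept-anti (≤′-step s≤t) v v∈ = kept-anti s≤t v (kept-step _ v v∈)

  kept⊆ : ∀ t → kept t ⊆ vertices
  kept⊆ t = kept-anti (z≤′n {t})

  kept-opt : ∀ t → opt (kept t) ≡ opt vertices
  kept-opt zero = refl
  kept-opt (suc t) with opt (λ v → kept t v ∧ not (v ≡ᵇ t)) ≡ᵇ opt vertices in eq
  ... | true = ≡ᵇ-true eq
  ... | false = kept-opt t

  -- Suppose an optimal `H` misses a kept vertex `v`. When `v` was tested, `H` lay inside the tested
  -- set, so the optimum did not drop and `v` would have been discarded. What remains is therefore
  -- itself a solution.
  kept-solution : ∀ {H} → Balanced-in (kept n) (opt vertices) H → ∀ v → kept n v ≡ H v
  kept-solution {H} bal v with H v in Hv | kept n v in kv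
  ... | true  | true  = refl
  ... | false | false = refl
  ... | true  | false = ⊥-elim (true≢false (proj₁ bal v Hv) kv)
  ... | false | true  = ⊥-elim (true≢false (kept-anti (≤⇒≤′ v<n) v kv) discarded)
    where
    v<n : v < n
    v<n = <ᵇ-true⁻ v n (kept⊆ n v kv)
    without : ℕ → Bool
    without x = kept v x ∧ not (x ≡ᵇ v)
    H⊆without : H ⊆ without
    H⊆without x x∈ = ∧⁺ (kept-anti (≤⇒≤′ (<⇒≤ v<n)) x (proj₁ bal x x∈))
      (cong not (≡ᵇ-false {x} {v} λ { refl → true≢false x∈ Hv }))
    without⊆ : without ⊆ vertices
    without⊆ x x∈ = kept⊆ v x (proj₁ (∧⁻ {kept v x} x∈))
    same-opt : (opt without ≡ᵇ opt vertices) ≡ true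
    same-opt = subst (λ k → (k ≡ᵇ opt vertices) ≡ true)
      (≤-antisym (opt-complete without⊆ (H⊆without , proj₂ bal)) (opt-mono without⊆ (λ x x∈ → x∈)))
      (≡ᵇ-refl (opt vertices))
    discarded : kept (suc v) v ≡ false
    discarded = trans (cong (if_then without v else kept v v) same-opt) (∧-falseʳ (kept v v) (cong not (≡ᵇ-refl v)))

  kept-balanced : Balanced-in vertices (opt vertices) (kept n)
  kept-balanced with opt-sound (kept⊆ n)
  ... | H , bal′ = kept⊆ n , conn ,
      trans (count-cong F (λ x _ → cong (_∧ bl x) (same x))) (proj₁ (proj₂ (proj₂ bal))) ,
      trans (count-cong F (λ x _ → cong (_∧ not (bl x)) (same x))) (proj₂ (proj₂ (proj₂ bal)))
    where
    bal : Balanced-in (kept n) (opt vertices) H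
    bal = subst (λ k → Balanced-in (kept n) k H) (kept-opt n) bal′
    same : ∀ x → kept n x ≡ H x
    same = kept-solution bal
    conn : Conn (kept n)
    conn {u} {v} u∈ v∈ = gmap (λ x → x) (λ (a , b , e) → trans (same _) a , trans (same _) b , e)
      (proj₁ (proj₂ bal) (trans (sym (same u)) u∈) (trans (sym (same v)) v∈))

-- The table entry as an expression

infix 4 _<E_ _≡E_
infixl 6 _+E_ _-E_
infixl 7 _*E_ _÷E_

-- A condition holds when nonzero, so truncated `b -E a` tests `a < b`, and equality is 1 minus the
-- distance.
_+E_ _-E_ _*E_ _÷E_ _<E_ _≡E_ : Ex → Ex → Ex
_+E_ = op add
_-E_ = op sub
_*E_ = op mul
_÷E_ = op div
a <E b = b -E a
a ≡E b = num 1 -E ((a -E b) +E (b -E a))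

boolE : Ex → Ex
boolE e = ite e (num 1) (num 0)

sumE : ℕ → Ex → Ex
sumE = fold add 0

-- Variables 0 to 6 hold a table index and its decoding: index, number of masks,
-- mask, vertex, row, kind, stage.  The others are bound by folds and lets.
opaque
  nE rE : Ex
  nE = inp (num 0)
  rE = nE +E (nE +E num 2)

  colourE : ℕ → Ex
  colourE y = inp (num 1 +E var y)

  redE : Ex
  redE = sumE 20 (ite (var 20 <E nE) (boolE (colourE 20)) (num 0))

  blE : ℕ → Ex
  -- Red is the minority unless more than half of the vertices are red; ties go to red.
  blE y = ite (var y <E nE) (ite (nE <E redE +E redE) (ite (colourE y) (num 0) (num 1)) (colourE y)) (num 0)

  edgeE : ℕ → ℕ → Ex
  edgeE x y = ite (var x <E nE) (ite (var y <E nE) (inp ((num 1 +E nE) +E (var x *E nE +E var y))) (num 0)) (num 0)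

  weightE : Ex → Ex
  weightE e = fold mul 1 21 (ite (var 21 <E e) (ite (blE 21) (num 2) (num 1)) (num 1))

  subsetE : ℕ → Ex
  -- The last binary digit of a quotient `q`, as `q` minus twice its half.
  subsetE y = ite (blE y) ((var 2 ÷E weightE (var y)) -E (var 2 ÷E weightE (var y)) ÷E num 2 *E num 2) (num 0)

  readE : Ex → ℕ → Ex → Ex → Ex → Ex
  -- Most significant first: stage, kind, row, vertex, mask. In this order an entry reads only
  -- earlier ones: earlier stages, smaller kinds of its stage, smaller rows of its kind, or the
  -- preceding mask. All kinds share this layout, even where a value is constant in a coordinate.
  readE t κ m v X = get ((((t *E num 5 +E num κ) *E rE +E m) *E rE +E v) *E var 1 +E X)

  candidateE : ℕ → Ex
  candidateE y = ite (var 6)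
    (ite (readE (var 6 -E num 1) 4 (num 0) (var y) (num 0)) (ite (var y ≡E var 6 -E num 1) (num 0) (num 1)) (num 0))
    (var y <E nE)

  allowedE : ℕ → Ex
  allowedE y = ite (blE y) (ite (candidateE y) (subsetE y) (num 0)) (candidateE y)

treeE treesE reachE valE bestE keptE : Ex
treeE = ite (var 4)
  (sumE 7 (ite (edgeE 3 7)
    (sumE 8 (ite (var 8 <E var 4)
      (readE (var 6) 0 (var 8) (var 3) (var 2) *E readE (var 6) 0 (var 4 -E num 1 -E var 8) (var 7) (var 2)) (num 0))) (num 0)))
  (boolE (allowedE 3))
treesE = ite (var 4)
  (lett 9 (var 4 -E num 1)
    (readE (var 6) 1 (var 9) (var 3) (var 2) -E
     ite (subsetE 9) (readE (var 6) 1 (var 9) (var 3) (var 2 -E weightE (var 9))) (num 0)))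
  (sumE 7 (ite (var 7 <E var 3 +E var 3) (sumE 8 (readE (var 6) 0 (var 7) (var 8) (var 2))) (num 0)))
reachE = ite (allowedE 3)
  (ite (var 4)
    (ite (readE (var 6) 2 (var 4 -E num 1) (var 3) (var 2)) (num 1)
      (boolE (sumE 7 (ite (edgeE 7 3) (readE (var 6) 2 (var 4 -E num 1) (var 7) (var 2)) (num 0)))))
    (boolE (blE 3)))
  (num 0)
valE = lett 15 (sumE 7 (boolE (subsetE 7)))
  (ite (readE (var 6) 1 nE (var 15) (var 2))
    (ite (sumE 7 (ite (readE (var 6) 2 (rE -E num 1) (var 7) (var 2)) (ite (blE 7) (num 0) (num 1)) (num 0)) <E var 15)
      (num 0) (var 15))
    (num 0))
bestE = lett 13 valE
  (ite (var 2)
    (lett 14 (readE (var 6) 3 (var 4) (var 3) (var 2 -E num 1)) (var 14 +E (var 13 -E var 14)))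
    (var 13))
keptE = ite (var 6)
  (ite (readE (var 6) 3 (num 0) (num 0) (var 1 -E num 1) ≡E readE (num 0) 3 (num 0) (num 0) (var 1 -E num 1))
    (boolE (candidateE 3))
    (readE (var 6 -E num 1) 4 (num 0) (var 3) (num 0)))
  (boolE (var 3 <E nE))

stagesE kindE : Ex
stagesE = (nE +E num 1) *E num 5 *E rE *E rE *E var 1
kindE = ite (var 5) (ite (var 5 -E num 1) (ite (var 5 -E num 2) (ite (var 5 -E num 3) keptE bestE) reachE) treesE) treeE

-- Opaque, lest exBits and exTime of these large terms be unfolded.
opaque
  entryE sizeE : Ex
  entryE =
    lett 1 (weightE nE) (
    lett 10 (var 0 ÷E var 1) (
    lett 11 (var 10 ÷E rE) (
    lett 12 (var 11 ÷E rE) (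
    lett 2 (var 0 -E var 10 *E var 1) (
    lett 3 (var 10 -E var 11 *E rE) (
    lett 4 (var 11 -E var 12 *E rE) (
    lett 6 (var 12 ÷E num 5) (
    lett 5 (var 12 -E var 6 *E num 5) (
    -- After all stages, `n` more entries repeat the kept vertices of stage `n` contiguously, where
    -- `copyOut` expects them.
    ite (var 0 <E stagesE) kindE (readE nE 4 (num 0) (var 0 -E stagesE) (num 0)))))))))))
  sizeE = lett 1 (weightE nE) (stagesE +E nE)

-- Values of the expressions and correctness of the entries

nz-∸ : ∀ a b → nz (b ∸ a) ≡ (a <ᵇ b)
nz-∸ zero zero = refl
nz-∸ zero (suc b) = refl
nz-∸ (suc a) zero = refl
nz-∸ (suc a) (suc b) = nz-∸ a b

nz-≡ : ∀ a b → nz (1 ∸ ((a ∸ b) + (b ∸ a))) ≡ (a ≡ᵇ b)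
nz-≡ zero zero = refl
nz-≡ zero (suc b) = cong nz (0∸n≡0 b)
nz-≡ (suc a) zero = cong nz (0∸n≡0 (a + 0))
nz-≡ (suc a) (suc b) = nz-≡ a b

if-≡ : ∀ {c b} {x x′ y y′ : ℕ} → c ≡ b → (b ≡ true → x ≡ x′) → (b ≡ false → y ≡ y′) → (if c then x else y) ≡ (if b then x′ else y′)
if-≡ {b = true} refl eq _ = eq refl
if-≡ {b = false} refl _ eq = eq refl

if-≡ᵇ : ∀ {c b} {x y : ℕ} {x′ y′ : Bool} → c ≡ b → (b ≡ true → nz x ≡ x′) → (b ≡ false → nz y ≡ y′) →
        nz (if c then x else y) ≡ (if b then x′ else y′)
if-≡ᵇ {b = true} refl eq _ = eq refl
if-≡ᵇ {b = false} refl _ eq = eq refl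

remainder< : ∀ {D} → 0 < D → ∀ a → a ∸ a ÷ D * D < D
remainder< {suc d} _ a = subst (_< suc d) (m%n≡m∸m/n*n a (suc d)) (m%n<n a (suc d))

divide : ∀ {D} → 0 < D → ∀ a → a ÷ D * D + (a ∸ a ÷ D * D) ≡ a
divide {suc d} _ a = trans (cong (a ÷ suc d * suc d +_) (sym (m%n≡m∸m/n*n a (suc d))))
  (trans (+-comm (a ÷ suc d * suc d) (a % suc d)) (sym (m≡m%n+[m/n]*n a (suc d))))

quotient-unique : ∀ {D} → 0 < D → ∀ a {y} → y < D → (a * D + y) ÷ D ≡ a
quotient-unique {D} D>0 a {y} y<D = trans (cong (_÷ D) (+-comm (a * D) y))
  (trans (÷-multiple y a D>0) (cong (_+ a) (÷-small y<D)))

module Input (n : ℕ) (I : ℕ → ℕ) where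

  colour : ℕ → Bool
  colour v = nz (I (1 + v))

  redCount : ℕ
  redCount = Sum (range n) (λ v → if v <ᵇ n then 𝟙 (colour v) else 0)

  minority : ℕ → Bool
  minority v = if v <ᵇ n then (if n <ᵇ redCount + redCount then not (colour v) else colour v) else false

  edge : ℕ → ℕ → Bool
  edge u v = if u <ᵇ n then (if v <ᵇ n then nz (I (1 + n + (u * n + v))) else false) else false

  edge<n : ∀ u v → edge u v ≡ true → v < n
  edge<n u v e with u <ᵇ n | v <ᵇ n in eq
  ... | true | true = <ᵇ-true⁻ v n eq

  minority<n : ∀ v → minority v ≡ true → v < n
  minority<n v e with v <ᵇ n in eq
  ... | true = <ᵇ-true⁻ v n eq

module Evaluation (n : ℕ) (I : ℕ → ℕ) (I0 : I 0 ≡ n) (edge-sym : ∀ u v → Input.edge n I u v ≡ Input.edge n I v u) where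

  open Input n I
  open Reduction n edge (λ u v → edge<n u v) edge-sym minority minority<n

  product-full : ∀ m j → j ≤ m → foldTo mul 1 j (λ u → if u <ᵇ m then radix u else 1) ≡ weight j
  product-full m zero _ = refl
  product-full m (suc j) j<m = cong₂ _*_ (product-full m j (<⇒≤ j<m)) (cong (if_then radix j else 1) (<ᵇ-true j<m))

  product-cut : ∀ {m k} → m ≤′ k → foldTo mul 1 k (λ u → if u <ᵇ m then radix u else 1) ≡ weight m
  product-cut {m} ≤′-refl = product-full m m ≤-refl
  product-cut {m} {suc k} (≤′-step m≤k) =
    trans (cong₂ _*_ (product-cut m≤k) (cong (if_then radix k else 1) (<ᵇ-false (≤′⇒≤ m≤k)))) (*-identityʳ (weight m))

  product-cong : ∀ k {f g : ℕ → ℕ} → (∀ i → f i ≡ g i) → foldTo mul 1 k f ≡ foldTo mul 1 k g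
  product-cong zero eq = refl
  product-cong (suc k) eq = cong₂ _*_ (product-cong k eq) (eq k)

  -- For the stage t of the self-reduction and the mask X: tree counts by edges m
  -- and root v; tree counts covering X below m, with at most 2v nodes;
  -- reachability from X in m steps; the optimum over the masks up to X; kept vertices.
  table : ℕ → (t m v X : ℕ) → ℕ
  table 0 t m v X = sumT F m v (λ u → 𝟙 (allIn (allowed (candidate t) (subset X)) u))
  table 1 t m v X = trees m v (candidate t) (subset X)
  table 2 t m v X = 𝟙 (reach m (candidate t) (subset X) v)
  table 3 t m v X = best (candidate t) X
  table _ t m v X = 𝟙 (kept t v)

  P : ℕ
  P = weight n

  index : ℕ → (t m v X : ℕ) → ℕ
  index κ t m v X = (((t * 5 + κ) * F + m) * F + v) * P + X

  module Basic (z : ℕ → ℕ) where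
    open Eval n I z

    n<base : n < base n
    n<base = ≤-trans (≤-reflexive (trans (+-comm 1 n) (sym (*-identityʳ (n + 1))))) (*-monoʳ-≤ (n + 1) (m≤n+m 1 n))

    eval-inp : ∀ e {ρ a} → eval e ρ ≡ a → a < base n → eval (inp e) ρ ≡ I a
    eval-inp e {ρ} refl a<b = cong (if_then I (eval e ρ) else 0) (trans (nz-∸ _ (base n)) (<ᵇ-true a<b))

    opaque
      unfolding nE rE colourE redE blE edgeE weightE subsetE readE candidateE allowedE

      eval-n : ∀ ρ → eval nE ρ ≡ n
      eval-n ρ = trans (eval-inp (num 0) {ρ} refl (≤-trans (s≤s z≤n) n<base)) I0

      eval-r : ∀ ρ → eval rE ρ ≡ F
      eval-r ρ = cong₂ (λ a b → a + (b + 2)) (eval-n ρ) (eval-n ρ)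

    eval-<n : ∀ e ρ → nz (eval (e <E nE) ρ) ≡ (eval e ρ <ᵇ n)
    eval-<n e ρ = trans (nz-∸ (eval e ρ) (eval nE ρ)) (cong (eval e ρ <ᵇ_) (eval-n ρ))

    opaque
      unfolding nE rE colourE redE blE edgeE weightE subsetE readE candidateE allowedE

      eval-colour : ∀ y ρ → ρ y < n → nz (eval (colourE y) ρ) ≡ colour (ρ y)
      eval-colour y ρ v<n = cong nz (eval-inp (num 1 +E var y) {ρ} refl (≤-trans (s≤s v<n) n<base))

      eval-red : ∀ ρ → eval redE ρ ≡ redCount
      eval-red ρ = Sum-cong F λ v _ → if-≡ (eval-<n (var 20) (ρ [ 20 ↦ v ]))
        (λ v<n → if-≡ (eval-colour 20 (ρ [ 20 ↦ v ]) (<ᵇ-true⁻ v n v<n)) (λ _ → refl) (λ _ → refl)) (λ _ → refl)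

      eval-bl : ∀ y ρ → nz (eval (blE y) ρ) ≡ minority (ρ y)
      eval-bl y ρ = if-≡ᵇ (eval-<n (var y) ρ) (λ v<n → if-≡ᵇ
          (trans (nz-∸ (eval nE ρ) (eval redE ρ + eval redE ρ)) (cong₂ _<ᵇ_ (eval-n ρ) (cong₂ _+_ (eval-red ρ) (eval-red ρ))))
          (λ _ → trans (if-≡ᵇ (eval-colour y ρ (<ᵇ-true⁻ (ρ y) n v<n)) (λ _ → refl) (λ _ → refl)) (if-not (colour (ρ y))))
          (λ _ → eval-colour y ρ (<ᵇ-true⁻ (ρ y) n v<n)))
        (λ _ → refl)
        where
        if-not : ∀ b → (if b then false else true) ≡ not b
        if-not true = refl
        if-not false = refl

      eval-edge : ∀ x y ρ → nz (eval (edgeE x y) ρ) ≡ edge (ρ x) (ρ y)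
      eval-edge x y ρ = if-≡ᵇ (eval-<n (var x) ρ) (λ u<n → if-≡ᵇ (eval-<n (var y) ρ) (λ v<n →
        cong nz (eval-inp ((num 1 +E nE) +E (var x *E nE +E var y)) {ρ}
          (cong (λ k → 1 + k + (ρ x * k + ρ y)) (eval-n ρ)) (bound (<ᵇ-true⁻ (ρ x) n u<n) (<ᵇ-true⁻ (ρ y) n v<n))))
        (λ _ → refl)) (λ _ → refl)
        where
        bound : ∀ {u v} → u < n → v < n → 1 + n + (u * n + v) < base n
        bound {u} {v} u<n v<n = begin-strict
          1 + n + (u * n + v)   <⟨ +-monoʳ-< (1 + n) (+-monoʳ-< (u * n) v<n) ⟩
          1 + n + (u * n + n)   ≡⟨ cong (1 + n +_) (+-comm (u * n) n) ⟩
          1 + n + suc u * n     ≤⟨ +-monoʳ-≤ (1 + n) (*-monoˡ-≤ n u<n) ⟩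
          1 + n + n * n         ≤⟨ +-monoʳ-≤ (1 + n) (*-monoʳ-≤ n (n≤1+n n)) ⟩
          suc n * suc n         ≡⟨ cong (λ k → k * k) (+-comm 1 n) ⟩
          base n                ∎
          where open ≤-Reasoning

      eval-weight : ∀ e ρ {m} → (∀ i → eval e (ρ [ 21 ↦ i ]) ≡ m) → m ≤ F → eval (weightE e) ρ ≡ weight m
      eval-weight e ρ {m} val m≤F = trans (product-cong F λ u → if-≡ (trans (nz-∸ u _) (cong (u <ᵇ_) (val u)))
          (λ _ → trans (if-≡ (eval-bl 21 (ρ [ 21 ↦ u ])) (λ _ → refl) (λ _ → refl)) (radix-if (minority u))) (λ _ → refl))
        (product-cut (≤⇒≤′ m≤F))
        where
        radix-if : ∀ b → (if b then 2 else 1) ≡ suc (𝟙 b)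
        radix-if true = refl
        radix-if false = refl

      -- The first hypothesis protects `y` from variable 21, which is bound inside `weightE`.
      eval-subset : ∀ y ρ {v X} → (∀ i → (ρ [ 21 ↦ i ]) y ≡ v) → ρ y ≡ v → v ≤ F → ρ 2 ≡ X →
                    nz (eval (subsetE y) ρ) ≡ subset X v
      eval-subset y ρ {v} fresh refl v≤F refl = trans
        (if-≡ᵇ {y = 0} {x′ = nz (ρ 2 ÷ weight v % 2)} {y′ = false} (eval-bl y ρ)
          (λ _ → cong nz (trans (cong (λ w → (ρ 2 ÷ w) ∸ (ρ 2 ÷ w) ÷ 2 * 2) (eval-weight (var y) ρ fresh v≤F))
                           (sym (m%n≡m∸m/n*n (ρ 2 ÷ weight v) 2))))
          (λ _ → refl))
        (case-bl (minority v))
        where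
        case-bl : ∀ b → (if b then nz (ρ 2 ÷ weight v % 2) else false) ≡ nz (ρ 2 ÷ weight v % suc (𝟙 b))
        case-bl true = refl
        case-bl false = cong nz (sym (n%1≡0 (ρ 2 ÷ weight v)))

      eval-read : ∀ κ tE mE vE XE ρ {t m v X} → ρ 1 ≡ P →
        eval tE ρ ≡ t → eval mE ρ ≡ m → eval vE ρ ≡ v → eval XE ρ ≡ X →
        eval (readE tE κ mE vE XE) ρ ≡ z (index κ t m v X)
      eval-read κ tE mE vE XE ρ eP refl refl refl refl = cong z
        (cong₂ (λ f p → (((eval tE ρ * 5 + κ) * f + eval mE ρ) * f + eval vE ρ) * p + eval XE ρ) (eval-r ρ) eP)

  F>0 : 0 < F
  F>0 = <-≤-trans z<s (≤-trans (m≤n+m 2 n) (m≤n+m (n + 2) n))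

  P>0 : 0 < P
  P>0 = weight>0 n

  n<F : n < F
  n<F = ≤-trans (≤-reflexive (+-comm 1 n)) (≤-trans (+-monoʳ-≤ n (n≤1+n 1)) (m≤n+m (n + 2) n))

  lexicographic : ∀ {a b y} D y′ → a < b → y < D → a * D + y < b * D + y′
  lexicographic {a} {b} {y} D y′ a<b y<D = begin-strict
    a * D + y    <⟨ +-monoʳ-< (a * D) y<D ⟩
    a * D + D    ≡⟨ +-comm (a * D) D ⟩
    suc a * D    ≤⟨ *-monoˡ-≤ D a<b ⟩
    b * D        ≤⟨ m≤m+n (b * D) y′ ⟩
    b * D + y′   ∎
    where open ≤-Reasoning

  module _ (m v X : ℕ) {m′ v′ X′ : ℕ} (m′<F : m′ < F) (v′<F : v′ < F) (X′<P : X′ < P) where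

    index-<κ : ∀ t {κ′ κ} → κ′ < κ → index κ′ t m′ v′ X′ < index κ t m v X
    index-<κ t κ′<κ = lexicographic P X (lexicographic F v (lexicographic F m (+-monoʳ-< (t * 5) κ′<κ) m′<F) v′<F) X′<P

    index-<t : ∀ {t′ t κ′} κ → κ′ < 5 → t′ < t → index κ′ t′ m′ v′ X′ < index κ t m v X
    index-<t κ κ′<5 t′<t = lexicographic P X (lexicographic F v (lexicographic F m (lexicographic 5 κ t′<t κ′<5) m′<F) v′<F) X′<P

  index-<m : ∀ κ t v X {m m′ v′ X′} → m′ < m → v′ < F → X′ < P → index κ t m′ v′ X′ < index κ t m v X
  index-<m κ t v X m′<m v′<F X′<P =
    lexicographic P X (lexicographic F v (+-monoʳ-< ((t * 5 + κ) * F) m′<m) v′<F) X′<P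

  index-<X : ∀ κ t m v {X X′} → X′ < X → index κ t m v X′ < index κ t m v X
  index-<X κ t m v = +-monoʳ-< ((((t * 5 + κ) * F + m) * F + v) * P)

  tree-step : ∀ t s v X → suc s < F → table 0 t (suc s) v X ≡ Sum F λ w → if edge v w then
    Sum F (λ i → if i <ᵇ suc s then table 0 t i v X * table 0 t (s ∸ i) w X else 0) else 0
  tree-step t s v X = sumT-multiplicative s v (λ u → 𝟙 (allIn (allowed (candidate t) (subset X)) u)) (λ u w → 𝟙-∧ (allIn (allowed (candidate t) (subset X)) u) _)

  trees-start : ∀ t k X → table 1 t 0 k X ≡ Sum F λ s → if s <ᵇ k + k then Sum F (λ v → table 0 t s v X) else 0
  trees-start t k X = Sum-cong F λ s _ → if-cong (s <ᵇ k + k) λ _ → Sum-cong F λ v _ →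
    sumT-cong F s v (λ u → cong 𝟙 (∧-trueʳ (allIn (allowed (candidate t) (subset X)) u) refl))

  -- By `trees-drop` the subtrahend is a summand of the minuend, so truncated subtraction is exact.
  trees-step : ∀ t j k X → table 1 t (suc j) k X ≡
    table 1 t j k X ∸ (if subset X j then table 1 t j k (X ∸ weight j) else 0)
  trees-step t j k X = step (subset X j) refl
    where
    C = candidate t
    step : ∀ b → subset X j ≡ b → trees (suc j) k C (subset X) ≡
      trees j k C (subset X) ∸ (if b then trees j k C (subset (X ∸ weight j)) else 0)
    step false j∉ = trees-skip j k C (subset X) j∉
    step true j∈ = sym (trans (cong (_∸ trees j k C (subset (X ∸ weight j)))
        (sym (trees-drop j k C (subset X) (subset (X ∸ weight j)) bj j∈ (drop-self {X} {j} bj j∈) (drop-other {X} {j} bj j∈))))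
      (m+n∸n≡m (trees (suc j) k C (subset X)) (trees j k C (subset (X ∸ weight j)))))
      where bj = subset⊆bl X j j∈

  -- Makes the size of a subset a valid vertex coordinate, as which `valE` uses it to read the tree
  -- counts.
  count-subset<F : ∀ X → count F (subset X) < F
  count-subset<F X = ≤-<-trans (≤-trans (≤-reflexive (Sum-extend (λ x → 𝟙 (subset X x)) n≤range none)) (count-≤ n (subset X))) n<F
    where
    none : ∀ i → n ≤ i → 𝟙 (subset X i) ≡ 0
    none i n≤i = cong 𝟙 (≢true⇒false λ i∈ → <⇒≱ (minority<n i (subset⊆bl X i i∈)) n≤i)

  module Step (z : ℕ → ℕ) (κ t m v X : ℕ) (m<F : m < F) (v<F : v < F) (X<P : X < P)
    (known : ∀ κ′ t′ m′ v′ X′ → κ′ < 5 → m′ < F → v′ < F → X′ < P →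
             index κ′ t′ m′ v′ X′ < index κ t m v X → z (index κ′ t′ m′ v′ X′) ≡ table κ′ t′ m′ v′ X′) where
    open Eval n I z
    open Basic z

    record Env (ρ : ℕ → ℕ) : Set where
      field
        at-P : ρ 1 ≡ P
        at-X : ρ 2 ≡ X
        at-v : ρ 3 ≡ v
        at-m : ρ 4 ≡ m
        at-t : ρ 6 ≡ t
    open Env

    bind : ∀ {ρ} k {u} → Env ρ → Env (ρ [ 7 + k ↦ u ])
    bind k e = record { at-P = at-P e ; at-X = at-X e ; at-v = at-v e ; at-m = at-m e ; at-t = at-t e }

    read-known : ∀ κ′ tE mE vE XE ρ {t′ m′ v′ X′} → Env ρ →
      eval tE ρ ≡ t′ → eval mE ρ ≡ m′ → eval vE ρ ≡ v′ → eval XE ρ ≡ X′ →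
      κ′ < 5 → m′ < F → v′ < F → X′ < P → index κ′ t′ m′ v′ X′ < index κ t m v X →
      eval (readE tE κ′ mE vE XE) ρ ≡ table κ′ t′ m′ v′ X′
    read-known κ′ tE mE vE XE ρ e et em ev eX κ′< m′< v′< X′< lt =
      trans (eval-read κ′ tE mE vE XE ρ (at-P e) et em ev eX) (known κ′ _ _ _ _ κ′< m′< v′< X′< lt)

    opaque
      unfolding candidateE allowedE

      eval-candidate : ∀ y ρ → Env ρ → ρ y < F → nz (eval (candidateE y) ρ) ≡ candidate t (ρ y)
      -- `t` is a module parameter, so the case distinction goes through an equation; the other
      -- coordinates are treated likewise below.
      eval-candidate y ρ e y<F = by-stage t refl
        where
        conj : ∀ a b → (if a then (if b then false else true) else false) ≡ a ∧ not b
        conj true true = refl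
        conj true false = refl
        conj false b = refl
        by-stage : ∀ t₁ → t ≡ t₁ → nz (eval (candidateE y) ρ) ≡ candidate t₁ (ρ y)
        by-stage zero t≡ = if-≡ᵇ {b = false} {x′ = false} (cong nz (trans (at-t e) t≡)) (λ ()) (λ _ → eval-<n (var y) ρ)
        by-stage (suc t₁) t≡ = if-≡ᵇ {b = true} {y′ = false} (cong nz (trans (at-t e) t≡))
          (λ _ → trans
            (if-≡ᵇ (trans (cong nz (read-known 4 (var 6 -E num 1) (num 0) (var y) (num 0) ρ e t-1 refl refl refl ≤-refl F>0 y<F P>0
                 (index-<t m v X F>0 y<F P>0 κ ≤-refl (≤-reflexive (sym t≡))))) (nz-𝟙 (kept t₁ (ρ y))))
              (λ _ → if-≡ᵇ (trans (nz-≡ (ρ y) (ρ 6 ∸ 1)) (cong (ρ y ≡ᵇ_) t-1)) (λ _ → refl) (λ _ → refl))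
              (λ _ → refl))
            (conj (kept t₁ (ρ y)) (ρ y ≡ᵇ t₁)))
          (λ ())
          where
          t-1 : ρ 6 ∸ 1 ≡ t₁
          t-1 = cong pred (trans (at-t e) t≡)

      eval-allowed : ∀ ρ → Env ρ → nz (eval (allowedE 3) ρ) ≡ allowed (candidate t) (subset X) v
      eval-allowed ρ e = if-≡ᵇ (trans (eval-bl 3 ρ) (cong minority (at-v e)))
          (λ _ → trans (if-≡ᵇ cand (λ _ → eval-subset 3 ρ (λ i → at-v e) (at-v e) (<⇒≤ v<F) (at-X e)) (λ _ → refl)) (conj (candidate t v) (subset X v)))
          (λ _ → cand)
        where
        cand : nz (eval (candidateE 3) ρ) ≡ candidate t v
        cand = subst (λ w → nz (eval (candidateE 3) ρ) ≡ candidate t w) (at-v e)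
          (eval-candidate 3 ρ e (subst (_< F) (sym (at-v e)) v<F))
        conj : ∀ a b → (if a then b else false) ≡ a ∧ b
        conj true b = refl
        conj false b = refl

    minus-one : ∀ {a b} → a ≡ suc b → a ∸ 1 ≡ b
    minus-one refl = refl

    eval-tree : κ ≡ 0 → ∀ ρ → Env ρ → eval treeE ρ ≡ table 0 t m v X
    eval-tree refl ρ e = by-size m refl
      where
      by-size : ∀ m₁ → m ≡ m₁ → eval treeE ρ ≡ table 0 t m₁ v X
      by-size zero m≡ = if-≡ {b = false} {x′ = 0} (cong nz (trans (at-m e) m≡)) (λ ())
        (λ _ → if-≡ (eval-allowed ρ e) (λ _ → refl) (λ _ → refl))
      by-size (suc s) m≡ = trans (if-≡ {b = true} {y′ = 0} (cong nz (trans (at-m e) m≡)) (λ _ →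
          Sum-cong F λ w w<F → if-≡ (trans (eval-edge 3 7 (ρ [ 7 ↦ w ])) (cong (λ x → edge x w) (at-v e)))
            (λ _ → Sum-cong F λ i i<F → if-≡ (trans (nz-∸ i (ρ 4)) (cong (i <ᵇ_) (trans (at-m e) m≡)))
              (λ i<ss → subtree w w<F i i<F (<ᵇ-true⁻ i (suc s) i<ss)) (λ _ → refl))
            (λ _ → refl)) (λ ()))
        (sym (tree-step t s v X (subst (_< F) m≡ m<F)))
        where
        subtree : ∀ w → w < F → ∀ i → i < F → i < suc s →
          eval (readE (var 6) 0 (var 8) (var 3) (var 2) *E readE (var 6) 0 (var 4 -E num 1 -E var 8) (var 7) (var 2)) ((ρ [ 7 ↦ w ]) [ 8 ↦ i ])
          ≡ table 0 t i v X * table 0 t (s ∸ i) w X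
        subtree w w<F i i<F i≤s = cong₂ _*_
          (read-known 0 (var 6) (var 8) (var 3) (var 2) _ e₂ (at-t e) refl (at-v e) (at-X e) z<s i<F v<F X<P
            (index-<m 0 t v X (subst (i <_) (sym m≡) i≤s) v<F X<P))
          (read-known 0 (var 6) (var 4 -E num 1 -E var 8) (var 7) (var 2) _ e₂ (at-t e) (cong (_∸ i) (minus-one (trans (at-m e) m≡))) refl (at-X e) z<s
            (≤-<-trans (m∸n≤m s i) (<-trans ≤-refl (subst (_< F) m≡ m<F))) w<F X<P
            (index-<m 0 t v X (subst (s ∸ i <_) (sym m≡) (s≤s (m∸n≤m s i))) w<F X<P))
          where
          e₂ : Env ((ρ [ 7 ↦ w ]) [ 8 ↦ i ])
          e₂ = bind 1 (bind 0 e)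

    eval-trees : κ ≡ 1 → ∀ ρ → Env ρ → eval treesE ρ ≡ table 1 t m v X
    eval-trees refl ρ e = by-level m refl
      where
      by-level : ∀ m₁ → m ≡ m₁ → eval treesE ρ ≡ table 1 t m₁ v X
      by-level zero m≡ = trans (if-≡ {b = false} {x′ = 0} (cong nz (trans (at-m e) m≡)) (λ ()) (λ _ →
          Sum-cong F λ s s<F → if-≡ (trans (nz-∸ s (ρ 3 + ρ 3)) (cong (λ k → s <ᵇ k + k) (at-v e)))
            (λ _ → Sum-cong F λ w w<F →
              read-known 0 (var 6) (var 7) (var 8) (var 2) ((ρ [ 7 ↦ s ]) [ 8 ↦ w ]) (bind 1 (bind 0 e)) (at-t e) refl refl (at-X e) z<s s<F w<F X<P
                (index-<κ m v X s<F w<F X<P t z<s))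
            (λ _ → refl)))
        (sym (trees-start t v X))
      by-level (suc j) m≡ = trans (if-≡ {b = true} {y′ = 0} (cong nz (trans (at-m e) m≡)) (λ _ →
          cong₂ _∸_ (below-level (var 2) (at-X e) X<P)
            (if-≡ (eval-subset 9 ρ₁ (λ _ → j≡) j≡ j≤F (at-X e))
              (λ _ → below-level (var 2 -E weightE (var 9))
                (cong₂ _∸_ (at-X e) (eval-weight (var 9) ρ₁ (λ _ → j≡) j≤F)) (≤-<-trans (m∸n≤m X (weight j)) X<P))
              (λ _ → refl))) (λ ()))
        (sym (trees-step t j v X))
        where
        ρ₁ : ℕ → ℕ
        ρ₁ = ρ [ 9 ↦ ρ 4 ∸ 1 ]
        j≡ : ρ 4 ∸ 1 ≡ j
        j≡ = minus-one (trans (at-m e) m≡)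
        j<F : j < F
        j<F = <-trans ≤-refl (subst (_< F) m≡ m<F)
        j≤F : j ≤ F
        j≤F = <⇒≤ j<F
        below-level : ∀ XE {X′} → eval XE ρ₁ ≡ X′ → X′ < P → eval (readE (var 6) 1 (var 9) (var 3) XE) ρ₁ ≡ table 1 t j v X′
        below-level XE eX X′<P = read-known 1 (var 6) (var 9) (var 3) XE ρ₁ (bind 2 e) (at-t e) j≡ (at-v e) eX (s<s z<s) j<F v<F X′<P
          (index-<m 1 t v X (subst (j <_) (sym m≡) ≤-refl) v<F X′<P)

    if-∧ : ∀ a b → (if a then 𝟙 b else 0) ≡ 𝟙 (a ∧ b)
    if-∧ true b = refl
    if-∧ false b = refl

    if-∨ : ∀ a b → (if a then 1 else 𝟙 b) ≡ 𝟙 (a ∨ b)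
    if-∨ true b = refl
    if-∨ false b = refl

    eval-reach : κ ≡ 2 → ∀ ρ → Env ρ → eval reachE ρ ≡ table 2 t m v X
    eval-reach refl ρ e = by-level m refl
      where
      C = candidate t
      S = subset X
      by-level : ∀ m₁ → m ≡ m₁ → eval reachE ρ ≡ 𝟙 (reach m₁ C S v)
      by-level zero m≡ = trans (if-≡ (eval-allowed ρ e)
          (λ _ → if-≡ {b = false} {x′ = 0} {y′ = 𝟙 (minority v)} (cong nz (trans (at-m e) m≡)) (λ ())
            (λ _ → if-≡ (trans (eval-bl 3 ρ) (cong minority (at-v e))) (λ _ → refl) (λ _ → refl)))
          (λ _ → refl))
        (if-∧ (allowed C S v) (minority v))
      by-level (suc i) m≡ = trans (if-≡ (eval-allowed ρ e)
          (λ _ → trans (if-≡ {b = true} {y′ = 0} (cong nz (trans (at-m e) m≡))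
            (λ _ → if-≡ (trans (cong nz (previous 3 ρ e (at-v e) v<F)) (nz-𝟙 (reach i C S v))) (λ _ → refl)
              (λ _ → if-≡ (cong nz neighbours) (λ _ → refl) (λ _ → refl))) (λ ()))
            (if-∨ (reach i C S v) _))
          (λ _ → refl))
        (if-∧ (allowed C S v) _)
        where
        i<F : i < F
        i<F = <-trans ≤-refl (subst (_< F) m≡ m<F)
        previous : ∀ y ρ₁ {w} → Env ρ₁ → ρ₁ y ≡ w → w < F →
          eval (readE (var 6) 2 (var 4 -E num 1) (var y) (var 2)) ρ₁ ≡ 𝟙 (reach i C S w)
        previous y ρ₁ e₁ y≡ w<F = read-known 2 (var 6) (var 4 -E num 1) (var y) (var 2) ρ₁ e₁ (at-t e₁)
          (minus-one (trans (at-m e₁) m≡)) y≡ (at-X e₁) (s<s (s<s z<s)) i<F w<F X<P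
          (index-<m 2 t v X (subst (i <_) (sym m≡) ≤-refl) w<F X<P)
        neighbours : eval (sumE 7 (ite (edgeE 7 3) (readE (var 6) 2 (var 4 -E num 1) (var 7) (var 2)) (num 0))) ρ
          ≡ Sum F (λ u → if edge u v then 𝟙 (reach i C S u) else 0)
        neighbours = Sum-cong F λ u u<F → if-≡ (trans (eval-edge 7 3 (ρ [ 7 ↦ u ])) (cong (edge u) (at-v e)))
          (λ _ → previous 7 (ρ [ 7 ↦ u ]) (bind 0 e) refl u<F) (λ _ → refl)

    -- Values of single masks have no entry of their own; they are computed inside the entries of
    -- kind 3 from kinds 1 and 2 of the same stage.
    eval-val : κ ≡ 3 → ∀ ρ → Env ρ → eval valE ρ ≡ val (candidate t) X
    eval-val refl ρ e = if-≡
        (cong nz (read-known 1 (var 6) nE (var 15) (var 2) ρ₁ (bind 8 e) (at-t e) (eval-n ρ₁) k≡ (at-X e) (s<s z<s) n<F (count-subset<F X) X<P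
          (index-<κ m v X n<F (count-subset<F X) X<P t (s<s z<s))))
        (λ _ → if-≡ (trans (nz-∸ _ (ρ₁ 15)) (cong₂ _<ᵇ_ reds≡ k≡)) (λ _ → refl) (λ _ → k≡))
        (λ _ → refl)
      where
      C = candidate t
      S = subset X
      ρ₁ : ℕ → ℕ
      ρ₁ = ρ [ 15 ↦ eval (sumE 7 (boolE (subsetE 7))) ρ ]
      k≡ : eval (sumE 7 (boolE (subsetE 7))) ρ ≡ count F S
      k≡ = Sum-cong F λ u u<F → if-≡ (eval-subset 7 (ρ [ 7 ↦ u ]) (λ _ → refl) refl (<⇒≤ u<F) (at-X e)) (λ _ → refl) (λ _ → refl)
      F-1<F : F ∸ 1 < F
      F-1<F = ∸-monoʳ-< z<s F>0
      if-∧-not : ∀ a b → (if a then (if b then 0 else 1) else 0) ≡ 𝟙 (a ∧ not b)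
      if-∧-not true true = refl
      if-∧-not true false = refl
      if-∧-not false b = refl
      reds≡ : eval (sumE 7 (ite (readE (var 6) 2 (rE -E num 1) (var 7) (var 2)) (ite (blE 7) (num 0) (num 1)) (num 0))) ρ₁ ≡ reds C S
      reds≡ = Sum-cong F λ u u<F → trans
        (if-≡ (trans (cong nz (read-known 2 (var 6) (rE -E num 1) (var 7) (var 2) (ρ₁ [ 7 ↦ u ]) (bind 0 (bind 8 e)) (at-t e)
              (cong (_∸ 1) (eval-r (ρ₁ [ 7 ↦ u ]))) refl (at-X e) (s<s (s<s z<s)) F-1<F u<F X<P
              (index-<κ m v X F-1<F u<F X<P t (s<s (s<s z<s))))) (nz-𝟙 (reach (F ∸ 1) C S u)))
          (λ _ → if-≡ (eval-bl 7 (ρ₁ [ 7 ↦ u ])) (λ _ → refl) (λ _ → refl)) (λ _ → refl))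
        (if-∧-not (reach (F ∸ 1) C S u) (minority u))

    eval-best : κ ≡ 3 → ∀ ρ → Env ρ → eval bestE ρ ≡ table 3 t m v X
    eval-best refl ρ e = by-mask X refl
      where
      ρ₁ : ℕ → ℕ
      ρ₁ = ρ [ 13 ↦ eval valE ρ ]
      by-mask : ∀ X₁ → X ≡ X₁ → eval bestE ρ ≡ best (candidate t) X₁
      by-mask zero X≡ = if-≡ {b = false} {x′ = 0} (cong nz (trans (at-X e) X≡)) (λ ())
        (λ _ → trans (eval-val refl ρ e) (cong (val (candidate t)) X≡))
      by-mask (suc X₁) X≡ = if-≡ {b = true} {y′ = 0} (cong nz (trans (at-X e) X≡))
        (λ _ → cong₂ (λ a b → a + (b ∸ a))
          (read-known 3 (var 6) (var 4) (var 3) (var 2 -E num 1) ρ₁ (bind 6 e) (at-t e) (at-m e) (at-v e)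
            (minus-one (trans (at-X e) X≡)) (s<s (s<s (s<s z<s))) m<F v<F (<-trans ≤-refl (subst (_< P) X≡ X<P))
            (index-<X 3 t m v (≤-reflexive (sym X≡))))
          (trans (eval-val refl ρ e) (cong (val (candidate t)) X≡)))
        (λ ())

    eval-kept : κ ≡ 4 → ∀ ρ → Env ρ → eval keptE ρ ≡ table 4 t m v X
    eval-kept refl ρ e = by-stage t refl
      where
      P-1<P : P ∸ 1 < P
      P-1<P = ∸-monoʳ-< z<s P>0
      if-if : ∀ a b c → (if a then 𝟙 b else 𝟙 c) ≡ 𝟙 (if a then b else c)
      if-if true b c = refl
      if-if false b c = refl
      by-stage : ∀ t₁ → t ≡ t₁ → eval keptE ρ ≡ 𝟙 (kept t₁ v)
      by-stage zero t≡ = if-≡ {b = false} {x′ = 0} (cong nz (trans (at-t e) t≡)) (λ ())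
        (λ _ → if-≡ (trans (eval-<n (var 3) ρ) (cong (_<ᵇ n) (at-v e))) (λ _ → refl) (λ _ → refl))
      by-stage (suc t₁) t≡ = trans (if-≡ {b = true} {y′ = 0} (cong nz (trans (at-t e) t≡)) (λ _ →
          if-≡ (trans (nz-≡ (eval (readE (var 6) 3 (num 0) (num 0) (var 1 -E num 1)) ρ) (eval (readE (num 0) 3 (num 0) (num 0) (var 1 -E num 1)) ρ)) (cong₂ _≡ᵇ_ (opt-at (var 6) (suc t₁) (trans (at-t e) t≡) (index-<κ m v X F>0 F>0 P-1<P (suc t₁) ≤-refl))
                  (opt-at (num 0) 0 refl (index-<t m v X F>0 F>0 P-1<P {t = suc t₁} 4 (s<s (s<s (s<s z<s))) z<s))))
            (λ _ → if-≡ (subst (λ w → nz (eval (candidateE 3) ρ) ≡ candidate (suc t₁) w) (at-v e)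
                (subst (λ t → nz (eval (candidateE 3) ρ) ≡ candidate t (ρ 3)) t≡ (eval-candidate 3 ρ e (subst (_< F) (sym (at-v e)) v<F))))
              (λ _ → refl) (λ _ → refl))
            (λ _ → read-known 4 (var 6 -E num 1) (num 0) (var 3) (num 0) ρ e (minus-one (trans (at-t e) t≡)) refl (at-v e) refl ≤-refl F>0 v<F P>0
              (index-<t m v X F>0 v<F P>0 {t′ = t₁} 4 ≤-refl (≤-reflexive (sym t≡))))) (λ ()))
        (if-if (opt (candidate (suc t₁)) ≡ᵇ opt vertices) (candidate (suc t₁) v) (kept t₁ v))
        where
        opt-at : ∀ tE t₂ → eval tE ρ ≡ t₂ → index 3 t₂ 0 0 (P ∸ 1) < index 4 (suc t₁) m v X →
          eval (readE tE 3 (num 0) (num 0) (var 1 -E num 1)) ρ ≡ opt (candidate t₂)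
        opt-at tE t₂ et lt = read-known 3 tE (num 0) (num 0) (var 1 -E num 1) ρ e et refl refl (cong (_∸ 1) (at-P e))
          (s<s (s<s (s<s z<s))) F>0 F>0 P-1<P (subst (λ t → index 3 t₂ 0 0 (P ∸ 1) < index 4 t m v X) (sym t≡) lt)

    eval-kind : κ < 5 → ∀ ρ → Env ρ → ρ 5 ≡ κ → eval kindE ρ ≡ table κ t m v X
    eval-kind κ<5 ρ e κ≡ = by-kind κ refl κ<5
      where
      by-kind : ∀ k → κ ≡ k → k < 5 → eval kindE ρ ≡ table κ t m v X
      by-kind 0 refl _ rewrite κ≡ = eval-tree refl ρ e
      by-kind 1 refl _ rewrite κ≡ = eval-trees refl ρ e
      by-kind 2 refl _ rewrite κ≡ = eval-reach refl ρ e
      by-kind 3 refl _ rewrite κ≡ = eval-best refl ρ e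
      by-kind 4 refl _ rewrite κ≡ = eval-kept refl ρ e
      by-kind (suc (suc (suc (suc (suc k))))) _ (s≤s (s≤s (s≤s (s≤s (s≤s ())))))

  entries : ℕ
  entries = (n + 1) * 5 * F * F * P

  q₁ q₂ q₃ : ℕ → ℕ
  q₁ τ = τ ÷ P
  q₂ τ = q₁ τ ÷ F
  q₃ τ = q₂ τ ÷ F

  stage kind row vertex mask : ℕ → ℕ
  stage τ  = q₃ τ ÷ 5
  kind τ   = q₃ τ ∸ stage τ * 5
  row τ    = q₂ τ ∸ q₃ τ * F
  vertex τ = q₁ τ ∸ q₂ τ * F
  mask τ   = τ ∸ q₁ τ * P

  cell : ℕ → ℕ
  cell τ = if τ <ᵇ entries then table (kind τ) (stage τ) (row τ) (vertex τ) (mask τ) else 𝟙 (kept n (τ ∸ entries))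

  5>0 : 0 < 5
  5>0 = z<s

  index-decode : ∀ τ → index (kind τ) (stage τ) (row τ) (vertex τ) (mask τ) ≡ τ
  index-decode τ = trans (cong (λ k → (k * F + vertex τ) * P + mask τ) (trans (cong (λ k → k * F + row τ) (divide 5>0 (q₃ τ))) (divide F>0 (q₂ τ))))
    (trans (cong (λ k → k * P + mask τ) (divide F>0 (q₁ τ))) (divide P>0 τ))

  cell-index : ∀ κ t m v X → κ < 5 → m < F → v < F → X < P → index κ t m v X < entries →
               cell (index κ t m v X) ≡ table κ t m v X
  cell-index κ t m v X κ<5 m<F v<F X<P i< = trans (cong (if_then table (kind τ) (stage τ) (row τ) (vertex τ) (mask τ) else 𝟙 (kept n (τ ∸ entries))) (<ᵇ-true i<))
    (begin
      table (kind τ) (stage τ) (row τ) (vertex τ) (mask τ) ≡⟨ cong₂ (λ a b → table a b (row τ) (vertex τ) (mask τ)) kind≡ stage≡ ⟩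
      table κ t (row τ) (vertex τ) (mask τ)                ≡⟨ cong₂ (λ a b → table κ t a b (mask τ)) row≡ vertex≡ ⟩
      table κ t m v (mask τ)                               ≡⟨ cong (table κ t m v) mask≡ ⟩
      table κ t m v X                                      ∎)
    where
    open ≡-Reasoning
    τ = index κ t m v X
    q₁≡ : q₁ τ ≡ ((t * 5 + κ) * F + m) * F + v
    q₁≡ = quotient-unique P>0 (((t * 5 + κ) * F + m) * F + v) X<P
    q₂≡ : q₂ τ ≡ (t * 5 + κ) * F + m
    q₂≡ = trans (cong (_÷ F) q₁≡) (quotient-unique F>0 ((t * 5 + κ) * F + m) v<F)
    q₃≡ : q₃ τ ≡ t * 5 + κ
    q₃≡ = trans (cong (_÷ F) q₂≡) (quotient-unique F>0 (t * 5 + κ) m<F)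
    stage≡ : stage τ ≡ t
    stage≡ = trans (cong (_÷ 5) q₃≡) (quotient-unique 5>0 t κ<5)
    kind≡ : kind τ ≡ κ
    kind≡ = trans (cong₂ (λ a b → a ∸ b * 5) q₃≡ stage≡) (m+n∸m≡n (t * 5) κ)
    row≡ : row τ ≡ m
    row≡ = trans (cong₂ (λ a b → a ∸ b * F) q₂≡ q₃≡) (m+n∸m≡n ((t * 5 + κ) * F) m)
    vertex≡ : vertex τ ≡ v
    vertex≡ = trans (cong₂ (λ a b → a ∸ b * F) q₁≡ q₂≡) (m+n∸m≡n (((t * 5 + κ) * F + m) * F) v)
    mask≡ : mask τ ≡ X
    mask≡ = trans (cong (λ a → τ ∸ a * P) q₁≡) (m+n∸m≡n ((((t * 5 + κ) * F + m) * F + v) * P) X)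

  index<entries : ∀ κ t m v X → t ≤ n → κ < 5 → m < F → v < F → X < P → index κ t m v X < entries
  index<entries κ t m v X t≤n κ<5 m<F v<F X<P = <-≤-trans
    -- `entries` is the index at which stage `n + 1` would begin.
    (index-<t 0 0 0 m<F v<F X<P 0 κ<5 (≤-trans (s≤s t≤n) (≤-reflexive (+-comm 1 n))))
    (≤-reflexive (collapse (n + 1)))
    where
    collapse : ∀ a → ((((a * 5 + 0) * F + 0) * F + 0) * P + 0) ≡ a * 5 * F * F * P
    collapse a = trans (+-identityʳ _) (cong (_* P) (trans (+-identityʳ _) (cong (_* F) (trans (+-identityʳ _) (cong (_* F) (+-identityʳ (a * 5)))))))

  cell-output : ∀ v → cell (entries + v) ≡ 𝟙 (kept n v)
  cell-output v = trans (cong (if_then table (kind τ) (stage τ) (row τ) (vertex τ) (mask τ) else 𝟙 (kept n (τ ∸ entries))) (<ᵇ-false (m≤m+n entries v)))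
    (cong (λ w → 𝟙 (kept n w)) (m+n∸m≡n entries v))
    where τ = entries + v

  module Entry (z : ℕ → ℕ) where
    open Eval n I z
    open Basic z

    eval-P : ∀ ρ → eval (weightE nE) ρ ≡ P
    eval-P ρ = eval-weight nE ρ (λ i → eval-n (ρ [ 21 ↦ i ])) n≤range

    eval-stages : ∀ ρ → ρ 1 ≡ P → eval stagesE ρ ≡ entries
    eval-stages ρ P≡ = trans (cong₂ (λ a b → (a + 1) * 5 * b * b * ρ 1) (eval-n ρ) (eval-r ρ)) (cong ((n + 1) * 5 * F * F *_) P≡)

    opaque
      unfolding entryE sizeE

      eval-sizeE : ∀ ρ → eval sizeE ρ ≡ entries + n
      eval-sizeE ρ = cong₂ _+_ (eval-stages _ (eval-P ρ)) (eval-n (ρ [ 1 ↦ eval (weightE nE) ρ ]))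

      eval-entryE : ∀ τ ρ → ρ 0 ≡ τ → τ < entries + n → (∀ j → j < τ → z j ≡ cell j) → eval entryE ρ ≡ cell τ
      eval-entryE τ ρ ρ0≡ τ< known = if-≡ (trans (nz-∸ (ρ 0) (eval stagesE ρ₉)) (cong₂ _<ᵇ_ ρ0≡ (eval-stages ρ₉ P≡)))
        (λ τ<N → let open Step z (kind τ) (stage τ) (row τ) (vertex τ) (mask τ) row<F vertex<F mask<P (known-index (<ᵇ-true⁻ τ entries τ<N)) in
          eval-kind (remainder< 5>0 (q₃ τ)) ρ₉ (record { at-P = P≡ ; at-X = mask≡ ; at-v = vertex≡ ; at-m = row≡ ; at-t = stage≡ }) kind≡)
        (λ τ≥N → let N≤τ = ≮⇒≥ (λ lt → true≢false (<ᵇ-true lt) τ≥N)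
                     v<n = +-cancelˡ-< entries (τ ∸ entries) n (≤-<-trans (≤-reflexive (m+[n∸m]≡n N≤τ)) τ<)
                     v<F = <-≤-trans v<n n≤range
                     i<N = index<entries 4 n 0 (τ ∸ entries) 0 ≤-refl ≤-refl F>0 v<F P>0
          in trans (eval-read 4 nE (num 0) (var 0 -E stagesE) (num 0) ρ₉ P≡ (eval-n ρ₉) refl (cong₂ _∸_ ρ0≡ (eval-stages ρ₉ P≡)) refl)
               (trans (known _ (<-≤-trans i<N N≤τ)) (cell-index 4 n 0 (τ ∸ entries) 0 ≤-refl F>0 v<F P>0 i<N)))
        where
        ρ₁ ρ₂ ρ₃ ρ₄ ρ₅ ρ₆ ρ₇ ρ₈ ρ₉ : ℕ → ℕ
        ρ₁ = ρ [ 1 ↦ eval (weightE nE) ρ ]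
        ρ₂ = ρ₁ [ 10 ↦ eval (var 0 ÷E var 1) ρ₁ ]
        ρ₃ = ρ₂ [ 11 ↦ eval (var 10 ÷E rE) ρ₂ ]
        ρ₄ = ρ₃ [ 12 ↦ eval (var 11 ÷E rE) ρ₃ ]
        ρ₅ = ρ₄ [ 2 ↦ eval (var 0 -E var 10 *E var 1) ρ₄ ]
        ρ₆ = ρ₅ [ 3 ↦ eval (var 10 -E var 11 *E rE) ρ₅ ]
        ρ₇ = ρ₆ [ 4 ↦ eval (var 11 -E var 12 *E rE) ρ₆ ]
        ρ₈ = ρ₇ [ 6 ↦ eval (var 12 ÷E num 5) ρ₇ ]
        ρ₉ = ρ₈ [ 5 ↦ eval (var 12 -E var 6 *E num 5) ρ₈ ]
        P≡ : ρ₁ 1 ≡ P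
        P≡ = eval-P ρ
        q₁≡ : ρ₂ 10 ≡ q₁ τ
        q₁≡ = cong₂ _÷_ ρ0≡ P≡
        q₂≡ : ρ₃ 11 ≡ q₂ τ
        q₂≡ = cong₂ _÷_ q₁≡ (eval-r ρ₂)
        q₃≡ : ρ₄ 12 ≡ q₃ τ
        q₃≡ = cong₂ _÷_ q₂≡ (eval-r ρ₃)
        mask≡ : ρ₅ 2 ≡ mask τ
        mask≡ = cong₂ _∸_ ρ0≡ (cong₂ _*_ q₁≡ P≡)
        vertex≡ : ρ₆ 3 ≡ vertex τ
        vertex≡ = cong₂ _∸_ q₁≡ (cong₂ _*_ q₂≡ (eval-r ρ₅))
        row≡ : ρ₇ 4 ≡ row τ
        row≡ = cong₂ _∸_ q₂≡ (cong₂ _*_ q₃≡ (eval-r ρ₆))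
        stage≡ : ρ₈ 6 ≡ stage τ
        stage≡ = cong (_÷ 5) q₃≡
        kind≡ : ρ₉ 5 ≡ kind τ
        kind≡ = cong₂ (λ a b → a ∸ b * 5) q₃≡ stage≡
        row<F : row τ < F
        row<F = remainder< F>0 (q₂ τ)
        vertex<F : vertex τ < F
        vertex<F = remainder< F>0 (q₁ τ)
        mask<P : mask τ < P
        mask<P = remainder< P>0 τ
        known-index : τ < entries → ∀ κ′ t′ m′ v′ X′ → κ′ < 5 → m′ < F → v′ < F → X′ < P →
          index κ′ t′ m′ v′ X′ < index (kind τ) (stage τ) (row τ) (vertex τ) (mask τ) → z (index κ′ t′ m′ v′ X′) ≡ table κ′ t′ m′ v′ X′
        known-index τ<N κ′ t′ m′ v′ X′ κ′< m′< v′< X′< lt = trans (known _ i<τ) (cell-index κ′ t′ m′ v′ X′ κ′< m′< v′< X′< (<-trans i<τ τ<N))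
          where
          i<τ : index κ′ t′ m′ v′ X′ < τ
          i<τ = subst (index κ′ t′ m′ v′ X′ <_) (index-decode τ) lt

-- Size of the table and of its entries

-- The first two mirror repeated use of `op-<₂` on the products and sums that form `big` and `size`.
cellBits sizeBits tableBits rounds : ℕ → ℕ
cellBits n  = range n + (range n + ((range n + range n) * (range n * range n) + 1) + 1) + 1
sizeBits n  = ((n + 1) + 5 + 1 + range n + 1 + range n + 1 + (n + 1) + 1) + n + 1
tableBits n = cellBits n + (sizeBits n + suc n)
rounds n    = (n + 1) * 5 * range n * range n + n

poly-tableBits : Polynomial tableBits
poly-tableBits =
  (poly-range ⊕ (poly-range ⊕ ((poly-range ⊕ poly-range) ⊗ (poly-range ⊗ poly-range) ⊕ poly-const 1) ⊕ poly-const 1) ⊕ poly-const 1) ⊕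
  ((((poly-id ⊕ poly-const 1) ⊕ poly-const 5 ⊕ poly-const 1 ⊕ poly-range ⊕ poly-const 1 ⊕ poly-range ⊕ poly-const 1
     ⊕ (poly-id ⊕ poly-const 1) ⊕ poly-const 1) ⊕ poly-id ⊕ poly-const 1) ⊕ poly-suc poly-id)

poly-rounds : Polynomial rounds
poly-rounds = (poly-id ⊕ poly-const 1) ⊗ poly-const 5 ⊗ poly-range ⊗ poly-range ⊕ poly-id

first-≤ : ∀ a b c → a ≤ a + (b + c)
first-≤ a b c = m≤m+n a (b + c)

second-≤ : ∀ a b c → b ≤ a + (b + c)
second-≤ a b c = ≤-trans (m≤m+n b c) (m≤n+m (b + c) a)

third-≤ : ∀ a b c → c ≤ a + (b + c)
third-≤ a b c = ≤-trans (m≤n+m c b) (m≤n+m (b + c) a)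

count-not : ∀ m p → count m p + count m (λ x → not (p x)) ≡ m
count-not m p = trans (sym (Sum-+ m (λ x → 𝟙 (p x)) (λ x → 𝟙 (not (p x)))))
  (trans (Sum-cong m (λ x _ → complement (p x))) (trans (Sum-const m 1) (*-identityʳ m)))
  where
  complement : ∀ b → 𝟙 b + 𝟙 (not b) ≡ 1
  complement true = refl
  complement false = refl

power-<₂ : ∀ {x a} k → x ≤ 2 ^ a → x ^ k <₂ (a * k + 1)
power-<₂ {x} {a} k x≤ = below (≤-<-trans (≤-trans (^-monoˡ-≤ k x≤) (≤-reflexive (^-*-assoc 2 a k)))
  (^-monoʳ-< 2 (s≤s (s≤s z≤n)) (≤-reflexive (+-comm 1 (a * k)))))

module _ (n : ℕ) (I : ℕ → ℕ) where
  open Input n I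

  redCount≡ : redCount ≡ count n colour
  redCount≡ = Sum-cut (range n) (λ v → 𝟙 (colour v)) n (m≤m+n n (n + 2))

  minority-half : count n minority + count n minority ≤ n
  minority-half with n <ᵇ redCount + redCount in flag
  ... | true = +-cancelʳ-≤ (r + r) _ _ (begin
      m + m + (r + r)     ≡⟨ +-interchange m m r r ⟩
      (m + r) + (m + r)   ≡⟨ cong (λ k → k + k) total ⟩
      n + n               ≤⟨ +-monoʳ-≤ n (<⇒≤ (subst (λ k → n < k + k) redCount≡ (<ᵇ-true⁻ n (redCount + redCount) flag))) ⟩
      n + (r + r)         ∎)
    where
    open ≤-Reasoning
    r = count n colour
    m = count n (λ v → if v <ᵇ n then not (colour v) else false)
    total : m + r ≡ n
    total = trans (cong (_+ r) (count-cong n λ v v<n → cong (if_then not (colour v) else false) (<ᵇ-true v<n)))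
      (trans (+-comm _ r) (count-not n colour))
  ... | false = subst (λ k → k + k ≤ n)
    (trans redCount≡ (count-cong n λ v v<n → sym (cong (if_then colour v else false) (<ᵇ-true v<n))))
    (≮⇒≥ λ lt → true≢false (<ᵇ-true lt) flag)

module Bounding (n : ℕ) (I : ℕ → ℕ) (I0 : I 0 ≡ n) (edge-sym : ∀ u v → Input.edge n I u v ≡ Input.edge n I v u)
  (I-beyond : ∀ i → base n ≤ i → I i ≡ 0) (I-small : ∀ i → I i ≤ suc n) where

  open Input n I
  open Evaluation n I I0 edge-sym
  open Reduction n edge (λ u v → edge<n u v) edge-sym minority minority<n

  P≤ : P ≤ 2 ^ ⌊ n /2⌋
  P≤ = weight-≤ n n (minority-half n I)

  -- The largest entries are sums of tree counts over edge numbers and roots, hence the two factors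
  -- `F`; with `s < F` edges the exponent `s * s` is at most `F * F`.
  big : ℕ
  big = F * (F * (F * F) ^ (F * F))

  big-<₂ : big <₂ cellBits n
  big-<₂ = op-<₂ mul (n<₂n F) (op-<₂ mul (n<₂n F) (power-<₂ {F * F} {F + F} (F * F)
    (≤-trans (*-mono-≤ (<⇒≤ (n<2^n F)) (<⇒≤ (n<2^n F))) (≤-reflexive (sym (^-distribˡ-+-* 2 F F))))))

  F*F≥1 : 1 ≤ F * F
  F*F≥1 = *-mono-≤ F>0 F>0

  power≥1 : 1 ≤ (F * F) ^ (F * F)
  power≥1 = m^n>0 (F * F) ⦃ >-nonZero F*F≥1 ⦄ (F * F)

  F≤big : F ≤ big
  F≤big = ≤-trans (≤-reflexive (sym (*-identityʳ F))) (*-monoʳ-≤ F (*-mono-≤ F>0 power≥1))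

  1≤big : 1 ≤ big
  1≤big = ≤-trans F>0 F≤big

  sumT-power : ∀ s v φ → s < F → (∀ t → φ t ≤ 1) → sumT F s v φ ≤ (F * F) ^ (F * F)
  sumT-power s v φ s<F φ≤1 = ≤-trans (sumT-≤ F s v φ 1 F>0 φ≤1)
    (≤-trans (≤-reflexive (*-identityʳ _)) (^-monoʳ-≤ (F * F) ⦃ >-nonZero F*F≥1 ⦄ (*-mono-≤ (<⇒≤ s<F) (<⇒≤ s<F))))

  best-≤F : ∀ C X → best C X ≤ F
  best-≤F C X = subst (_≤ F) (proj₂ (best-attained C X)) (val-≤F (proj₁ (best-attained C X)))
    where
    val-≤F : ∀ X → val C X ≤ F
    val-≤F X = if-≤ (nz (trees n (count F (subset X)) C (subset X)))
      (else-≤ (reds C (subset X) <ᵇ count F (subset X)) (count-≤ F (subset X)))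
      where
      else-≤ : ∀ b {x y} → x ≤ y → (if b then 0 else x) ≤ y
      else-≤ true _ = z≤n
      else-≤ false le = le

  table-≤ : ∀ κ t m v X → m < F → table κ t m v X ≤ big
  table-≤ 0 t m v X m<F = ≤-trans (sumT-power m v _ m<F (λ u → 𝟙≤1 (allIn (allowed (candidate t) (subset X)) u)))
    (≤-trans (≤-reflexive (sym (trans (+-identityʳ _) (+-identityʳ _)))) (*-mono-≤ F>0 (*-monoˡ-≤ _ F>0)))
  table-≤ 1 t m v X m<F = Sum-bound F λ s s<F → if-≤ (s <ᵇ v + v) (Sum-bound F λ w _ →
    sumT-power s w _ s<F (λ u → 𝟙≤1 (fits m (candidate t) (subset X) u)))
  table-≤ 2 t m v X m<F = ≤-trans (𝟙≤1 (reach m (candidate t) (subset X) v)) 1≤big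
  table-≤ 3 t m v X m<F = ≤-trans (best-≤F (candidate t) X) F≤big
  table-≤ (suc (suc (suc (suc _)))) t m v X m<F = ≤-trans (𝟙≤1 (kept t v)) 1≤big

  cell-≤ : ∀ τ → cell τ ≤ big
  cell-≤ τ with τ <ᵇ entries
  ... | true = table-≤ (kind τ) (stage τ) (row τ) (vertex τ) (mask τ) (remainder< F>0 (q₂ τ))
  ... | false = ≤-trans (𝟙≤1 (kept n (τ ∸ entries))) 1≤big

  size : ℕ
  size = entries + n

  size-<₂ : size <₂ sizeBits n
  size-<₂ = op-<₂ add (op-<₂ mul (op-<₂ mul (op-<₂ mul (op-<₂ mul (n<₂n (n + 1)) (n<₂n 5)) (n<₂n F)) (n<₂n F)) P<) (n<₂n n)
    where
    P< : P <₂ (n + 1)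
    P< = below (≤-<-trans P≤ (^-monoʳ-< 2 (s≤s (s≤s z≤n)) (≤-<-trans (⌊n/2⌋≤n n) (≤-reflexive (+-comm 1 n)))))

  size-≤ : size ≤ 2 ^ ⌊ n /2⌋ * rounds n
  size-≤ = begin
    (n + 1) * 5 * F * F * P + n                            ≤⟨ +-mono-≤ (*-monoʳ-≤ ((n + 1) * 5 * F * F) P≤) (m≤n*m n E ⦃ m^n≢0 2 ⌊ n /2⌋ ⦄) ⟩
    (n + 1) * 5 * F * F * E + E * n                        ≡⟨ cong (_+ E * n) (*-comm ((n + 1) * 5 * F * F) E) ⟩
    E * ((n + 1) * 5 * F * F) + E * n                      ≡⟨ *-distribˡ-+ E ((n + 1) * 5 * F * F) n ⟨
    E * rounds n                                           ∎
    where
    open ≤-Reasoning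
    E = 2 ^ ⌊ n /2⌋

  D : ℕ
  D = memoryBits sizeE entryE poly-tableBits poly-rounds n

  suc-n-<₂ : suc n <₂ tableBits n
  suc-n-<₂ = <₂-weaken (n<₂n (suc n)) (third-≤ (cellBits n) (sizeBits n) (suc n))

  ran : ∃[ t ] ∃[ σ ] ⟨ tableProgram sizeE entryE , I ⟩⇓⟨ t , σ ⟩
    × t ≤ tableTime sizeE entryE n D size × (∀ v → v < n → σ v ≡ cell (size ∸ n + v))
  ran = Table.tableProgram-ok n D (tableBits n) I sizeE entryE cell size I0 I-beyond
      (λ i → ≤-<₂ (I-small i) suc-n-<₂)
      (<₂-weaken size-<₂ (second-≤ (cellBits n) (sizeBits n) (suc n)))
      suc-n-<₂ (m≤n+m n entries) (Entry.eval-sizeE (λ _ → 0) (λ _ → 0))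
      (λ τ z τ< known → Entry.eval-entryE z τ ((λ _ → 0) [ 0 ↦ τ ]) refl τ< known)
      (λ τ _ → <₂-weaken (≤-<₂ (cell-≤ τ) big-<₂) (first-≤ (cellBits n) (sizeBits n) (suc n)))
      (first-≤ (tableBits n) (exBits sizeE F (tableBits n)) (exBits entryE F (tableBits n)))
      (second-≤ (tableBits n) (exBits sizeE F (tableBits n)) (exBits entryE F (tableBits n)))
      (third-≤ (tableBits n) (exBits sizeE F (tableBits n)) (exBits entryE F (tableBits n)))

  program-ok : ∃[ t ] ∃[ σ ] ⟨ tableProgram sizeE entryE , I ⟩⇓⟨ t , σ ⟩
    × t ≤ 2 ^ ⌊ n /2⌋ * timeFactor sizeE entryE poly-tableBits poly-rounds n × (∀ v → v < n → σ v ≡ 𝟙 (kept n v))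
  program-ok = finish ran
    where
    finish : (∃[ t ] ∃[ σ ] ⟨ tableProgram sizeE entryE , I ⟩⇓⟨ t , σ ⟩
      × t ≤ tableTime sizeE entryE n D size × (∀ v → v < n → σ v ≡ cell (size ∸ n + v))) → _
    finish (t , σ , run , t≤ , out) = t , σ , run ,
      ≤-trans t≤ (tableTime-≤ sizeE entryE poly-tableBits poly-rounds n size-≤) ,
      λ v v<n → trans (out v v<n) (trans (cong (λ k → cell (k + v)) (m+n∸n≡m entries n)) (cell-output v))

-- The input graph

load-++ˡ : ∀ xs {ys i} → i < length xs → load (xs ++ ys) i ≡ load xs i
load-++ˡ (x ∷ xs) {i = zero} _ = refl
load-++ˡ (x ∷ xs) {i = suc i} (s≤s i<) = load-++ˡ xs i<

load-++ʳ : ∀ xs {ys} i → load (xs ++ ys) (length xs + i) ≡ load ys i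
load-++ʳ [] i = refl
load-++ʳ (x ∷ xs) i = load-++ʳ xs i

load-beyond : ∀ xs {i} → length xs ≤ i → load xs i ≡ 0
load-beyond [] _ = refl
load-beyond (x ∷ xs) {suc i} (s≤s le) = load-beyond xs le

load-≤ : ∀ {xs c} → All (_≤ c) xs → ∀ i → load xs i ≤ c
load-≤ [] i = z≤n
load-≤ (x≤c ∷ _) zero = x≤c
load-≤ (_ ∷ xs≤c) (suc i) = load-≤ xs≤c i

load-tabulate : ∀ {A : Set} {m} (f : A → ℕ) (g : Fin m → A) v → load (map f (List.tabulate g)) (toℕ v) ≡ f (g v)
load-tabulate f g zero = refl
load-tabulate f g (suc v) = load-tabulate f (λ w → g (suc w)) v

length-product : ∀ {A : Set} (f : A → A → ℕ) xs ys → length (cartesianProductWith f xs ys) ≡ length xs * length ys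
length-product f [] ys = refl
length-product f (x ∷ xs) ys = trans (length-++ (map (f x) ys)) (cong₂ _+_ (length-map (f x) ys) (length-product f xs ys))

load-product : ∀ {A : Set} {m} (f : A → A → ℕ) (g : Fin m → A) ys u {j} → j < length ys →
  load (cartesianProductWith f (List.tabulate g) ys) (toℕ u * length ys + j) ≡ load (map (f (g u)) ys) j
load-product f g ys zero j< = load-++ˡ (map (f (g zero)) ys) (≤-trans j< (≤-reflexive (sym (length-map (f (g zero)) ys))))
load-product f g ys (suc u) {j} j< = trans
  (cong (load (map (f (g zero)) ys ++ rest))
    (trans (+-assoc (length ys) (toℕ u * length ys) j) (cong (_+ (toℕ u * length ys + j)) (sym (length-map (f (g zero)) ys)))))
  (trans (load-++ʳ (map (f (g zero)) ys) (toℕ u * length ys + j)) (load-product f (λ w → g (suc w)) ys u j<))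
  where rest = cartesianProductWith f (List.tabulate (λ w → g (suc w))) ys

module Encoding {n : ℕ} (G : BicoloredGraph n) where
  open BicoloredGraph G

  I : Memory
  I = encode G

  colours matrix : List ℕ
  colours = map (λ v → colorCode (color v)) (allFin n)
  matrix  = cartesianProductWith (λ u v → if adj u v then 1 else 0) (allFin n) (allFin n)

  length-allFin : length (allFin n) ≡ n
  length-allFin = length-tabulate (λ v → v)

  length-colours : length colours ≡ n
  length-colours = trans (length-map _ (allFin n)) length-allFin

  I-colour : ∀ v → I (1 + toℕ v) ≡ colorCode (color v)
  I-colour v = trans (load-++ˡ colours (≤-trans (toℕ<n v) (≤-reflexive (sym length-colours))))
    (load-tabulate (λ v → colorCode (color v)) (λ v → v) v)

  I-adj : ∀ u v → I (1 + n + (toℕ u * n + toℕ v)) ≡ (if adj u v then 1 else 0)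
  I-adj u v = trans (cong (λ k → load (colours ++ matrix) (k + (toℕ u * n + toℕ v))) (sym length-colours))
    (trans (load-++ʳ colours (toℕ u * n + toℕ v))
      (trans (cong (λ k → load matrix (toℕ u * k + toℕ v)) (sym length-allFin))
        (trans (load-product (λ u v → if adj u v then 1 else 0) (λ v → v) (allFin n) u (≤-trans (toℕ<n v) (≤-reflexive (sym length-allFin))))
          (load-tabulate (λ v → if adj u v then 1 else 0) (λ v → v) v))))

  I-beyond : ∀ i → base n ≤ i → I i ≡ 0
  I-beyond i le = load-beyond (n ∷ colours ++ matrix) (≤-trans (≤-reflexive total) (≤-trans bound le))
    where
    total : length (n ∷ colours ++ matrix) ≡ suc (n + n * n)
    total = cong suc (trans (length-++ colours) (cong₂ _+_ length-colours
      (trans (length-product _ (allFin n) (allFin n)) (cong₂ _*_ length-allFin length-allFin))))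
    bound : suc (n + n * n) ≤ base n
    bound = ≤-trans (s≤s (+-monoʳ-≤ n (*-monoʳ-≤ n (n≤1+n n)))) (≤-reflexive (cong (λ k → k * k) (+-comm 1 n)))

  I-small : ∀ i → I i ≤ suc n
  I-small = load-≤ (n≤1+n n ∷ All.++⁺ (All.map⁺ (All.universal (λ v → ≤-trans (code≤1 (color v)) (s≤s z≤n)) (allFin n)))
      (All.cartesianProductWith⁺ (setoid _) (setoid _) (λ u v → if adj u v then 1 else 0) (allFin n) (allFin n)
        (λ {u} {v} _ _ → ≤-trans (𝟙≤1 (adj u v)) (s≤s z≤n))))
    where
    code≤1 : ∀ c → colorCode c ≤ 1
    code≤1 blue = z≤n
    code≤1 red = ≤-refl

  open Input n I

  colour-red : ∀ v → colour (toℕ v) ≡ isRed (color v)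
  colour-red v = trans (cong nz (I-colour v)) (code-red (color v))
    where
    code-red : ∀ c → nz (colorCode c) ≡ isRed c
    code-red blue = refl
    code-red red = refl

  edge-adj : ∀ u v → edge (toℕ u) (toℕ v) ≡ adj u v
  edge-adj u v rewrite <ᵇ-true (toℕ<n u) | <ᵇ-true (toℕ<n v) | I-adj u v = nz-𝟙 (adj u v)

  edge-outˡ : ∀ {u} v → n ≤ u → edge u v ≡ false
  edge-outˡ v n≤u rewrite <ᵇ-false n≤u = refl

  edge-outʳ : ∀ u {v} → n ≤ v → edge u v ≡ false
  edge-outʳ u n≤v rewrite <ᵇ-false n≤v with u <ᵇ n
  ... | true = refl
  ... | false = refl

  edge-sym : ∀ u v → edge u v ≡ edge v u
  edge-sym u v = by (u <? n) (v <? n)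
    where
    by : Dec (u < n) → Dec (v < n) → edge u v ≡ edge v u
    by (yes u<n) (yes v<n) = subst₂ (λ a b → edge a b ≡ edge b a) (toℕ-fromℕ< u<n) (toℕ-fromℕ< v<n)
      (trans (edge-adj (fromℕ< u<n) (fromℕ< v<n)) (trans (symm _ _) (sym (edge-adj (fromℕ< v<n) (fromℕ< u<n)))))
    by (no u≮n) _ = trans (edge-outˡ v (≮⇒≥ u≮n)) (sym (edge-outʳ v (≮⇒≥ u≮n)))
    by (yes _) (no v≮n) = trans (edge-outʳ u (≮⇒≥ v≮n)) (sym (edge-outˡ u (≮⇒≥ v≮n)))

-- From the kept vertices to an optimal subgraph

member : ∀ {m} → Subset m → ℕ → Bool
member [] _ = false
member (b ∷ H) zero = b
member (b ∷ H) (suc x) = member H x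

member-lookup : ∀ {m} (H : Subset m) v → member H (toℕ v) ≡ lookup H v
member-lookup (b ∷ H) zero = refl
member-lookup (b ∷ H) (suc v) = member-lookup H v

member<n : ∀ {m} (H : Subset m) x → member H x ≡ true → x < m
member<n (b ∷ H) zero _ = z<s
member<n (b ∷ H) (suc x) x∈ = s<s (member<n H x x∈)

Sum-head : ∀ m f → Sum (suc m) f ≡ f 0 + Sum m (λ i → f (suc i))
Sum-head zero f = +-comm 0 (f 0)
Sum-head (suc m) f = trans (cong (_+ f (suc m)) (Sum-head m f)) (+-assoc (f 0) _ (f (suc m)))

size-member : ∀ {m} (H : Subset m) → ∣ H ∣ ≡ count m (member H)
size-member [] = refl
size-member {suc m} (true ∷ H) = trans (cong suc (size-member H)) (sym (Sum-head m (λ x → 𝟙 (member (true ∷ H) x))))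
size-member {suc m} (false ∷ H) = trans (size-member H) (sym (Sum-head m (λ x → 𝟙 (member (false ∷ H) x))))

count-range : ∀ {m k} p → m ≤ k → (∀ x → p x ≡ true → x < m) → count k p ≡ count m p
count-range p m≤k p<m = Sum-extend (λ x → 𝟙 (p x)) m≤k (λ i m≤i → cong 𝟙 (≢true⇒false λ pi → <⇒≱ (p<m i pi) m≤i))

module Correctness {n : ℕ} (G : BicoloredGraph n) where
  open BicoloredGraph G
  open Encoding G
  open Input n I
  open Reduction n edge (λ u v → edge<n u v) edge-sym minority minority<n

  size-∩ : ∀ (H : Subset n) (p : Fin n → Bool) (q : ℕ → Bool) → (∀ v → p v ≡ q (toℕ v)) →
           ∣ H ∩ tabulate p ∣ ≡ count F (λ x → member H x ∧ q x)
  size-∩ H p q eq = trans (size-member (H ∩ tabulate p)) (trans (count-cong n pointwise)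
    (sym (count-range (λ x → member H x ∧ q x) n≤range (λ x x∈ → member<n H x (proj₁ (∧⁻ {member H x} x∈))))))
    where
    pointwise : ∀ x → x < n → member (H ∩ tabulate p) x ≡ member H x ∧ q x
    pointwise x x<n = subst (λ x → member (H ∩ tabulate p) x ≡ member H x ∧ q x) (toℕ-fromℕ< x<n)
      (begin
        member (H ∩ tabulate p) (toℕ v)       ≡⟨ member-lookup (H ∩ tabulate p) v ⟩
        lookup (H ∩ tabulate p) v             ≡⟨ lookup-zipWith _∧_ v H (tabulate p) ⟩
        lookup H v ∧ lookup (tabulate p) v    ≡⟨ cong₂ _∧_ (sym (member-lookup H v)) (trans (lookup∘tabulate p v) (eq v)) ⟩
        member H (toℕ v) ∧ q (toℕ v)          ∎)
      where
      open ≡-Reasoning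
      v = fromℕ< x<n

  not-blue : ∀ c → isRed c ≡ not (isBlue c)
  not-blue blue = refl
  not-blue red = refl

  not-red : ∀ c → isBlue c ≡ not (isRed c)
  not-red blue = refl
  not-red red = refl

  inMinority inMajority : Subset n → ℕ
  inMinority H = count F (λ x → member H x ∧ minority x)
  inMajority H = count F (λ x → member H x ∧ not (minority x))

  -- Which colour is the minority depends on the graph; balance is symmetric in the colours, so both
  -- cases lead to the same condition.
  minority-colour : (∀ v → minority (toℕ v) ≡ isBlue (color v)) ⊎ (∀ v → minority (toℕ v) ≡ isRed (color v))
  minority-colour with n <ᵇ redCount + redCount
  ... | true = inj₁ λ v → trans (cong (if_then not (colour (toℕ v)) else false) (<ᵇ-true (toℕ<n v)))
                 (trans (cong not (colour-red v)) (sym (not-red (color v))))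
  ... | false = inj₂ λ v → trans (cong (if_then colour (toℕ v) else false) (<ᵇ-true (toℕ<n v))) (colour-red v)

  colour-sizes : ∀ H → (∣ H ∩ B G ∣ ≡ inMinority H × ∣ H ∩ R G ∣ ≡ inMajority H) ⊎
                       (∣ H ∩ B G ∣ ≡ inMajority H × ∣ H ∩ R G ∣ ≡ inMinority H)
  colour-sizes H with minority-colour
  ... | inj₁ eq = inj₁ (size-∩ H _ minority (λ v → sym (eq v)) ,
                        size-∩ H _ (λ x → not (minority x)) (λ v → trans (not-blue (color v)) (cong not (sym (eq v)))))
  ... | inj₂ eq = inj₂ (size-∩ H _ (λ x → not (minority x)) (λ v → trans (not-red (color v)) (cong not (sym (eq v)))) ,
                        size-∩ H _ minority (λ v → sym (eq v)))

  balanced⁺ : ∀ H → inMinority H ≡ inMajority H → Balanced G H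
  balanced⁺ H eq with colour-sizes H
  ... | inj₁ (b , r) = trans b (trans eq (sym r))
  ... | inj₂ (b , r) = trans b (trans (sym eq) (sym r))

  balanced⁻ : ∀ H → Balanced G H → inMinority H ≡ inMajority H
  balanced⁻ H eq with colour-sizes H
  ... | inj₁ (b , r) = trans (sym b) (trans eq r)
  ... | inj₂ (b , r) = trans (sym r) (trans (sym eq) b)

  size-split : ∀ H → ∣ H ∣ ≡ inMinority H + inMajority H
  size-split H = trans (size-member H) (trans (sym (count-range (member H) n≤range (member<n H))) (count-split F (member H) minority))

  ∈⇒member : ∀ {H : Subset n} {v} → v ∈ H → member H (toℕ v) ≡ true
  ∈⇒member {H} {v} v∈ = trans (member-lookup H v) ([]=⇒lookup v∈)

  member⇒∈ : ∀ {H : Subset n} {v} → member H (toℕ v) ≡ true → v ∈ H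
  member⇒∈ {H} {v} v∈ = lookup⇒[]= v H (trans (sym (member-lookup H v)) v∈)

  connected⇒conn : ∀ H → Connected G H → Conn (member H)
  connected⇒conn H conn {a} {b} a∈ b∈ = subst₂ (Star (Edge (member H))) (toℕ-fromℕ< a<n) (toℕ-fromℕ< b<n)
    (gmap toℕ (λ (x∈ , y∈ , e) → ∈⇒member x∈ , ∈⇒member y∈ , trans (edge-adj _ _) e)
      (conn (member⇒∈ (trans (cong (member H) (toℕ-fromℕ< a<n)) a∈)) (member⇒∈ (trans (cong (member H) (toℕ-fromℕ< b<n)) b∈))))
    where
    a<n = member<n H a a∈
    b<n = member<n H b b∈

  conn⇒connected : ∀ H → Conn (member H) → Connected G H
  conn⇒connected H conn {u} {v} u∈ v∈ = path (conn (∈⇒member u∈) (∈⇒member v∈)) u refl refl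
    where
    path : ∀ {a b} → Star (Edge (member H)) a b → ∀ u → toℕ u ≡ a → toℕ v ≡ b → Star (InducedEdge G H) u v
    path ε u u≡ v≡ rewrite toℕ-injective (trans u≡ (sym v≡)) = ε
    path (_◅_ {j = c} (a∈ , c∈ , e) rest) u refl v≡ =
      (member⇒∈ a∈ , member⇒∈ (trans (cong (member H) w≡) c∈) , trans (sym (edge-adj u w)) (trans (cong (edge (toℕ u)) w≡) e))
      ◅ path rest w w≡ v≡
      where
      w = fromℕ< (member<n H c c∈)
      w≡ = toℕ-fromℕ< (member<n H c c∈)

  member⊆vertices : ∀ (H : Subset n) → member H ⊆ vertices
  member⊆vertices H x x∈ = <ᵇ-true (member<n H x x∈)

  -- A feasible set has equally many vertices of both colours, at most `opt vertices` of each by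
  -- `opt-complete`, and the kept vertices attain this.
  optimal : ∀ H → (∀ v → member H v ≡ kept n v) → Optimal G H
  optimal H H≡ = (conn⇒connected H conn , balanced⁺ H (trans min≡ (sym maj≡))) , best-size
    where
    k = opt vertices
    min≡ : inMinority H ≡ k
    min≡ = trans (count-cong F (λ x _ → cong (_∧ minority x) (H≡ x))) (proj₁ (proj₂ (proj₂ kept-balanced)))
    maj≡ : inMajority H ≡ k
    maj≡ = trans (count-cong F (λ x _ → cong (_∧ not (minority x)) (H≡ x))) (proj₂ (proj₂ (proj₂ kept-balanced)))
    conn : Conn (member H)
    conn a∈ b∈ = gmap (λ x → x) (λ (x∈ , y∈ , e) → trans (H≡ _) x∈ , trans (H≡ _) y∈ , e)
      (proj₁ (proj₂ kept-balanced) (trans (sym (H≡ _)) a∈) (trans (sym (H≡ _)) b∈))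
    best-size : ∀ H′ → Feasible G H′ → ∣ H′ ∣ ≤ ∣ H ∣
    best-size H′ (conn′ , bal′) = begin
      ∣ H′ ∣                          ≡⟨ size-split H′ ⟩
      inMinority H′ + inMajority H′   ≡⟨ cong (inMinority H′ +_) (balanced⁻ H′ bal′) ⟨
      inMinority H′ + inMinority H′   ≤⟨ +-mono-≤ k′≤k k′≤k ⟩
      k + k                           ≡⟨ cong₂ _+_ min≡ maj≡ ⟨
      inMinority H + inMajority H     ≡⟨ size-split H ⟨
      ∣ H ∣                           ∎
      where
      open ≤-Reasoning
      k′≤k : inMinority H′ ≤ k
      k′≤k = opt-complete (λ x x∈ → x∈)
        (member⊆vertices H′ , connected⇒conn H′ conn′ , refl , sym (balanced⁻ H′ bal′))

  member-output : ∀ (σ : Memory) → (∀ v → v < n → σ v ≡ 𝟙 (kept n v)) → ∀ v → member (output n σ) v ≡ kept n v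
  member-output σ out v = by (v <? n)
    where
    nonzero : ∀ b → isNonzero (𝟙 b) ≡ b
    nonzero true = refl
    nonzero false = refl
    by : Dec (v < n) → member (output n σ) v ≡ kept n v
    by (yes v<n) = subst (λ x → member (output n σ) x ≡ kept n x) (toℕ-fromℕ< v<n)
      (trans (member-lookup (output n σ) w) (trans (lookup∘tabulate (λ v → isNonzero (σ (toℕ v))) w)
        (trans (cong isNonzero (out (toℕ w) (toℕ<n w))) (nonzero _))))
      where w = fromℕ< v<n
    by (no v≮n) = trans (≢true⇒false λ v∈ → v≮n (member<n (output n σ) v v∈))
      (sym (≢true⇒false λ v∈ → v≮n (<ᵇ-true⁻ v n (kept⊆ n v v∈))))

solution : Program
solution = tableProgram sizeE entryE

factor : ℕ → ℕ
factor = timeFactor sizeE entryE poly-tableBits poly-rounds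

solves : SolvesBCSInTime solution (λ n → 2 ^ ⌊ n /2⌋ * factor n)
solves {n} G = finish (Bounding.program-ok n (encode G) refl (Encoding.edge-sym G) (Encoding.I-beyond G) (Encoding.I-small G))
  where
  finish : (∃[ t ] ∃[ σ ] ⟨ solution , encode G ⟩⇓⟨ t , σ ⟩ × t ≤ 2 ^ ⌊ n /2⌋ * factor n × _) →
           ∃[ t ] ∃[ σ ] ⟨ solution , encode G ⟩⇓⟨ t , σ ⟩ × t ≤ 2 ^ ⌊ n /2⌋ * factor n × Optimal G (output n σ)
  finish (t , σ , run , t≤ , out) = t , σ , run , t≤ , Correctness.optimal G (output n σ) (Correctness.member-output G σ out)

theorem10 : ∃[ p ] ∃[ T ] (SolvesBCSInTime p T × O*[2^n/2] T)
theorem10 = solution , (λ n → 2 ^ ⌊ n /2⌋ * factor n) , solves ,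
  O*-poly (poly-timeFactor sizeE entryE poly-tableBits poly-rounds)
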